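{- The following hold, where $o(1)$ denotes a quantity tending to $0$ as $m\to\infty$ (with $k$ fixed), and the upper bounds in (2) and (3) hold for every positive integer $m$. \begin{enumerate} \item $\rho(C_4,m)=(1+o(1))\dfrac{m^2}{4}$. \item $(1+o(1))\left(\dfrac{m}{6}\right)^{3}\le \rho(C_6,m)\le 3\left(\dfrac{m}{6}\right)^{3}$. \item For every even integer $k=2l\ge 8$, $$(1+o(1))\left(\frac{m}{k}\right)^{k/2}\le \rho(C_k,m)\le \left(\frac{m}{2l}\right)^{l}\left(1+\frac{1}{l-1}\right)^{l-1}\le e\left(\frac{m}{k}\right)^{k/2}.$$ \end{enumerate}
   Context: Graphs are finite, simple and undirected. $C_k$ denotes the cycle on $k$ vertices. For graphs $G$ and $H$, $c(G,H)$ is the number of induced copies of $H$ in $G$, i.e. the number of subsets $S\subseteq V(G)$ such that the induced subgraph $G[S]$ is isomorphic to $H$. For a positive integer $m$, $\rho(H,m)=\max\{c(G,H) : G \text{ a graph with } |E(G)|=m\}$ (the number of vertices of $G$ is not restricted). Here $e$ is the base of the natural logarithm. -}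

module Defs where

open import Data.Bool using (Bool; true; false; _∧_; _∨_; not)
import Data.Bool.Properties as Bool
open import Data.Fin as Fin using (Fin; zero; suc; toℕ; finToFun; funToFin; combine; remQuot)
import Data.Fin.Properties as Fin
open import Data.Fin.Subset using (Subset; _∈_; inside; outside)
import Data.Fin.Subset.Properties as Subset
open import Data.Integer as ℤ using (+_; +[1+_]; +≤+)
open import Data.List as List using (List; []; _∷_; _++_; map; length; filter; allFin; cartesianProduct; concatMap; upTo; deduplicate)
import Data.List.Properties as List
open import Data.List.Extrema.Nat using (argmax; argmax-all; f[xs]≤f[argmax])
open import Data.List.Membership.Propositional renaming (_∈_ to _∈ₗ_)
open import Data.List.Membership.Propositional.Properties using (∈-∃++; ∈-filter⁺; ∈-filter⁻; ∈-cartesianProduct⁺; ∈-allFin; ∈-map⁺; ∈-map⁻; ∈-++⁺ˡ; ∈-++⁺ʳ; ∈-++⁻; ∈-deduplicate⁺; ∈-deduplicate⁻; ∈-upTo⁺; ∈-concatMap⁺; ∈-lookup)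
open import Data.List.Relation.Unary.All as All using ([]; _∷_)
import Data.List.Relation.Unary.All.Properties as All
open import Data.List.Relation.Unary.AllPairs using ([]; _∷_)
open import Data.List.Relation.Unary.Any as Any using (here; there)
import Data.List.Relation.Unary.Any.Properties as Any
open import Data.List.Relation.Unary.Unique.Propositional using (Unique)
import Data.List.Relation.Unary.Unique.Propositional.Properties as Unique
import Data.List.Relation.Unary.Unique.DecPropositional.Properties as UniqueDec
open import Data.Nat as ℕ using (ℕ; zero; suc; _≤_; s≤s; z≤n; _≡ᵇ_; ∣_-_∣; _!)
import Data.Nat.Properties as ℕ
open import Data.Nat.Tactic.RingSolver using (solve-∀)
open import Data.Product using (Σ-syntax; ∃; ∃-syntax; _×_; _,_; proj₁; proj₂; uncurry)
open import Data.Rational.Unnormalised as ℚᵘ using (ℚᵘ; mkℚᵘ; 0ℚᵘ; 1ℚᵘ; *≤*; *<*)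
import Data.Rational.Unnormalised.Properties as ℚᵘ
import Data.Rational.Unnormalised.Solver as ℚᵘ-Solver
open import Data.Sum using (_⊎_; inj₁; inj₂)
open import Data.Vec using ([]; _∷_; lookup; tabulate; here; there)
import Data.Vec.Properties as Vec
open import Function using (_∘_; id; _↔_; Inverse; mk↔ₛ′)
open import Relation.Binary.Definitions using (tri<; tri≈; tri>)
open import Relation.Binary.PropositionalEquality using (_≡_; _≢_; refl; sym; trans; cong; cong₂; subst)
open import Relation.Nullary using (¬_; Dec; yes; no; ⌊_⌋; contradiction)
open import Relation.Nullary.Decidable using (_×-dec_; _→-dec_; map′)
open import Relation.Unary using (Decidable)

record Graph (V : Set) : Set where
  field
    adj        : V → V → Bool
    adj-sym    : ∀ u v → adj u v ≡ adj v u
    adj-irrefl : ∀ v → adj v v ≡ false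

open Graph public

infix 4 _≅_

_≅_ : {V W : Set} → Graph V → Graph W → Set
_≅_ {V} {W} G H =
  Σ[ f ∈ V ↔ W ] ∀ u v → adj G u v ≡ adj H (Inverse.to f u) (Inverse.to f v)

infix 8 _[_]

_[_] : ∀ {n} → Graph (Fin n) → (S : Subset n) → Graph (∃[ v ] v ∈ S)
adj        (G [ S ]) u v = adj G (proj₁ u) (proj₁ v)
adj-sym    (G [ S ]) u v = adj-sym G (proj₁ u) (proj₁ v)
adj-irrefl (G [ S ]) v   = adj-irrefl G (proj₁ v)

-- Each undirected edge is listed once, with its smaller endpoint first.
edges : ∀ {n} → Graph (Fin n) → List (Fin n × Fin n)
edges {n} G =
  filter (λ (u , v) → (u Fin.<? v) ×-dec (adj G u v Bool.≟ true))
         (cartesianProduct (allFin n) (allFin n))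

∣E_∣ : ∀ {n} → Graph (Fin n) → ℕ
∣E G ∣ = length (edges G)

subsets : ∀ n → List (Subset n)
subsets zero    = [] ∷ []
subsets (suc n) = map (inside ∷_) (subsets n) ++ map (outside ∷_) (subsets n)

∈-irrelevant : ∀ {n} {S : Subset n} {v} (p q : v ∈ S) → p ≡ q
∈-irrelevant here      here      = refl
∈-irrelevant (there p) (there q) = cong there (∈-irrelevant p q)

Σ-≡ : ∀ {n} {S : Subset n} {u v : ∃[ v ] v ∈ S} → proj₁ u ≡ proj₁ v → u ≡ v
Σ-≡ {u = _ , p} {_ , q} refl = cong (_ ,_) (∈-irrelevant p q)

module _ {n h} (G : Graph (Fin n)) (S : Subset n) (H : Graph (Fin h)) where

  private
    Parametrises : (Fin h → Fin n) → Set
    Parametrises g =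
      (∀ i → g i ∈ S) ×
      (∀ i j → g i ≡ g j → i ≡ j) ×
      (∀ v → v ∈ S → ∃[ i ] g i ≡ v) ×
      (∀ i j → adj H i j ≡ adj G (g i) (g j))

    parametrises? : Decidable Parametrises
    parametrises? g =
      Fin.all? (λ i → g i Subset.∈? S) ×-dec
      Fin.all? (λ i → Fin.all? λ j → (g i Fin.≟ g j) →-dec (i Fin.≟ j)) ×-dec
      Fin.all? (λ v → (v Subset.∈? S) →-dec Fin.any? λ i → g i Fin.≟ v) ×-dec
      Fin.all? (λ i → Fin.all? λ j → adj H i j Bool.≟ adj G (g i) (g j))

    resp : ∀ {f g} → (∀ i → f i ≡ g i) → Parametrises f → Parametrises g
    resp f≗g (a , b , c , d) =
      (λ i → subst (_∈ S) (f≗g i) (a i)) ,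
      (λ i j e → b i j (trans (f≗g i) (trans e (sym (f≗g j))))) ,
      (λ v v∈S → let (i , e) = c v v∈S in i , trans (sym (f≗g i)) e) ,
      (λ i j → trans (d i j) (cong₂ (adj G) (f≗g i) (f≗g j)))

    fromIso : G [ S ] ≅ H → ∃ Parametrises
    fromIso (f , p) = (λ i → proj₁ (from i)) ,
      (λ i → proj₂ (from i)) ,
      (λ i j e → trans (sym (strictlyInverseˡ i)) (trans (cong to (Σ-≡ e)) (strictlyInverseˡ j))) ,
      (λ v v∈S → to (v , v∈S) , cong proj₁ (strictlyInverseʳ (v , v∈S))) ,
      (λ i j → trans (sym (cong₂ (adj H) (strictlyInverseˡ i) (strictlyInverseˡ j))) (sym (p (from i) (from j))))
      where open Inverse f

    toIso : ∃ Parametrises → G [ S ] ≅ H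
    toIso (g , a , b , c , d) =
      mk↔ₛ′ (λ (v , v∈S) → proj₁ (c v v∈S)) (λ i → g i , a i)
            (λ i → b _ _ (proj₂ (c (g i) (a i))))
            (λ (v , v∈S) → Σ-≡ (proj₂ (c v v∈S))) ,
      λ (u , u∈S) (v , v∈S) →
        sym (trans (d _ _) (cong₂ (adj G) (proj₂ (c u u∈S)) (proj₂ (c v v∈S))))

  induced≅? : Dec (G [ S ] ≅ H)
  induced≅? = map′ (λ (i , p) → toIso (finToFun i , p))
              (λ iso → let (g , p) = fromIso iso in
                funToFin g , resp (λ i → sym (Fin.finToFun-funToFin g i)) p)
              (Fin.any? λ i → parametrises? (finToFun i))

c : ∀ {n h} → Graph (Fin n) → Graph (Fin h) → ℕ
c {n} G H = length (filter (λ S → induced≅? G S H) (subsets n))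

IsMaximumCopies : ∀ {h} → Graph (Fin h) → ℕ → ℕ → Set
IsMaximumCopies H m r =
  (∃[ n ] Σ[ G ∈ Graph (Fin n) ] ∣E G ∣ ≡ m × c G H ≡ r) ×
  (∀ n (G : Graph (Fin n)) → ∣E G ∣ ≡ m → c G H ≤ r)

NoIsolatedVertex : ∀ {n} → Graph (Fin n) → Set
NoIsolatedVertex G = ∀ v → ∃[ w ] adj G v w ≡ true

noIsolatedVertex? : ∀ {n} (G : Graph (Fin n)) → Dec (NoIsolatedVertex G)
noIsolatedVertex? G = Fin.all? λ v → Fin.any? λ w → adj G v w Bool.≟ true

-- If H has no isolated vertex, the maximum exists: isolated vertices of the
-- host graph contribute no copies, so hosts with at most 2m vertices suffice.
module MaximumExists where

  -- An injective relation from xs into ys.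
  length-≤ : ∀ {A B : Set} (R : A → B → Set) (xs : List A) (ys : List B) →
    Unique xs → (∀ {x} → x ∈ₗ xs → ∃[ y ] y ∈ₗ ys × R x y) →
    (∀ {x x′ y} → R x y → R x′ y → x ≡ x′) → length xs ≤ length ys
  length-≤ R []       ys u        tot inj = z≤n
  length-≤ R (x ∷ xs) ys (x∉ ∷ u) tot inj
    with y , y∈ , r ← tot (here refl)
    with ps , qs , refl ← ∈-∃++ y∈ =
    ℕ.≤-trans (s≤s (length-≤ R xs (ps ++ qs) u tot′ inj)) (ℕ.≤-reflexive eq)
    where
    tot′ : ∀ {z} → z ∈ₗ xs → ∃[ w ] w ∈ₗ ps ++ qs × R z w
    tot′ z∈ with w , w∈ , rw ← tot (there z∈) with ∈-++⁻ ps w∈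
    ... | inj₁ w∈ps         = w , ∈-++⁺ˡ w∈ps , rw
    ... | inj₂ (there w∈qs) = w , ∈-++⁺ʳ ps w∈qs , rw
    ... | inj₂ (here refl)  = contradiction (inj r rw) (All.lookup x∉ z∈)
    eq : suc (length (ps ++ qs)) ≡ length (ps ++ y ∷ qs)
    eq = trans (cong suc (List.length-++ ps))
           (trans (sym (ℕ.+-suc (length ps) (length qs))) (sym (List.length-++ ps)))

  lookup-injective : ∀ {A : Set} {xs : List A} → Unique xs →
    ∀ i j → List.lookup xs i ≡ List.lookup xs j → i ≡ j
  lookup-injective (_ ∷ _)  zero    zero    e = refl
  lookup-injective (x∉ ∷ _) zero    (suc j) e = contradiction e (All.lookup x∉ (∈-lookup j))
  lookup-injective (x∉ ∷ _) (suc i) zero    e = contradiction (sym e) (All.lookup x∉ (∈-lookup i))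
  lookup-injective (_ ∷ u)  (suc i) (suc j) e = cong suc (lookup-injective u i j e)

  ∈-subsets : ∀ {n} (S : Subset n) → S ∈ₗ subsets n
  ∈-subsets []            = here refl
  ∈-subsets (true ∷ S)    = ∈-++⁺ˡ (∈-map⁺ (inside ∷_) (∈-subsets S))
  ∈-subsets {suc n} (false ∷ S) = ∈-++⁺ʳ (map (inside ∷_) (subsets n)) (∈-map⁺ (outside ∷_) (∈-subsets S))

  subsets-unique : ∀ n → Unique (subsets n)
  subsets-unique zero    = [] ∷ []
  subsets-unique (suc n) =
    Unique.++⁺ (Unique.map⁺ Vec.∷-injectiveʳ (subsets-unique n))
               (Unique.map⁺ Vec.∷-injectiveʳ (subsets-unique n)) disjoint
    where
    disjoint : ∀ {S} → ¬ (S ∈ₗ map (inside ∷_) (subsets n) × S ∈ₗ map (outside ∷_) (subsets n))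
    disjoint (p , q) with _ , _ , refl ← ∈-map⁻ (inside ∷_) p with ∈-map⁻ (outside ∷_) q
    ... | _ , _ , ()

  module _ {n} (G : Graph (Fin n)) where

    edges-unique : Unique (edges G)
    edges-unique = Unique.filter⁺ _
      (Unique.cartesianProduct⁺ (Unique.allFin⁺ n) (Unique.allFin⁺ n))

    ∈-edges⁺ : ∀ {u v} → u Fin.< v → adj G u v ≡ true → (u , v) ∈ₗ edges G
    ∈-edges⁺ {u} {v} u<v a =
      ∈-filter⁺ _ (∈-cartesianProduct⁺ (∈-allFin u) (∈-allFin v)) (u<v , a)

    ∈-edges⁻ : ∀ {u v} → (u , v) ∈ₗ edges G → u Fin.< v × adj G u v ≡ true
    ∈-edges⁻ e = proj₂ (∈-filter⁻ (λ (u , v) → (u Fin.<? v) ×-dec (adj G u v Bool.≟ true)) {xs = cartesianProduct (allFin n) (allFin n)} e)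

    adj⇒≢ : ∀ {u v} → adj G u v ≡ true → u ≢ v
    adj⇒≢ {u} a refl = contradiction (trans (sym a) (adj-irrefl G u)) λ ()

  -- G′ is G with some isolated vertices removed, up to relabelling by g.
  module _ {n n′} (G : Graph (Fin n)) (G′ : Graph (Fin n′)) (g : Fin n′ → Fin n)
           (g-inj : ∀ i j → g i ≡ g j → i ≡ j)
           (g-adj : ∀ i j → adj G′ i j ≡ adj G (g i) (g j))
           (g-covers : ∀ v w → adj G v w ≡ true → ∃[ i ] g i ≡ v) where

    private
      Same : Fin n × Fin n → Fin n′ × Fin n′ → Set
      Same (u , v) (i , j) =
        (u Fin.< v × i Fin.< j) × ((g i ≡ u × g j ≡ v) ⊎ (g i ≡ v × g j ≡ u))

      same-injˡ : ∀ {e e′ f} → Same e f → Same e′ f → e ≡ e′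
      same-injˡ (_ , inj₁ (refl , refl)) (_ , inj₁ (refl , refl)) = refl
      same-injˡ (_ , inj₂ (refl , refl)) (_ , inj₂ (refl , refl)) = refl
      same-injˡ ((p , _) , inj₁ (refl , refl)) ((q , _) , inj₂ (refl , refl)) = contradiction q (Fin.<-asym p)
      same-injˡ ((p , _) , inj₂ (refl , refl)) ((q , _) , inj₁ (refl , refl)) = contradiction q (Fin.<-asym p)

      same-injʳ : ∀ {e f f′} → Same e f → Same e f′ → f ≡ f′
      same-injʳ (_ , inj₁ (a , b)) (_ , inj₁ (c , d)) = cong₂ _,_ (g-inj _ _ (trans a (sym c))) (g-inj _ _ (trans b (sym d)))
      same-injʳ (_ , inj₂ (a , b)) (_ , inj₂ (c , d)) = cong₂ _,_ (g-inj _ _ (trans a (sym c))) (g-inj _ _ (trans b (sym d)))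
      same-injʳ ((_ , p) , inj₁ (a , b)) ((_ , q) , inj₂ (c , d))
        with refl ← g-inj _ _ (trans a (sym d)) | refl ← g-inj _ _ (trans b (sym c)) = contradiction q (Fin.<-asym p)
      same-injʳ ((_ , p) , inj₂ (a , b)) ((_ , q) , inj₁ (c , d))
        with refl ← g-inj _ _ (trans a (sym d)) | refl ← g-inj _ _ (trans b (sym c)) = contradiction q (Fin.<-asym p)

      forward : ∀ {e} → e ∈ₗ edges G → ∃[ f ] f ∈ₗ edges G′ × Same e f
      forward {u , v} e∈
        with u<v , a ← ∈-edges⁻ G e∈
        with i , refl ← g-covers u v a
        with j , refl ← g-covers v u (trans (adj-sym G v u) a)
        with a′ ← trans (g-adj i j) a
        with Fin.<-cmp i j
      ... | tri< i<j _ _  = (i , j) , ∈-edges⁺ G′ i<j a′ , (u<v , i<j) , inj₁ (refl , refl)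
      ... | tri≈ _ i≡j _  = contradiction i≡j (adj⇒≢ G′ a′)
      ... | tri> _ _ j<i  = (j , i) , ∈-edges⁺ G′ j<i (trans (adj-sym G′ j i) a′) , (u<v , j<i) , inj₂ (refl , refl)

      backward : ∀ {f} → f ∈ₗ edges G′ → ∃[ e ] e ∈ₗ edges G × Same e f
      backward {i , j} f∈
        with i<j , a′ ← ∈-edges⁻ G′ f∈
        with a ← trans (sym (g-adj i j)) a′
        with Fin.<-cmp (g i) (g j)
      ... | tri< u<v _ _ = (g i , g j) , ∈-edges⁺ G u<v a , (u<v , i<j) , inj₁ (refl , refl)
      ... | tri≈ _ u≡v _ = contradiction u≡v (adj⇒≢ G a)
      ... | tri> _ _ v<u = (g j , g i) , ∈-edges⁺ G v<u (trans (adj-sym G _ _) a) , (v<u , i<j) , inj₂ (refl , refl)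

    same-edges : ∣E G ∣ ≡ ∣E G′ ∣
    same-edges = ℕ.≤-antisym
      (length-≤ Same (edges G) (edges G′) (edges-unique G) forward same-injˡ)
      (length-≤ (λ f e → Same e f) (edges G′) (edges G) (edges-unique G′) backward same-injʳ)

    copies-≤ : ∀ {h} (H : Graph (Fin h)) → NoIsolatedVertex H → c G H ≤ c G′ H
    copies-≤ H noIso = length-≤ Restricts _ _ (Unique.filter⁺ _ (subsets-unique n))
        (λ S∈ → _ , ∈-filter⁺ (λ S′ → induced≅? G′ S′ H) (∈-subsets _) (restrict-iso _ (iso S∈)) , covered _ (iso S∈) , refl)
        restricts-inj
      where
      restrict : Subset n → Subset n′
      restrict S = tabulate (lookup S ∘ g)

      Restricts : Subset n → Subset n′ → Set
      Restricts S S′ = (∀ v → v ∈ S → ∃[ i ] g i ≡ v) × restrict S ≡ S′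

      iso : ∀ {S} → S ∈ₗ filter (λ S → induced≅? G S H) (subsets n) → G [ S ] ≅ H
      iso S∈ = proj₂ (∈-filter⁻ (λ S → induced≅? G S H) {xs = subsets n} S∈)

      covered : ∀ S → G [ S ] ≅ H → ∀ v → v ∈ S → ∃[ i ] g i ≡ v
      covered S (f , p) v v∈S =
        let open Inverse f
            (w , a) = noIso (to (v , v∈S))
        in g-covers v (proj₁ (from w))
             (trans (p (v , v∈S) (from w)) (trans (cong (adj H _) (strictlyInverseˡ w)) a))

      ∈-restrict⁺ : ∀ {S i} → g i ∈ S → i ∈ restrict S
      ∈-restrict⁺ {S} {i} p = Vec.lookup⇒[]= i _ (trans (Vec.lookup∘tabulate _ i) (Vec.[]=⇒lookup p))

      ∈-restrict⁻ : ∀ {S i} → i ∈ restrict S → g i ∈ S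
      ∈-restrict⁻ {S} {i} p = Vec.lookup⇒[]= (g i) _ (trans (sym (Vec.lookup∘tabulate _ i)) (Vec.[]=⇒lookup p))

      restricts-inj : ∀ {S T S′} → Restricts S S′ → Restricts T S′ → S ≡ T
      restricts-inj {S} {T} (cS , refl) (cT , e) = Subset.⊆-antisym
        (λ {v} v∈S → let (i , q) = cS v v∈S in
          subst (_∈ T) q (∈-restrict⁻ (subst (i ∈_) (sym e) (∈-restrict⁺ (subst (_∈ S) (sym q) v∈S)))))
        (λ {v} v∈T → let (i , q) = cT v v∈T in
          subst (_∈ S) q (∈-restrict⁻ (subst (i ∈_) e (∈-restrict⁺ (subst (_∈ T) (sym q) v∈T)))))

      restrict-iso : ∀ S → G [ S ] ≅ H → G′ [ restrict S ] ≅ H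
      restrict-iso S ι@(f , p) = mk↔ₛ′ to′ from′
          (λ x → trans (cong to (Σ-≡ (proj₂ (covered S ι _ (proj₂ (from x)))))) (strictlyInverseˡ x))
          (λ (i , i∈) → Σ-≡ (g-inj _ _ (trans (proj₂ (covered S ι _ (proj₂ (from (to′ (i , i∈))))))
             (cong proj₁ (strictlyInverseʳ (g i , ∈-restrict⁻ i∈)))))) ,
          λ (i , i∈) (j , j∈) → trans (g-adj i j) (p (g i , ∈-restrict⁻ i∈) (g j , ∈-restrict⁻ j∈))
        where
        open Inverse f
        to′ : ∃[ i ] i ∈ restrict S → Fin _
        to′ (i , i∈) = to (g i , ∈-restrict⁻ i∈)
        from′ : Fin _ → ∃[ i ] i ∈ restrict S
        from′ x = let (v , v∈S) = from x ; (i , q) = covered S ι v v∈S in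
          i , ∈-restrict⁺ (subst (_∈ S) (sym q) v∈S)

  module _ {n} (G : Graph (Fin n)) where

    endpoints covers : List (Fin n)
    endpoints = map proj₁ (edges G) ++ map proj₂ (edges G)
    covers    = deduplicate Fin._≟_ endpoints

    removeIsolated : Graph (Fin (length covers))
    adj        removeIsolated i j = adj G (List.lookup covers i) (List.lookup covers j)
    adj-sym    removeIsolated i j = adj-sym G _ _
    adj-irrefl removeIsolated i   = adj-irrefl G _

    order-≤ : length covers ≤ ∣E G ∣ ℕ.+ ∣E G ∣
    order-≤ = ℕ.≤-trans
      (length-≤ _≡_ covers endpoints (UniqueDec.deduplicate-! Fin._≟_ endpoints)
        (λ x∈ → _ , ∈-deduplicate⁻ Fin._≟_ endpoints x∈ , refl) (λ { refl refl → refl }))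
      (ℕ.≤-reflexive (trans (List.length-++ (map proj₁ (edges G)))
        (cong₂ ℕ._+_ (List.length-map proj₁ (edges G)) (List.length-map proj₂ (edges G)))))

    covers-injective : ∀ i j → List.lookup covers i ≡ List.lookup covers j → i ≡ j
    covers-injective = lookup-injective (UniqueDec.deduplicate-! Fin._≟_ endpoints)

    covers-adj : ∀ v w → adj G v w ≡ true → ∃[ i ] List.lookup covers i ≡ v
    covers-adj v w a = Any.index v∈ , sym (Any.lookup-index v∈)
      where
      v∈endpoints : v ∈ₗ endpoints
      v∈endpoints with Fin.<-cmp v w
      ... | tri< v<w _ _ = ∈-++⁺ˡ (∈-map⁺ proj₁ (∈-edges⁺ G v<w a))
      ... | tri≈ _ v≡w _ = contradiction v≡w (adj⇒≢ G a)
      ... | tri> _ _ w<v = ∈-++⁺ʳ (map proj₁ (edges G)) (∈-map⁺ proj₂ (∈-edges⁺ G w<v (trans (adj-sym G w v) a)))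
      v∈ : v ∈ₗ covers
      v∈ = ∈-deduplicate⁺ Fin._≟_ v∈endpoints

  fromBits : ∀ n → Subset (n ℕ.* n) → Graph (Fin n)
  fromBits n bits = record
    { adj        = λ i j → not ⌊ i Fin.≟ j ⌋ ∧ (bit i j ∨ bit j i)
    ; adj-sym    = λ i j → cong₂ _∧_ (cong not (≟-sym i j)) (Bool.∨-comm (bit i j) (bit j i))
    ; adj-irrefl = irrefl
    }
    where
    bit : Fin n → Fin n → Bool
    bit i j = lookup bits (combine i j)
    ≟-sym : ∀ i j → ⌊ i Fin.≟ j ⌋ ≡ ⌊ j Fin.≟ i ⌋
    ≟-sym i j with i Fin.≟ j | j Fin.≟ i
    ... | yes _ | yes _ = refl
    ... | no _  | no _  = refl
    ... | yes p | no q  = contradiction (sym p) q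
    ... | no p  | yes q = contradiction (sym q) p
    irrefl : ∀ i → not ⌊ i Fin.≟ i ⌋ ∧ (bit i i ∨ bit i i) ≡ false
    irrefl i with i Fin.≟ i
    ... | yes _ = refl
    ... | no p  = contradiction refl p

  toBits : ∀ {n} → Graph (Fin n) → Subset (n ℕ.* n)
  toBits {n} G = tabulate (uncurry (adj G) ∘ remQuot n)

  fromBits-toBits : ∀ {n} (G : Graph (Fin n)) i j → adj (fromBits n (toBits G)) i j ≡ adj G i j
  fromBits-toBits {n} G i j = trans (cong₂ (λ a b → not ⌊ i Fin.≟ j ⌋ ∧ (a ∨ b)) (bit i j) (trans (bit j i) (adj-sym G j i))) simplify
    where
    bit : ∀ i j → lookup (toBits G) (combine i j) ≡ adj G i j
    bit i j = trans (Vec.lookup∘tabulate _ (combine i j)) (cong (uncurry (adj G)) (Fin.remQuot-combine i j))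
    simplify : not ⌊ i Fin.≟ j ⌋ ∧ (adj G i j ∨ adj G i j) ≡ adj G i j
    simplify with i Fin.≟ j
    ... | yes refl = sym (adj-irrefl G i)
    ... | no _     = Bool.∨-idem (adj G i j)

  star : ∀ m → Graph (Fin (suc m))
  star m = record { adj = a ; adj-sym = a-sym ; adj-irrefl = a-irrefl }
    where
    a : Fin (suc m) → Fin (suc m) → Bool
    a zero    (suc _) = true
    a (suc _) zero    = true
    a zero    zero    = false
    a (suc _) (suc _) = false
    a-sym : ∀ u v → a u v ≡ a v u
    a-sym zero    zero    = refl
    a-sym zero    (suc _) = refl
    a-sym (suc _) zero    = refl
    a-sym (suc _) (suc _) = refl
    a-irrefl : ∀ v → a v v ≡ false
    a-irrefl zero    = refl
    a-irrefl (suc _) = refl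

  star-edges : ∀ m → ∣E star m ∣ ≡ m
  star-edges m = trans (ℕ.≤-antisym
      (length-≤ (λ e j → Leaf j e) (edges (star m)) (allFin m) (edges-unique (star m)) toLeaf λ { refl refl → refl })
      (length-≤ Leaf (allFin m) (edges (star m)) (Unique.allFin⁺ m) (λ {j} _ → _ , ∈-edges⁺ (star m) {zero} {suc j} (s≤s z≤n) refl , refl) λ { refl refl → refl }))
    (List.length-tabulate id)
    where
    Leaf : Fin m → Fin (suc m) × Fin (suc m) → Set
    Leaf j e = e ≡ (zero , suc j)
    toLeaf : ∀ {e} → e ∈ₗ edges (star m) → ∃[ j ] j ∈ₗ allFin m × Leaf j e
    toLeaf {u , v} e∈ with ∈-edges⁻ (star m) e∈
    toLeaf {zero  , suc j} e∈ | _ , _ = j , ∈-allFin j , refl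
    toLeaf {zero  , zero}  e∈ | () , _
    toLeaf {suc _ , zero}  e∈ | () , _
    toLeaf {suc _ , suc _} e∈ | _ , ()

  module _ {n} (G : Graph (Fin n)) where

    removeIsolated-edges : ∣E G ∣ ≡ ∣E removeIsolated G ∣
    removeIsolated-edges = same-edges G (removeIsolated G) (List.lookup (covers G))
      (covers-injective G) (λ _ _ → refl) (covers-adj G)

    removeIsolated-copies : ∀ {h} (H : Graph (Fin h)) → NoIsolatedVertex H → c G H ≤ c (removeIsolated G) H
    removeIsolated-copies = copies-≤ G (removeIsolated G) (List.lookup (covers G))
      (covers-injective G) (λ _ _ → refl) (covers-adj G)

    fromBits-edges : ∣E G ∣ ≡ ∣E fromBits n (toBits G) ∣
    fromBits-edges = same-edges G (fromBits n (toBits G)) id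
      (λ _ _ → id) (fromBits-toBits G) (λ v _ _ → v , refl)

    fromBits-copies : ∀ {h} (H : Graph (Fin h)) → NoIsolatedVertex H → c G H ≤ c (fromBits n (toBits G)) H
    fromBits-copies = copies-≤ G (fromBits n (toBits G)) id
      (λ _ _ → id) (fromBits-toBits G) (λ v _ _ → v , refl)

  compress : ∀ {n h} (G : Graph (Fin n)) (H : Graph (Fin h)) → NoIsolatedVertex H →
    Σ[ n′ ∈ ℕ ] Σ[ bits ∈ Subset (n′ ℕ.* n′) ]
      (n′ ≤ ∣E G ∣ ℕ.+ ∣E G ∣) × (∣E G ∣ ≡ ∣E fromBits n′ bits ∣) × (c G H ≤ c (fromBits n′ bits) H)
  compress G H noIso =
    length (covers G) , toBits (removeIsolated G) , order-≤ G ,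
    trans (removeIsolated-edges G) (fromBits-edges (removeIsolated G)) ,
    ℕ.≤-trans (removeIsolated-copies G H noIso) (fromBits-copies (removeIsolated G) H noIso)

  max-among : ∀ {A : Set} (f : A → ℕ) {P : A → Set} → Decidable P → ∃ P → (xs : List A) →
    ∃[ a ] P a × (∀ {x} → x ∈ₗ xs → P x → f x ≤ f a)
  max-among f P? (d , Pd) xs =
    argmax f d (filter P? xs) , argmax-all f Pd (All.all-filter P? xs) ,
    λ x∈ Px → All.lookup (f[xs]≤f[argmax] {f = f} d (filter P? xs)) (∈-filter⁺ P? x∈ Px)

  Host : Set
  Host = Σ[ n ∈ ℕ ] Graph (Fin n)

  hosts : ∀ N → ∃[ Gs ] (∀ {n} → n ≤ N → ∀ bits → (n , fromBits n bits) ∈ₗ Gs)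
  hosts N = concatMap hostsOn (upTo (suc N)) ,
    λ n≤N bits → ∈-concatMap⁺ hostsOn (lose (∈-upTo⁺ (s≤s n≤N)) (∈-map⁺ _ (∈-subsets bits)))
    where
    hostsOn : ℕ → List Host
    hostsOn n = map (λ bits → n , fromBits n bits) (subsets (n ℕ.* n))

  opaque
    maximum-exists : ∀ {h} (H : Graph (Fin h)) → NoIsolatedVertex H → ∀ m → ∃[ r ] IsMaximumCopies H m r
    maximum-exists H noIso m = c (proj₂ best) H , (_ , proj₂ best , best-edges , refl) , bound
      where
      copies : Host → ℕ
      copies (_ , G) = c G H

      Good : Host → Set
      Good (_ , G) = ∣E G ∣ ≡ m

      maximal : Σ[ G ∈ Host ] Good G × (∀ {G′} → G′ ∈ₗ proj₁ (hosts (m ℕ.+ m)) → Good G′ → copies G′ ≤ copies G)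
      maximal = max-among copies (λ (_ , G) → ∣E G ∣ ℕ.≟ m) ((suc m , star m) , star-edges m) (proj₁ (hosts (m ℕ.+ m)))

      best : Host
      best = proj₁ maximal

      best-edges : Good best
      best-edges = proj₁ (proj₂ maximal)

      bound : ∀ n (G : Graph (Fin n)) → ∣E G ∣ ≡ m → c G H ≤ copies best
      bound n G ∣E∣≡m =
        let (n′ , bits , n′≤ , ∣E∣≡ , c≤) = compress G H noIso
            n′≤m+m = ℕ.≤-trans n′≤ (ℕ.≤-reflexive (cong (λ x → x ℕ.+ x) ∣E∣≡m))
        in ℕ.≤-trans c≤ (proj₂ (proj₂ maximal) {n′ , fromBits n′ bits}
             (proj₂ (hosts (m ℕ.+ m)) n′≤m+m bits) (trans (sym ∣E∣≡) ∣E∣≡m))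

-- The number of vertices is not restricted, so the maximum need not exist when
-- H has isolated vertices; the value 0 is then a placeholder.
ρ : ∀ {h} → Graph (Fin h) → ℕ → ℕ
ρ H m with noIsolatedVertex? H
... | yes p = proj₁ (MaximumExists.maximum-exists H p m)
... | no _  = 0

ρ-isMaximum : ∀ {h} (H : Graph (Fin h)) → NoIsolatedVertex H → ∀ m → IsMaximumCopies H m (ρ H m)
ρ-isMaximum H noIso m with noIsolatedVertex? H
... | yes p = proj₂ (MaximumExists.maximum-exists H p m)
... | no ¬p = contradiction noIso ¬p

-- i and j are adjacent iff they differ by 1 or by k - 1; this is the cycle on
-- k vertices for k ≥ 3.
C : ∀ k → Graph (Fin k)
C k = record
  { adj        = λ i j → adjacent ∣ toℕ i - toℕ j ∣
  ; adj-sym    = λ i j → cong adjacent (ℕ.∣-∣-comm (toℕ i) (toℕ j))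
  ; adj-irrefl = λ i → cong adjacent (ℕ.∣n-n∣≡0 (toℕ i))
  }
  where
  adjacent : ℕ → Bool
  adjacent zero      = false
  adjacent d@(suc _) = (d ≡ᵇ 1) ∨ (suc d ≡ᵇ k)

C-noIsolatedVertex : ∀ k → 3 ≤ k → NoIsolatedVertex (C k)
C-noIsolatedVertex 1 (s≤s ()) _
C-noIsolatedVertex (suc (suc k)) _ zero    = suc zero , refl
C-noIsolatedVertex (suc (suc k)) _ (suc i) = Fin.inject₁ i , consecutive
  where
  gap : ∣ suc (toℕ i) - toℕ (Fin.inject₁ i) ∣ ≡ 1
  gap rewrite Fin.toℕ-inject₁ i = trans (ℕ.∣-∣-comm (suc (toℕ i)) (toℕ i))
      (trans (cong (λ x → ∣ toℕ i - x ∣) (ℕ.+-comm 1 (toℕ i))) (ℕ.∣m-m+n∣≡n (toℕ i) 1))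
  consecutive : adj (C (suc (suc k))) (suc i) (Fin.inject₁ i) ≡ true
  consecutive rewrite gap = refl

ρ-C-isMaximum : ∀ k → 3 ≤ k → ∀ m → IsMaximumCopies (C k) m (ρ (C k) m)
ρ-C-isMaximum k k≥3 = ρ-isMaximum (C k) (C-noIsolatedVertex k k≥3)

open import Algebra.Definitions.RawSemiring ℚᵘ.+-*-rawSemiring public using (_^_)

infix 7 _÷_

-- p ÷ 0 is a placeholder.
_÷_ : ℕ → ℕ → ℚᵘ
p ÷ zero      = 0ℚᵘ
p ÷ q@(suc _) = + p ℚᵘ./ q

infix 4 _→0

_→0 : (ℕ → ℚᵘ) → Set
δ →0 = ∀ ε → 0ℚᵘ ℚᵘ.< ε → ∃[ N ] (∀ m → N ≤ m → ℚᵘ.∣ δ m ∣ ℚᵘ.≤ ε)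

IsCauchy : (ℕ → ℚᵘ) → Set
IsCauchy x =
  ∀ ε → 0ℚᵘ ℚᵘ.< ε → ∃[ N ] (∀ m n → N ≤ m → N ≤ n → ℚᵘ.∣ x m ℚᵘ.- x n ∣ ℚᵘ.≤ ε)

-- Real numbers as Cauchy sequences of rationals; x and y are equal when
-- x ≤ᴿ y and y ≤ᴿ x.
record ℝ : Set where
  field
    approx : ℕ → ℚᵘ
    cauchy : IsCauchy approx

open ℝ public

infix 4 _≤ᴿ_

_≤ᴿ_ : ℝ → ℝ → Set
x ≤ᴿ y =
  ∀ ε → 0ℚᵘ ℚᵘ.< ε → ∃[ N ] (∀ n → N ≤ n → approx x n ℚᵘ.≤ approx y n ℚᵘ.+ ε)

fromℚᵘ : ℚᵘ → ℝ
approx (fromℚᵘ q) _ = q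
cauchy (fromℚᵘ q) ε 0<ε =
  0 , λ _ _ _ _ → ℚᵘ.≤-trans (ℚᵘ.≤-reflexive (ℚᵘ.∣-∣-cong (ℚᵘ.+-inverseʳ q))) (ℚᵘ.<⇒≤ 0<ε)

infixr 7 _·_

_·_ : ℚᵘ → ℝ → ℝ
approx (q · x) n = q ℚᵘ.* approx x n
cauchy (q · x) ε 0<ε =
  let (N , close) = cauchy x ε/k 0<ε/k in N , λ m n N≤m N≤n →
    begin
      ℚᵘ.∣ q ℚᵘ.* approx x m ℚᵘ.- q ℚᵘ.* approx x n ∣   ≃⟨ ℚᵘ.∣-∣-cong (factor (approx x m) (approx x n)) ⟩
      ℚᵘ.∣ q ℚᵘ.* (approx x m ℚᵘ.- approx x n) ∣        ≃⟨ ℚᵘ.∣p*q∣≃∣p∣*∣q∣ q _ ⟩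
      ℚᵘ.∣ q ∣ ℚᵘ.* ℚᵘ.∣ approx x m ℚᵘ.- approx x n ∣   ≤⟨ ℚᵘ.*-monoʳ-≤-nonNeg ℚᵘ.∣ q ∣ {{ℚᵘ.∣-∣-nonNeg q}} (close m n N≤m N≤n) ⟩
      ℚᵘ.∣ q ∣ ℚᵘ.* ε/k                                 ≤⟨ ℚᵘ.*-monoˡ-≤-nonNeg ε/k {{ℚᵘ.nonNegative (ℚᵘ.<⇒≤ 0<ε/k)}} (ℚᵘ.p≤p+q ℚᵘ.∣ q ∣ 1ℚᵘ) ⟩
      k ℚᵘ.* (ℚᵘ.1/ k ℚᵘ.* ε)                           ≃⟨ ℚᵘ.≃-trans (ℚᵘ.≃-sym (ℚᵘ.*-assoc k (ℚᵘ.1/ k) ε)) (ℚᵘ.≃-trans (ℚᵘ.*-congʳ (ℚᵘ.*-inverseʳ k)) (ℚᵘ.*-identityˡ ε)) ⟩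
      ε                                                 ∎
  where
  open ℚᵘ.≤-Reasoning
  k = ℚᵘ.∣ q ∣ ℚᵘ.+ 1ℚᵘ
  instance
    k>0 : ℚᵘ.Positive k
    k>0 = ℚᵘ.positive (ℚᵘ.+-mono-≤-< (ℚᵘ.0≤∣p∣ q) (ℚᵘ.positive⁻¹ 1ℚᵘ))
    k≢0 : ℚᵘ.NonZero k
    k≢0 = ℚᵘ.pos⇒nonZero k
  ε/k = ℚᵘ.1/ k ℚᵘ.* ε
  0<ε/k : 0ℚᵘ ℚᵘ.< ε/k
  0<ε/k = ℚᵘ.positive⁻¹ ε/k {{ℚᵘ.pos*pos⇒pos (ℚᵘ.1/ k) {{ℚᵘ.1/pos⇒pos k}} ε {{ℚᵘ.positive 0<ε}}}}
  factor : ∀ a b → q ℚᵘ.* a ℚᵘ.- q ℚᵘ.* b ℚᵘ.≃ q ℚᵘ.* (a ℚᵘ.- b)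
  factor a b = ℚᵘ.≃-sym (ℚᵘ.≃-trans (ℚᵘ.*-distribˡ-+ q a (ℚᵘ.- b))
    (ℚᵘ.+-congʳ (q ℚᵘ.* a) (ℚᵘ.≃-sym (ℚᵘ.neg-distribʳ-* q b))))

-- e = Σ 1/i!
e-partialSum : ℕ → ℚᵘ
e-partialSum zero    = 1ℚᵘ
e-partialSum (suc n) = e-partialSum n ℚᵘ.+ 1 ÷ (suc n !)

e-partialSum-cauchy : IsCauchy e-partialSum
e-partialSum-cauchy (mkℚᵘ (+ 0) _) (*<* (ℤ.+<+ ()))
e-partialSum-cauchy (mkℚᵘ ℤ.-[1+ _ ] _) (*<* ())
e-partialSum-cauchy ε@(mkℚᵘ +[1+ p ] q) _ = suc q , λ m n N≤m N≤n →
    ℚᵘ.≤-trans (close (lower N≤m) (lower N≤n) (upper N≤m) (upper N≤n)) small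
  where
  S f : ℕ → ℚᵘ
  S = e-partialSum
  f n = 1 ÷ (n !)

  ÷-nonNeg : ∀ p q → 0ℚᵘ ℚᵘ.≤ p ÷ q
  ÷-nonNeg p zero    = ℚᵘ.≤-refl
  ÷-nonNeg p (suc q) = ℚᵘ.nonNegative⁻¹ (mkℚᵘ (+ p) q)

  halve : ∀ a b → 1 ≤ b → 2 ℕ.* b ≤ a → (1 ÷ a) ℚᵘ.+ (1 ÷ a) ℚᵘ.≤ 1 ÷ b
  halve (suc a) (suc b) _ 2b≤a = *≤* (+≤+ (ℕ.≤-trans (ℕ.≤-reflexive (regroup (suc a) (suc b)))
    (ℕ.≤-trans (ℕ.*-monoʳ-≤ (suc a) 2b≤a) (ℕ.≤-reflexive (sym (ℕ.*-identityˡ (suc a ℕ.* suc a)))))))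
    where
    regroup : ∀ a b → (1 ℕ.* a ℕ.+ 1 ℕ.* a) ℕ.* b ≡ a ℕ.* (2 ℕ.* b)
    regroup = solve-∀

  lower : ∀ {N n} → N ≤ n → S N ℚᵘ.≤ S n
  lower N≤n = go (ℕ.≤⇒≤′ N≤n)
    where
    go : ∀ {N n} → N ℕ.≤′ n → S N ℚᵘ.≤ S n
    go ℕ.≤′-refl                   = ℚᵘ.≤-refl
    go (ℕ.≤′-step {n = n} N≤n) = ℚᵘ.≤-trans (go N≤n)
      (ℚᵘ.p≤p+q (S n) (f (suc n)) {{ℚᵘ.nonNegative (÷-nonNeg 1 (suc n !))}})

  upper : ∀ {N n} → suc N ≤ n → S n ℚᵘ.≤ S (suc N) ℚᵘ.+ f (suc N)
  upper {N} {n} N≤n = ℚᵘ.≤-trans (ℚᵘ.p≤p+q (S n) (f n) {{ℚᵘ.nonNegative (÷-nonNeg 1 (n !))}}) (go (ℕ.≤⇒≤′ N≤n))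
    where
    go : ∀ {N n} → suc N ℕ.≤′ n → S n ℚᵘ.+ f n ℚᵘ.≤ S (suc N) ℚᵘ.+ f (suc N)
    go ℕ.≤′-refl                         = ℚᵘ.≤-refl
    go {N} (ℕ.≤′-step {n = zero} N≤n)    = contradiction (ℕ.≤′⇒≤ N≤n) λ ()
    go {N} (ℕ.≤′-step {n = suc n} N≤n)   = ℚᵘ.≤-trans
      (ℚᵘ.≤-reflexive (ℚᵘ.+-assoc (S (suc n)) (f (suc (suc n))) (f (suc (suc n)))))
      (ℚᵘ.≤-trans
        (ℚᵘ.+-monoʳ-≤ (S (suc n)) (halve (suc (suc n) !) (suc n !) (ℕ.1≤n! (suc n)) (ℕ.*-monoˡ-≤ (suc n !) (s≤s (s≤s (z≤n {n}))))))
        (go N≤n))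

  swap : ∀ x y → ℚᵘ.- (x ℚᵘ.- y) ℚᵘ.≃ y ℚᵘ.- x
  swap = solve 2 (λ x y → :- (x :- y) := y :- x) ℚᵘ.≃-refl
    where open ℚᵘ-Solver.+-*-Solver

  shift : ∀ {a d x y} → x ℚᵘ.≤ a ℚᵘ.+ d → a ℚᵘ.≤ y → x ℚᵘ.- y ℚᵘ.≤ d
  shift {a} {d} {x} {y} x≤a+d a≤y = ℚᵘ.≤-trans
    (ℚᵘ.+-monoˡ-≤ (ℚᵘ.- y) (ℚᵘ.≤-trans x≤a+d (ℚᵘ.+-monoˡ-≤ d a≤y)))
    (ℚᵘ.≤-reflexive (cancel y d))
    where
    open ℚᵘ-Solver.+-*-Solver
    cancel : ∀ y d → y ℚᵘ.+ d ℚᵘ.- y ℚᵘ.≃ d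
    cancel = solve 2 (λ y d → y :+ d :- y := d) ℚᵘ.≃-refl

  close : ∀ {a d x y} → a ℚᵘ.≤ x → a ℚᵘ.≤ y → x ℚᵘ.≤ a ℚᵘ.+ d → y ℚᵘ.≤ a ℚᵘ.+ d → ℚᵘ.∣ x ℚᵘ.- y ∣ ℚᵘ.≤ d
  close {a} {d} {x} {y} a≤x a≤y x≤a+d y≤a+d with ℚᵘ.∣p∣≡p∨∣p∣≡-p (x ℚᵘ.- y)
  ... | inj₁ eq = ℚᵘ.≤-trans (ℚᵘ.≤-reflexive-≡ eq) (shift x≤a+d a≤y)
  ... | inj₂ eq = ℚᵘ.≤-trans (ℚᵘ.≤-reflexive-≡ eq)
    (ℚᵘ.≤-trans (ℚᵘ.≤-reflexive (swap x y)) (shift y≤a+d a≤x))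

  small : f (suc q) ℚᵘ.≤ ε
  small = ℚᵘ.≤-trans (bound (suc q !) (ℕ.m≤m*n (suc q) (q !) {{q ℕ.!≢0}})) (*≤* (+≤+ (ℕ.*-monoˡ-≤ (suc q) (s≤s (z≤n {p})))))
    where
    bound : ∀ b → suc q ≤ b → 1 ÷ b ℚᵘ.≤ mkℚᵘ (+ 1) q
    bound (suc b) q<b = *≤* (+≤+ (ℕ.*-monoʳ-≤ 1 q<b))

e : ℝ
approx e = e-partialSum
cauchy e = e-partialSum-cauchy

{-
Upper bounds. Build an induced C_{2l} edge by edge: pick an arc v₀v₁, then
repeatedly an edge xy with x adjacent to the last vertex only and y to none (in
the last step, y to the first vertex only). If nᵢ is the number of choices at
step i, the weights 1 / (n₀ ⋯ nₗ₋₁) of all outcomes sum to at most 1, and every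
copy is an outcome for each of its 2l rotations in both directions. Fix a copy, a
direction and an edge xy. Apart from the last step, xy is a choice only for
starting points from which the first vertex adjacent to x or y lies at odd
distance, and no two consecutive starting points have that property; taking the
last step into account, xy is a choice at most l times when l ≥ 4. As n₀ = 2m, the
AM-GM inequality for the remaining nᵢ gives 2l (2 (l - 1))^(l - 1) c ≤ m^l.

For hexagons the count fails for edges joining opposite vertices of the copy. The
outcomes are then weighted a second time: the last two vertices are a uniform
neighbour v₄ of v₃ and a vertex v₅ closing up the cycle taken with probability
deg v₅ / W, where W is the total degree of such vertices. The ratios
deg v₅ / deg v₃ cancel over the six rotations, and with this W each edge counts at
most 4 times per direction, so that 108 c ≤ m³. For C₄, two opposite edges
determine the copy.

Lower bounds. Blow up every second vertex of C_{2l} to ⌊m / 2l⌋ copies; for C₄ take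
K_{a,a} with a = ⌊√m⌋. Disjoint edges make up for the missing ones.

All weights are scaled by N !, N = 2m, so that the upper bounds stay within ℕ.
-}
module Submission where

-- The choices along a single walk are not bounded; only the sum of all nᵢ over all rotations is, by
-- counting pairs of an edge and a step. AM-GM is therefore used in a form linear in that sum. For l
-- ≥ 4 the 2l (l - 1) numbers nᵢ with i ≥ 1 add up to at most l m, so their mean is at most m / (2
-- (l - 1)), which is where the constant comes from. Parity halves the count because vertices are
-- added in pairs: the path always ends at an odd index, so an edge attached there has its first hit
-- at odd distance from the start.
--
-- For hexagons the count is 4 m instead of 3 m, which alone would give 54 c ≤ m³, that is 4 (m /
-- 6)³. Let n₂ and n₃ be the numbers of choices for the second and third edge. Up to the degree
-- ratios the two weightings are proportional to 1 / (n₂ n₃) and 1 / (n₂ W), and n₂ + n₃ + W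
-- averages at most 2m / 3 per rotation. As n₂ occurs in both, the extremal point is n₂ = m / 3 and
-- n₃ = W = m / 6. There each weighting equals 18 / m², whence 18 = 3 · 6 and 108 = 6 · 18.

module Sums where

  open import Data.Bool using (Bool; true; false)
  open import Data.List using (List; []; _∷_; _++_; map; length; concatMap; filterᵇ; upTo; applyUpTo)
  open import Data.Nat.ListAction using (product; sum)
  open import Data.List.Membership.Propositional using (_∈_)
  open import Data.List.Membership.Propositional.Properties using (∈-∃++; ∈-++⁺ˡ; ∈-++⁺ʳ; ∈-++⁻)
  open import Data.List.Relation.Unary.All as All using ([]; _∷_)
  open import Data.List.Relation.Unary.AllPairs using ([]; _∷_)
  open import Data.List.Relation.Unary.Any using (here; there)
  open import Data.List.Relation.Unary.Unique.Propositional using (Unique)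
  open import Data.Nat
  open import Data.Nat.Properties
  open import Data.Nat.Tactic.RingSolver using (solve-∀)
  open import Data.Product using (_,_; ∃-syntax)
  open import Data.Sum using (inj₁; inj₂)
  open import Function using (_∘_; id)
  open import Relation.Binary.PropositionalEquality
  open import Relation.Nullary using (yes; no; contradiction)

  -- Finite sums over lists

  module _ {A : Set} where

    ∑ : List A → (A → ℕ) → ℕ
    ∑ []       f = 0
    ∑ (x ∷ xs) f = f x + ∑ xs f

    ∑-mono : ∀ xs {f g : A → ℕ} → (∀ {x} → x ∈ xs → f x ≤ g x) → ∑ xs f ≤ ∑ xs g
    ∑-mono []       h = z≤n
    ∑-mono (x ∷ xs) h = +-mono-≤ (h (here refl)) (∑-mono xs (h ∘ there))

    ∑-cong : ∀ xs {f g : A → ℕ} → (∀ {x} → x ∈ xs → f x ≡ g x) → ∑ xs f ≡ ∑ xs g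
    ∑-cong []       h = refl
    ∑-cong (x ∷ xs) h = cong₂ _+_ (h (here refl)) (∑-cong xs (h ∘ there))

    ∑-++ : ∀ xs {ys} (f : A → ℕ) → ∑ (xs ++ ys) f ≡ ∑ xs f + ∑ ys f
    ∑-++ []       f = refl
    ∑-++ (x ∷ xs) f = trans (cong (f x +_) (∑-++ xs f)) (sym (+-assoc (f x) _ _))

    ∑-+ : ∀ xs (f g : A → ℕ) → ∑ xs (λ x → f x + g x) ≡ ∑ xs f + ∑ xs g
    ∑-+ []       f g = refl
    ∑-+ (x ∷ xs) f g = trans (cong (f x + g x +_) (∑-+ xs f g)) (interchange (f x) (g x) _ _)
      where
      interchange : ∀ a b c d → a + b + (c + d) ≡ a + c + (b + d)
      interchange = solve-∀

    ∑-*ˡ : ∀ xs c (f : A → ℕ) → ∑ xs (λ x → c * f x) ≡ c * ∑ xs f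
    ∑-*ˡ []       c f = sym (*-zeroʳ c)
    ∑-*ˡ (x ∷ xs) c f = trans (cong (c * f x +_) (∑-*ˡ xs c f)) (sym (*-distribˡ-+ c (f x) _))

    ∑-const : ∀ xs c → ∑ xs (λ _ → c) ≡ length xs * c
    ∑-const []       c = refl
    ∑-const (x ∷ xs) c = cong (c +_) (∑-const xs c)

    ∑-⊆ : ∀ {xs ys} (f : A → ℕ) → Unique xs → (∀ {x} → x ∈ xs → x ∈ ys) → ∑ xs f ≤ ∑ ys f
    ∑-⊆ {[]}     f u        sub = z≤n
    ∑-⊆ {x ∷ xs} f (x∉ ∷ u) sub
      with ps , qs , refl ← ∈-∃++ (sub (here refl)) =
      ≤-trans (+-monoʳ-≤ (f x) (∑-⊆ {xs} {ps ++ qs} f u sub′)) (≤-reflexive eq)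
      where
      sub′ : ∀ {z} → z ∈ xs → z ∈ ps ++ qs
      sub′ z∈ with ∈-++⁻ ps (sub (there z∈))
      ... | inj₁ z∈ps         = ∈-++⁺ˡ z∈ps
      ... | inj₂ (here refl)  = contradiction refl (All.lookup x∉ z∈)
      ... | inj₂ (there z∈qs) = ∈-++⁺ʳ ps z∈qs
      swap-middle : ∀ a b c → a + (b + c) ≡ b + (a + c)
      swap-middle = solve-∀
      eq : f x + ∑ (ps ++ qs) f ≡ ∑ (ps ++ x ∷ qs) f
      eq = begin
        f x + ∑ (ps ++ qs) f        ≡⟨ cong (f x +_) (∑-++ ps f) ⟩
        f x + (∑ ps f + ∑ qs f)     ≡⟨ swap-middle (f x) (∑ ps f) (∑ qs f) ⟩
        ∑ ps f + (f x + ∑ qs f)     ≡⟨ ∑-++ ps f ⟨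
        ∑ (ps ++ x ∷ qs) f          ∎
        where open ≡-Reasoning

    ∑-member : ∀ {xs x} (f : A → ℕ) → x ∈ xs → f x ≤ ∑ xs f
    ∑-member f (here refl) = m≤m+n _ _
    ∑-member f (there x∈)  = ≤-trans (∑-member f x∈) (m≤n+m _ _)

  module _ {A B : Set} where

    ∑-map : ∀ (h : A → B) xs (f : B → ℕ) → ∑ (map h xs) f ≡ ∑ xs (f ∘ h)
    ∑-map h []       f = refl
    ∑-map h (x ∷ xs) f = cong (f (h x) +_) (∑-map h xs f)

    ∑-concatMap : ∀ (h : A → List B) xs (f : B → ℕ) → ∑ (concatMap h xs) f ≡ ∑ xs (λ x → ∑ (h x) f)
    ∑-concatMap h []       f = refl
    ∑-concatMap h (x ∷ xs) f = trans (∑-++ (h x) f) (cong (∑ (h x) f +_) (∑-concatMap h xs f))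

    ∑-swap : ∀ (xs : List A) (ys : List B) (f : A → B → ℕ) →
      ∑ xs (λ x → ∑ ys (f x)) ≡ ∑ ys (λ y → ∑ xs (λ x → f x y))
    ∑-swap []       ys f = sym (trans (∑-const ys 0) (*-zeroʳ (length ys)))
    ∑-swap (x ∷ xs) ys f = trans (cong (∑ ys (f x) +_) (∑-swap xs ys f)) (sym (∑-+ ys (f x) _))

  𝟙 : Bool → ℕ
  𝟙 true  = 1
  𝟙 false = 0

  length-filterᵇ : ∀ {A : Set} (p : A → Bool) xs → length (filterᵇ p xs) ≡ ∑ xs (𝟙 ∘ p)
  length-filterᵇ p []       = refl
  length-filterᵇ p (x ∷ xs) with p x
  ... | true  = cong suc (length-filterᵇ p xs)
  ... | false = length-filterᵇ p xs

  ∑-filterᵇ : ∀ {A : Set} (p : A → Bool) xs (f : A → ℕ) → ∑ (filterᵇ p xs) f ≡ ∑ xs (λ x → 𝟙 (p x) * f x)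
  ∑-filterᵇ p []       f = refl
  ∑-filterᵇ p (x ∷ xs) f with p x
  ... | true  = cong₂ _+_ (sym (+-identityʳ (f x))) (∑-filterᵇ p xs f)
  ... | false = ∑-filterᵇ p xs f

  -- Sums over initial segments and over a period

  ∑< : ℕ → (ℕ → ℕ) → ℕ
  ∑< zero    f = 0
  ∑< (suc n) f = f 0 + ∑< n (f ∘ suc)

  ∑-applyUpTo : ∀ {A : Set} (g : ℕ → A) n (f : A → ℕ) → ∑ (applyUpTo g n) f ≡ ∑< n (f ∘ g)
  ∑-applyUpTo g zero    f = refl
  ∑-applyUpTo g (suc n) f = cong (f (g 0) +_) (∑-applyUpTo (g ∘ suc) n f)

  ∑<-mono : ∀ n {f g : ℕ → ℕ} → (∀ i → i < n → f i ≤ g i) → ∑< n f ≤ ∑< n g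
  ∑<-mono zero    h = z≤n
  ∑<-mono (suc n) h = +-mono-≤ (h 0 z<s) (∑<-mono n (λ i i<n → h (suc i) (s<s i<n)))

  ∑<-cong : ∀ n {f g : ℕ → ℕ} → (∀ i → i < n → f i ≡ g i) → ∑< n f ≡ ∑< n g
  ∑<-cong zero    h = refl
  ∑<-cong (suc n) h = cong₂ _+_ (h 0 z<s) (∑<-cong n (λ i i<n → h (suc i) (s<s i<n)))

  ∑<-const : ∀ n c → ∑< n (λ _ → c) ≡ n * c
  ∑<-const zero    c = refl
  ∑<-const (suc n) c = cong (c +_) (∑<-const n c)

  ∑<-+ : ∀ n (f g : ℕ → ℕ) → ∑< n (λ i → f i + g i) ≡ ∑< n f + ∑< n g
  ∑<-+ n f g = begin
    ∑< n (λ i → f i + g i)                  ≡⟨ ∑-applyUpTo id n _ ⟨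
    ∑ (upTo n) (λ i → f i + g i)            ≡⟨ ∑-+ (upTo n) f g ⟩
    ∑ (upTo n) f + ∑ (upTo n) g             ≡⟨ cong₂ _+_ (∑-applyUpTo id n f) (∑-applyUpTo id n g) ⟩
    ∑< n f + ∑< n g                         ∎
    where open ≡-Reasoning

  ∑<-*ˡ : ∀ n c (f : ℕ → ℕ) → ∑< n (λ i → c * f i) ≡ c * ∑< n f
  ∑<-*ˡ n c f = begin
    ∑< n (λ i → c * f i)         ≡⟨ ∑-applyUpTo id n _ ⟨
    ∑ (upTo n) (λ i → c * f i)   ≡⟨ ∑-*ˡ (upTo n) c f ⟩
    c * ∑ (upTo n) f             ≡⟨ cong (c *_) (∑-applyUpTo id n f) ⟩
    c * ∑< n f                   ∎
    where open ≡-Reasoning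

  ∑<-∑-swap : ∀ {A : Set} n (xs : List A) (f : ℕ → A → ℕ) →
    ∑< n (λ i → ∑ xs (f i)) ≡ ∑ xs (λ x → ∑< n (λ i → f i x))
  ∑<-∑-swap n xs f = begin
    ∑< n (λ i → ∑ xs (f i))                  ≡⟨ ∑-applyUpTo id n _ ⟨
    ∑ (upTo n) (λ i → ∑ xs (f i))            ≡⟨ ∑-swap (upTo n) xs f ⟩
    ∑ xs (λ x → ∑ (upTo n) (λ i → f i x))    ≡⟨ ∑-cong xs (λ {x} _ → ∑-applyUpTo id n (λ i → f i x)) ⟩
    ∑ xs (λ x → ∑< n (λ i → f i x))          ∎
    where open ≡-Reasoning

  ∑<-snoc : ∀ n (f : ℕ → ℕ) → ∑< (suc n) f ≡ ∑< n f + f n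
  ∑<-snoc zero    f = +-identityʳ (f 0)
  ∑<-snoc (suc n) f = trans (cong (f 0 +_) (∑<-snoc n (f ∘ suc))) (sym (+-assoc (f 0) _ _))

  -- Moving the window by one trades the term at `s` for the one at `s + k`, which periodicity makes
  -- equal.
  ∑<-rotate : ∀ k (f : ℕ → ℕ) → (∀ t → f (k + t) ≡ f t) → ∀ s → ∑< k (f ∘ (s +_)) ≡ ∑< k f
  ∑<-rotate k f per zero    = refl
  ∑<-rotate k f per (suc s) = trans step (∑<-rotate k f per s)
    where
    open ≡-Reasoning
    shift : f (suc s + k) ≡ f (suc s)
    shift = trans (cong f (+-comm (suc s) k)) (per (suc s))
    g : ℕ → ℕ
    g = f ∘ (s +_)
    step : ∑< k (f ∘ (suc s +_)) ≡ ∑< k g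
    step = +-cancelˡ-≡ (g 0) _ _ (begin
      g 0 + ∑< k (f ∘ (suc s +_))  ≡⟨ cong (g 0 +_) (∑<-cong k (λ i _ → cong f (sym (+-suc s i)))) ⟩
      ∑< (suc k) g                 ≡⟨ ∑<-snoc k g ⟩
      ∑< k g + g k                 ≡⟨ +-comm (∑< k g) (g k) ⟩
      g k + ∑< k g                 ≡⟨ cong (_+ ∑< k g) (trans (cong f (+-comm s k)) (trans (per s) (cong f (sym (+-identityʳ s))))) ⟩
      g 0 + ∑< k g                 ∎)

  ∑<-pairs : ∀ n (f : ℕ → ℕ) → ∑< (n * 2) f ≡ ∑< n (λ i → f (i * 2) + f (suc (i * 2)))
  ∑<-pairs zero    f = refl
  ∑<-pairs (suc n) f = trans (cong (λ x → f 0 + (f 1 + x)) (∑<-pairs n (f ∘ suc ∘ suc))) (sym (+-assoc (f 0) (f 1) _))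

  -- Arithmetic and geometric means in ℕ

  ^-distrib-* : ∀ a b n → (a * b) ^ n ≡ a ^ n * b ^ n
  ^-distrib-* a b zero    = refl
  ^-distrib-* a b (suc n) = trans (cong (a * b *_) (^-distrib-* a b n)) (interchange a b (a ^ n) (b ^ n))
    where
    interchange : ∀ a b c d → a * b * (c * d) ≡ a * c * (b * d)
    interchange = solve-∀

  -- The tangent to x ↦ xⁿ⁺¹ at a lies below the graph, with both sides moved so
  -- that no subtraction occurs.
  bernoulli : ∀ a p n → suc n * (a ^ n * p) ≤ p ^ suc n + n * a ^ suc n
  bernoulli a p zero    = ≤-reflexive (trans (cong (_+ 0) (+-identityʳ p)) (trans (+-identityʳ p) (sym (trans (+-identityʳ (p * 1)) (*-identityʳ p)))))
  bernoulli a p (suc n) = +-cancelʳ-≤ (n * (a ^ suc n * p)) _ _ (begin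
    suc (suc n) * (a ^ suc n * p) + n * (a ^ suc n * p)             ≡⟨ regroup₁ n (a ^ n) a p ⟩
    suc n * a ^ n * (2 * (a * p))                                   ≤⟨ *-monoʳ-≤ (suc n * a ^ n) (square a p) ⟩
    suc n * a ^ n * (p * p + a * a)                                 ≡⟨ regroup₂ n (a ^ n) a p ⟩
    p * (suc n * (a ^ n * p)) + suc n * a ^ suc (suc n)             ≤⟨ +-monoˡ-≤ _ (*-monoʳ-≤ p (bernoulli a p n)) ⟩
    p * (p ^ suc n + n * a ^ suc n) + suc n * a ^ suc (suc n)       ≡⟨ regroup₃ n (a ^ n) a p (p ^ n) ⟩
    p ^ suc (suc n) + suc n * a ^ suc (suc n) + n * (a ^ suc n * p) ∎)
    where
    open ≤-Reasoning
    regroup₁ : ∀ n q a p → suc (suc n) * (a * q * p) + n * (a * q * p) ≡ suc n * q * (2 * (a * p))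
    regroup₁ = solve-∀
    regroup₂ : ∀ n q a p → suc n * q * (p * p + a * a) ≡ p * (suc n * (q * p)) + suc n * (a * (a * q))
    regroup₂ = solve-∀
    regroup₃ : ∀ n q a p r → p * (p * r + n * (a * q)) + suc n * (a * (a * q)) ≡ p * (p * r) + suc n * (a * (a * q)) + n * (a * q * p)
    regroup₃ = solve-∀
    square′ : ∀ a d → 2 * (a * (a + d)) ≤ (a + d) * (a + d) + a * a
    square′ a d = ≤-trans (m≤m+n _ (d * d)) (≤-reflexive (expand a d))
      where
      expand : ∀ a d → 2 * (a * (a + d)) + d * d ≡ (a + d) * (a + d) + a * a
      expand = solve-∀
    square : ∀ a p → 2 * (a * p) ≤ p * p + a * a
    square a p with ≤-total a p
    ... | inj₁ a≤p with d , refl ← m≤n⇒∃[o]m+o≡n a≤p = square′ a d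
    ... | inj₂ p≤a with d , refl ← m≤n⇒∃[o]m+o≡n p≤a =
      ≤-trans (≤-reflexive (cong (2 *_) (*-comm (p + d) p))) (≤-trans (square′ p d) (≤-reflexive (+-comm ((p + d) * (p + d)) (p * p))))

  am-gm : ∀ xs → length xs ^ length xs * product xs ≤ sum xs ^ length xs
  am-gm []           = ≤-refl
  am-gm (x ∷ [])     = ≤-reflexive (lemma x)
    where
    lemma : ∀ x → 1 * (x * 1) ≡ (x + 0) * 1
    lemma = solve-∀
  am-gm (x ∷ xs@(_ ∷ _)) = *-cancelˡ-≤ (n ^ n) {{m^n≢0 n n}} (begin
    n ^ n * (suc n ^ suc n * (x * P))              ≡⟨ regroup₀ (n ^ n) (suc n ^ suc n) x P ⟩
    suc n ^ suc n * x * (n ^ n * P)                ≤⟨ *-monoʳ-≤ (suc n ^ suc n * x) (am-gm xs) ⟩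
    suc n ^ suc n * x * s ^ n                      ≤⟨ step ⟩
    n ^ n * (x + s) ^ suc n                        ∎)
    where
    open ≤-Reasoning
    n s P : ℕ
    n = length xs
    s = sum xs
    P = product xs
    regroup₀ : ∀ a b x p → a * (b * (x * p)) ≡ b * x * (a * p)
    regroup₀ = solve-∀
    regroup₁ : ∀ n a b x s → n * ((1 + n) * a * x * b) + n * ((1 + n) * s * (a * b)) ≡ (1 + n) * ((a * b) * (n * (x + s)))
    regroup₁ = solve-∀
    regroup₂ : ∀ n a q b s → n * (x + s) * (a * b) + n * ((1 + n) * s * q) ≡ n * (a * ((x + s) * b)) + n * ((1 + n) * s * q)
    regroup₂ n a q b s = cong (_+ n * ((1 + n) * s * q)) (r n a b x s)
      where
      r : ∀ n a b x s → n * (x + s) * (a * b) ≡ n * (a * ((x + s) * b))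
      r = solve-∀
    step : suc n ^ suc n * x * s ^ n ≤ n ^ n * (x + s) ^ suc n
    -- Equality holds at x = s / n, that is when n (x + s) = (n + 1) s, so the tangent is taken at
    -- `suc n * s`. The factor `n` clears the denominator and the added term replaces a subtraction.
    step = *-cancelˡ-≤ n (+-cancelʳ-≤ (n * (suc n * s * (suc n ^ n * s ^ n))) _ _ (begin
      n * (suc n ^ suc n * x * s ^ n) + n * (suc n * s * (suc n ^ n * s ^ n))   ≡⟨ regroup₁ n (suc n ^ n) (s ^ n) x s ⟩
      suc n * ((suc n ^ n * s ^ n) * (n * (x + s)))                             ≡⟨ cong (λ z → suc n * (z * (n * (x + s)))) (sym (^-distrib-* (suc n) s n)) ⟩
      suc n * ((suc n * s) ^ n * (n * (x + s)))                                 ≤⟨ bernoulli (suc n * s) (n * (x + s)) n ⟩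
      (n * (x + s)) ^ suc n + n * (suc n * s) ^ suc n                           ≡⟨ cong₂ (λ y z → n * (x + s) * y + n * (suc n * s * z)) (^-distrib-* n (x + s) n) (^-distrib-* (suc n) s n) ⟩
      n * (x + s) * (n ^ n * (x + s) ^ n) + n * (suc n * s * (suc n ^ n * s ^ n)) ≡⟨ regroup₂ n (n ^ n) (suc n ^ n * s ^ n) ((x + s) ^ n) s ⟩
      n * (n ^ n * (x + s) ^ suc n) + n * (suc n * s * (suc n ^ n * s ^ n))       ∎))

  ^-cancel-≤ : ∀ n {x y} → x ^ suc n ≤ y ^ suc n → x ≤ y
  ^-cancel-≤ n {x} {y} h with x ≤? y
  ... | yes x≤y = x≤y
  ... | no  x≰y = contradiction h (<⇒≱ (^-monoˡ-< (suc n) (≰⇒> x≰y)))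

  -- Requiring the product to be an exact power makes `g` the geometric mean, so no root has to be
  -- extracted. All later uses rescale their entries to reach this form.
  am-gm-bound : ∀ g xs → product xs ≡ g ^ length xs → length xs * g ≤ sum xs
  am-gm-bound g []           _  = z≤n
  am-gm-bound g xs@(_ ∷ ys) eq = ^-cancel-≤ (length ys) (≤-trans
    (≤-reflexive (trans (^-distrib-* (length xs) g (length xs)) (cong (length xs ^ length xs *_) (sym eq))))
    (am-gm xs))

module UpperBounds where

  open Sums
  open import Data.Bool using (Bool; true; false; _∧_; _∨_; not; if_then_else_; T)
  open import Data.List as List using (List; []; _∷_; _++_; map; length; concatMap; filterᵇ; filter; allFin; cartesianProduct)
  open import Data.Nat
  open import Data.Nat.Properties
  open import Data.Product using (_×_; _,_; proj₁; proj₂; ∃-syntax; swap)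
  open import Data.Sum using (_⊎_; inj₁; inj₂)
  open import Function using (_∘_; id; Inverse)
  open import Relation.Binary.PropositionalEquality hiding ([_])
  open import Relation.Nullary using (¬_; yes; no; contradiction; ⌊_⌋)
  open import Defs hiding (_^_)
  open import Data.Fin as Fin using (Fin; toℕ; opposite)
  import Data.Fin.Properties as Fin
  open import Data.Fin.Subset using (Subset) renaming (_∈_ to _∈ˢ_)
  import Data.Fin.Subset.Properties as Subset
  import Data.List.Properties as List
  open import Data.List.Membership.Propositional using (_∈_; lose)
  open import Data.List.Membership.Propositional.Properties using (∈-++⁺ˡ; ∈-++⁺ʳ; ∈-map⁺; ∈-map⁻; ∈-concatMap⁺; ∈-filter⁻; ∈-lookup; ∈-allFin)
  open import Data.List.Relation.Unary.All as All using ([]; _∷_; All)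
  open import Data.List.Relation.Unary.AllPairs using ([]; _∷_)
  open import Data.List.Relation.Unary.Any using (here; there)
  open import Data.List.Relation.Unary.Unique.Propositional using (Unique)
  import Data.List.Relation.Unary.Unique.Propositional.Properties as Unique
  open import Data.Nat.DivMod
  open import Data.Nat.Divisibility using (m≤n⇒m!∣n!; ∣-trans; m∣m*n)
  open import Data.Nat.Tactic.RingSolver using (solve-∀)
  open import Data.Unit using (tt)
  open import Relation.Binary.Definitions using (tri<; tri≈; tri>)
  open import Data.Nat.ListAction using (product; sum)
  import Data.Nat.ListAction.Properties as ListAction
  open import Data.Vec using (Vec; []; _∷_)

  -- The first 2i terms of v, latest first: a state of the process that picks
  -- every other edge of a cycle.
  path : ∀ {A : Set} → (ℕ → A) → ℕ → List A
  path v zero    = []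
  path v (suc i) = v (suc (i * 2)) ∷ v (i * 2) ∷ path v i

  path-cong : ∀ {A : Set} {v w : ℕ → A} → (∀ t → v t ≡ w t) → ∀ i → path v i ≡ path w i
  path-cong h zero    = refl
  path-cong h (suc i) = cong₂ _∷_ (h _) (cong₂ _∷_ (h _) (path-cong h i))

  map-path : ∀ {A B : Set} (f : A → B) v i → map f (path v i) ≡ path (f ∘ v) i
  map-path f v zero    = refl
  map-path f v (suc i) = cong (λ p → _ ∷ _ ∷ p) (map-path f v i)

  -- Extending and closing a path

  none : List Bool → Bool
  none []       = true
  none (b ∷ bs) = not b ∧ none bs

  lastOnly : List Bool → Bool
  lastOnly []              = false
  lastOnly (b ∷ [])        = b
  lastOnly (b ∷ bs@(_ ∷ _)) = not b ∧ lastOnly bs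

  -- The lists hold the adjacencies of the two endpoints of an oriented edge to the path, latest
  -- vertex first. The first endpoint is the one that attaches.
  extends : List Bool → List Bool → Bool
  extends (a ∷ as) (b ∷ bs) = (a ∧ not b) ∧ (none as ∧ none bs)
  extends _        _        = false

  -- Here the second endpoint returns to the first vertex of the path, which is the last entry of
  -- the list.
  closes : List Bool → List Bool → Bool
  closes (a ∷ as@(_ ∷ _)) bs = a ∧ (none as ∧ lastOnly bs)
  closes _                _  = false

  ∧-true : ∀ x {y} → x ∧ y ≡ true → x ≡ true × y ≡ true
  ∧-true true h = refl , h

  not-true : ∀ {x} → not x ≡ true → x ≡ false
  not-true {false} refl = refl

  none-path⁻ : ∀ a i → none (path a i) ≡ true → ∀ j → j < i * 2 → a j ≡ false
  none-path⁻ a (suc i) h j j<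
    with h₁ , h′ ← ∧-true (not (a (suc (i * 2)))) h
    with h₀ , h″ ← ∧-true (not (a (i * 2))) h′
    with m≤n⇒m<n∨m≡n (s≤s⁻¹ j<)
  ... | inj₂ refl = not-true h₁
  ... | inj₁ j<1+ with m≤n⇒m<n∨m≡n (s≤s⁻¹ j<1+)
  ...   | inj₂ refl = not-true h₀
  ...   | inj₁ j<i  = none-path⁻ a i h″ j j<i

  none-path⁺ : ∀ a i → (∀ j → j < i * 2 → a j ≡ false) → none (path a i) ≡ true
  none-path⁺ a zero    h = refl
  none-path⁺ a (suc i) h
    rewrite h (suc (i * 2)) ≤-refl | h (i * 2) (m<n⇒m<1+n (n<1+n (i * 2))) =
    none-path⁺ a i (λ j j< → h j (m<n⇒m<1+n (m<n⇒m<1+n j<)))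

  none-path-skip : ∀ a i → a 0 ≡ false → a 1 ≡ false → none (path a (suc i)) ≡ none (path (a ∘ suc ∘ suc) i)
  none-path-skip a zero    h₀ h₁ rewrite h₀ | h₁ = refl
  none-path-skip a (suc i) h₀ h₁ = cong (λ z → not (a (3 + i * 2)) ∧ (not (a (2 + i * 2)) ∧ z)) (none-path-skip a i h₀ h₁)

  extends-path⁻ : ∀ a b i → extends (path a (suc i)) (path b (suc i)) ≡ true →
    (∀ j → j < suc (i * 2) → a j ≡ false) × (∀ j → j < suc (i * 2) → b j ≡ false)
  extends-path⁻ a b i h
    with _ , h′ ← ∧-true (a (suc (i * 2)) ∧ not (b (suc (i * 2)))) h
    with ha , hb ← ∧-true (not (a (i * 2)) ∧ none (path a i)) h′
    with ha₀ , ha′ ← ∧-true (not (a (i * 2))) ha | hb₀ , hb′ ← ∧-true (not (b (i * 2))) hb = below a ha₀ ha′ , below b hb₀ hb′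
    where
    below : ∀ c → not (c (i * 2)) ≡ true → none (path c i) ≡ true → ∀ j → j < suc (i * 2) → c j ≡ false
    below c h₀ h′ j j< with m≤n⇒m<n∨m≡n (s≤s⁻¹ j<)
    ... | inj₁ j<i  = none-path⁻ c i h′ j j<i
    ... | inj₂ refl = not-true h₀

  extends-path-skip : ∀ a b i → a 0 ≡ false → a 1 ≡ false → b 0 ≡ false → b 1 ≡ false →
    extends (path a (suc (suc i))) (path b (suc (suc i))) ≡
    extends (path (a ∘ suc ∘ suc) (suc i)) (path (b ∘ suc ∘ suc) (suc i))
  extends-path-skip a b i a₀ a₁ b₀ b₁ =
    cong₂ (λ y z → (a (3 + i * 2) ∧ not (b (3 + i * 2))) ∧ ((not (a (2 + i * 2)) ∧ y) ∧ (not (b (2 + i * 2)) ∧ z)))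
      (none-path-skip a i a₀ a₁) (none-path-skip b i b₀ b₁)

  closes-path⁻ : ∀ a b i → closes (path a (suc i)) (path b (suc i)) ≡ true →
    (a (suc (i * 2)) ≡ true × (∀ j → j < suc (i * 2) → a j ≡ false)) ×
    (b 0 ≡ true × (∀ j → 0 < j → j ≤ suc (i * 2) → b j ≡ false))
  closes-path⁻ a b i h
    with ha , h′ ← ∧-true (a (suc (i * 2))) h
    with ha′ , hb ← ∧-true (not (a (i * 2)) ∧ none (path a i)) h′
    with ha₀ , ha″ ← ∧-true (not (a (i * 2))) ha′ = (ha , below) , lastOnly-path⁻ i hb
    where
    below : ∀ j → j < suc (i * 2) → a j ≡ false
    below j j< with m≤n⇒m<n∨m≡n (s≤s⁻¹ j<)
    ... | inj₁ j<i  = none-path⁻ a i ha″ j j<i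
    ... | inj₂ refl = not-true ha₀
    lastOnly-path⁻ : ∀ i → lastOnly (path b (suc i)) ≡ true → b 0 ≡ true × (∀ j → 0 < j → j ≤ suc (i * 2) → b j ≡ false)
    lastOnly-path⁻ zero h with h₁ , h₀ ← ∧-true (not (b 1)) h = h₀ , λ { 1 _ _ → not-true h₁ ; (suc (suc _)) _ (s≤s ()) }
    lastOnly-path⁻ (suc i) h
      with h₁ , h′ ← ∧-true (not (b (3 + i * 2))) h
      with h₀ , h″ ← ∧-true (not (b (2 + i * 2))) h′
      with hb₀ , rest ← lastOnly-path⁻ i h″ = hb₀ , λ j 0<j j≤ → go j 0<j (m≤n⇒m<n∨m≡n j≤)
      where
      go : ∀ j → 0 < j → j < suc (suc i * 2) ⊎ j ≡ suc (suc i * 2) → b j ≡ false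
      go j 0<j (inj₂ refl) = not-true h₁
      go j 0<j (inj₁ j<) with m≤n⇒m<n∨m≡n (s≤s⁻¹ j<)
      ... | inj₂ refl = not-true h₀
      ... | inj₁ j<′  = rest j 0<j (s≤s⁻¹ j<′)

  -- Starting points from which a fixed edge is a choice

  𝟙≤1 : ∀ b → 𝟙 b ≤ 1
  𝟙≤1 true  = ≤-refl
  𝟙≤1 false = z≤n

  𝟙-false : ∀ {b} → ¬ (b ≡ true) → 𝟙 b ≡ 0
  𝟙-false {true}  h = contradiction refl h
  𝟙-false {false} h = refl

  𝟙-positive : ∀ {b} → 0 < 𝟙 b → b ≡ true
  𝟙-positive {true} _ = refl

  private
    exclusive : ∀ x y → ¬ (x ≡ true × y ≡ true) → 𝟙 x + 𝟙 y ≤ 1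
    exclusive true  true  h = contradiction (refl , refl) h
    exclusive true  false h = ≤-refl
    exclusive false y     h = 𝟙≤1 y

  -- Holds when `u` has a hit among its first `r * 2` positions and the first hit is at an odd
  -- index. In use, a hit is a cycle vertex adjacent to an endpoint of the edge.
  oddFirst : ℕ → (ℕ → Bool) → Bool
  oddFirst zero    u = false
  oddFirst (suc r) u = if u 0 then false else if u 1 then true else oddFirst r (u ∘ suc ∘ suc)

  oddFirst-cong : ∀ r {u w} → (∀ t → u t ≡ w t) → oddFirst r u ≡ oddFirst r w
  oddFirst-cong zero    h = refl
  oddFirst-cong (suc r) h rewrite h 0 | h 1 | oddFirst-cong r (h ∘ suc ∘ suc) = refl

  oddFirst-head : ∀ r {u} → u 0 ≡ true → oddFirst r u ≡ false
  oddFirst-head zero    h = refl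
  oddFirst-head (suc r) h rewrite h = refl

  -- Moving the start by one flips the parity of the distance to the first hit.
  oddFirst-suc : ∀ r r′ u → oddFirst r u ≡ true → oddFirst r′ (u ∘ suc) ≡ false
  oddFirst-suc (suc r) zero     u h = refl
  oddFirst-suc (suc r) (suc r′) u h with u 0 | u 1
  ... | false | true  = refl
  ... | false | false with u 2 in u₂
  ...   | true  = contradiction (trans (sym h) (oddFirst-head r u₂)) λ ()
  ...   | false = oddFirst-suc r r′ (u ∘ suc ∘ suc) h

  oddFirst-none : ∀ r {u} → (∀ j → j < r * 2 → u j ≡ false) → oddFirst r u ≡ false
  oddFirst-none zero    h = refl
  oddFirst-none (suc r) h rewrite h 0 z<s | h 1 (s<s z<s) = oddFirst-none r (λ j j< → h (suc (suc j)) (s<s (s<s j<)))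

  module _ (a b : ℕ → Bool) where

    extensions : ℕ → ℕ
    extensions i = 𝟙 (extends (path a (suc i)) (path b (suc i))) + 𝟙 (extends (path b (suc i)) (path a (suc i)))

    closures : ℕ → ℕ
    closures i = 𝟙 (closes (path a (suc i)) (path b (suc i))) + 𝟙 (closes (path b (suc i)) (path a (suc i)))

  private
    extensions-zero : ∀ a b i j → j < suc (i * 2) → a j ∨ b j ≡ true → extensions a b i ≡ 0
    extensions-zero a b i j j< h = cong₂ _+_ (𝟙-false λ e → both e) (𝟙-false λ e → both′ e)
      where
      both : ¬ (extends (path a (suc i)) (path b (suc i)) ≡ true)
      both e with ha , hb ← extends-path⁻ a b i e rewrite ha j j< | hb j j< = contradiction h λ ()
      both′ : ¬ (extends (path b (suc i)) (path a (suc i)) ≡ true)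
      both′ e with hb , ha ← extends-path⁻ b a i e rewrite ha j j< | hb j j< = contradiction h λ ()

    extensions-first : ∀ a b → extensions a b 0 ≤ 1
    extensions-first a b with a 1 | b 1 | a 0 | b 0
    ... | true  | true  | _     | _     = z≤n
    ... | false | false | _     | _     = z≤n
    ... | true  | false | true  | _     = z≤n
    ... | true  | false | false | true  = z≤n
    ... | true  | false | false | false = ≤-refl
    ... | false | true  | _     | true  = z≤n
    ... | false | true  | true  | false = z≤n
    ... | false | true  | false | false = ≤-refl

    ∑<-zero : ∀ n {f : ℕ → ℕ} → (∀ i → f i ≡ 0) → ∑< n f ≡ 0
    ∑<-zero n h = trans (∑<-cong n (λ i _ → h i)) (trans (∑<-const n 0) (*-zeroʳ n))

  -- An extension at step `i` has its hit at index `suc (i * 2)` and none before. The first hit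
  -- therefore determines `i`, and it lies at odd distance; there, only one orientation of the edge
  -- can attach.
  ∑extensions≤ : ∀ a b r → ∑< r (extensions a b) ≤ 𝟙 (oddFirst r (λ t → a t ∨ b t))
  ∑extensions≤ a b zero    = z≤n
  ∑extensions≤ a b (suc r) with a 0 ∨ b 0 in u₀ | a 1 ∨ b 1 in u₁
  ... | true  | _     = ≤-reflexive (∑<-zero (suc r) λ i → extensions-zero a b i 0 z<s u₀)
  ... | false | true  = ≤-trans (≤-reflexive (trans (cong (extensions a b 0 +_) (∑<-zero r λ i → extensions-zero a b (suc i) 1 (s<s z<s) u₁)) (+-identityʳ _))) (extensions-first a b)
  ... | false | false = ≤-trans (≤-reflexive (cong₂ _+_ first (∑<-cong r λ i _ → rest i))) (∑extensions≤ (a ∘ suc ∘ suc) (b ∘ suc ∘ suc) r)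
    where
    neither : ∀ x y → x ∨ y ≡ false → x ≡ false × y ≡ false
    neither false false refl = refl , refl
    first : extensions a b 0 ≡ 0
    first with _ , h ← neither (a 0) (b 0) u₀ | ha , hb ← neither (a 1) (b 1) u₁ rewrite ha | hb = refl
    rest : ∀ i → extensions a b (suc i) ≡ extensions (a ∘ suc ∘ suc) (b ∘ suc ∘ suc) i
    rest i with a₀ , b₀ ← neither (a 0) (b 0) u₀ | a₁ , b₁ ← neither (a 1) (b 1) u₁ =
      cong₂ (λ x y → 𝟙 x + 𝟙 y) (extends-path-skip a b i a₀ a₁ b₀ b₁) (extends-path-skip b a i b₀ b₁ a₀ a₁)

  private
    -- The pattern of hits left by a closing edge: both ends of the path of `suc r * 2` vertices and
    -- nothing between them. The stretch between is called clean below.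
    Closure : ℕ → (ℕ → Bool) → Set
    Closure r u = u 0 ≡ true × (∀ j → 0 < j → j ≤ r * 2 → u j ≡ false) × u (suc (r * 2)) ≡ true

    closure : ∀ a b r → 0 < closures a b r → Closure r (λ t → a t ∨ b t)
    closure a b r 0< with closes (path a (suc r)) (path b (suc r)) in e
    ... | true with (ha , ha′) , hb , hb′ ← closes-path⁻ a b r e = u₀ , mid , last
      where
      u₀ : a 0 ∨ b 0 ≡ true
      u₀ rewrite ha′ 0 z<s = hb
      mid : ∀ j → 0 < j → j ≤ r * 2 → a j ∨ b j ≡ false
      mid j 0<j j≤ rewrite ha′ j (s≤s j≤) = hb′ j 0<j (m≤n⇒m≤1+n j≤)
      last : a (suc (r * 2)) ∨ b (suc (r * 2)) ≡ true
      last rewrite ha = refl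
    ... | false with (hb , hb′) , ha , ha′ ← closes-path⁻ b a r (𝟙-positive 0<) = u₀ , mid , last
      where
      u₀ : a 0 ∨ b 0 ≡ true
      u₀ rewrite ha = refl
      mid : ∀ j → 0 < j → j ≤ r * 2 → a j ∨ b j ≡ false
      mid j 0<j j≤ rewrite ha′ j 0<j (m≤n⇒m≤1+n j≤) = hb′ j (s≤s j≤)
      last : a (suc (r * 2)) ∨ b (suc (r * 2)) ≡ true
      last rewrite ha′ (suc (r * 2)) z<s ≤-refl = hb

    find : ∀ n (f : ℕ → ℕ) → (∃[ s ] 0 < f s) ⊎ (∀ s → s < n → f s ≡ 0)
    find zero    f = inj₂ λ _ ()
    find (suc n) f with f n in e | find n f
    ... | suc _ | _      = inj₁ (n , subst (0 <_) (sym e) z<s)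
    ... | zero  | inj₁ p = inj₁ p
    ... | zero  | inj₂ h = inj₂ λ s s< → go s (m≤n⇒m<n∨m≡n (s≤s⁻¹ s<))
      where
      go : ∀ s → s < n ⊎ s ≡ n → f s ≡ 0
      go s (inj₁ s<n)  = h s s<n
      go s (inj₂ refl) = e

  -- Closing forces the second endpoint to miss the latest vertex, while the reversed orientation
  -- needs it to hit that vertex.
  closes-exclusive : ∀ as bs → 𝟙 (closes as bs) + 𝟙 (closes bs as) ≤ 1
  closes-exclusive as bs = exclusive _ _ (clash as bs)
    where
    clash : ∀ as bs → ¬ (closes as bs ≡ true × closes bs as ≡ true)
    clash (true ∷ _ ∷ _) (true ∷ bs@(_ ∷ _)) (_ , e) with _ , () ← ∧-true (none bs) e

  -- An edge xy is recorded by the indicator sequences a and b of the neighbours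
  -- of x and of y along a cycle of length 2 (2 + r).
  module _ (r : ℕ) (2≤r : 2 ≤ r) (a b : ℕ → Bool)
           (a-periodic : ∀ t → a ((2 + r) * 2 + t) ≡ a t)
           (b-periodic : ∀ t → b ((2 + r) * 2 + t) ≡ b t) where

    private
      k : ℕ
      k = (2 + r) * 2

      u : ℕ → Bool
      u t = a t ∨ b t

      u-periodic : ∀ t → u (k + t) ≡ u t
      u-periodic t = cong₂ _∨_ (a-periodic t) (b-periodic t)

      from : ∀ {A : Set} → ℕ → (ℕ → A) → ℕ → A
      from s f t = f (s + t)

      cl odd both : ℕ → ℕ
      cl s  = closures (from s a) (from s b) r
      odd s = 𝟙 (oddFirst r (from s u))
      both s   = odd s + cl s

      periodic-from : ∀ {A : Set} {f : ℕ → A} → (∀ t → f (k + t) ≡ f t) → ∀ s t → from (k + s) f t ≡ from s f t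
      periodic-from {f = f} h s t = trans (cong f (+-assoc k s t)) (h (s + t))

      both-periodic : ∀ s → both (k + s) ≡ both s
      both-periodic s = cong₂ _+_ (cong 𝟙 (oddFirst-cong r (periodic-from u-periodic s)))
        (cong₂ (λ x y → 𝟙 (closes x y) + 𝟙 (closes y x))
          (path-cong (periodic-from a-periodic s) (suc r)) (path-cong (periodic-from b-periodic s) (suc r)))

      odd-suc : ∀ s → oddFirst r (from s u) ≡ true → odd (suc s) ≡ 0
      odd-suc s h = cong 𝟙 (trans (oddFirst-cong r (λ t → cong u (sym (+-suc s t)))) (oddFirst-suc r r (from s u) h))

      -- A closure at `s` makes `s` a hit and the next `r * 2` positions clean, which rules out both
      -- `odd s` and `odd (suc s)`. Without a closure the parity flip of `oddFirst-suc` excludes one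
      -- of the two.
      pair : ∀ s → cl (suc s) ≡ 0 → both s + both (suc s) ≤ 1
      pair s e with cl s in e′
      ... | suc c
        with u₀ , mid , last ← closure (from s a) (from s b) r (subst (0 <_) (sym e′) z<s)
        rewrite oddFirst-head r {from s u} u₀
              | oddFirst-none r {from (suc s) u} (λ j j< → trans (cong u (sym (+-suc s j))) (mid (suc j) z<s j<))
              | e = ≤-trans (≤-reflexive (+-identityʳ (suc c))) (subst (_≤ 1) e′ (closes-exclusive (path (from s a) (suc r)) (path (from s b) (suc r))))
      ... | zero rewrite e with oddFirst r (from s u) in o
      ...   | true  rewrite odd-suc s o = ≤-refl
      ...   | false = ≤-trans (≤-reflexive (+-identityʳ _)) (𝟙≤1 _)

      pairs : ∀ s → (∀ i → i < 2 + r → cl (s + suc (i * 2)) ≡ 0) → ∑< k (both ∘ (s +_)) ≤ 2 + r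
      pairs s h = begin
        ∑< k (both ∘ (s +_))                                          ≡⟨ ∑<-pairs (2 + r) (both ∘ (s +_)) ⟩
        ∑< (2 + r) (λ i → both (s + i * 2) + both (s + suc (i * 2)))     ≤⟨ ∑<-mono (2 + r) {g = λ _ → 1} (λ i i< → ≤-trans (≤-reflexive (cong (λ z → both (s + i * 2) + both z) (+-suc s (i * 2)))) (pair (s + i * 2) (trans (cong cl (sym (+-suc s (i * 2)))) (h i i<)))) ⟩
        ∑< (2 + r) (λ _ → 1)                                       ≡⟨ ∑<-const (2 + r) 1 ⟩
        (2 + r) * 1                                                ≡⟨ *-identityʳ (2 + r) ⟩
        2 + r                                                      ∎
        where open ≤-Reasoning

      -- Two closures at odd distance would put a hit into a clean stretch.
      odd-distance : ∀ s → 0 < cl s → ∀ i → i < 2 + r → cl (s + suc (i * 2)) ≡ 0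
      odd-distance s 0<cl i i< with cl (s + suc (i * 2)) in e
      ... | zero  = refl
      ... | suc n
        with u₀ , mid , _ ← closure (from s a) (from s b) r 0<cl
        with v₀ , mid′ , _ ← closure (from (s + suc (i * 2)) a) (from (s + suc (i * 2)) b) r (subst (0 <_) (sym e) z<s)
        = clash (m≤n⇒m<n∨m≡n (s≤s⁻¹ i<))
        where
        wrap : ∀ d → suc (i * 2) + d ≡ k → 0 < d → d ≤ r * 2 → suc n ≡ 0
        wrap d eq 0<d d≤ = contradiction (trans (sym (mid′ d 0<d d≤)) (trans (cong u around) (trans (u-periodic (s + 0)) u₀))) λ ()
          where
          around : s + suc (i * 2) + d ≡ k + (s + 0)
          around = trans (+-assoc s _ d) (trans (cong (s +_) eq) (trans (+-comm s k) (cong (k +_) (sym (+-identityʳ s)))))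
        clash : i < suc r ⊎ i ≡ suc r → suc n ≡ 0
        clash (inj₂ refl) = wrap 1 (+-comm (suc (suc r * 2)) 1) z<s (≤-trans (s≤s z≤n) (*-monoˡ-≤ 2 2≤r))
        clash (inj₁ i<1+r) with m≤n⇒m<n∨m≡n (s≤s⁻¹ i<1+r)
        -- The first closure lies 3 past the second one, modulo `k`, and 3 must fall into a clean
        -- stretch of length `r * 2`. This fails for `r = 1`: an edge attached to two opposite
        -- vertices of a hexagon closes from both of them.
        ... | inj₂ refl = wrap 3 (+-comm (suc (r * 2)) 3) z<s (≤-trans (s≤s (s≤s (s≤s z≤n))) (*-monoˡ-≤ 2 2≤r))
        ... | inj₁ i<r  = contradiction (trans (sym (trans (cong u (sym (+-identityʳ (s + suc (i * 2))))) v₀)) (mid (suc (i * 2)) z<s (≤-trans (n≤1+n _) (*-monoˡ-≤ 2 i<r)))) λ ()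

      ∑both≤ : ∑< k both ≤ 2 + r
      ∑both≤ with find k cl
      -- Pairing the positions from a closure on puts every closure at an even offset, hence on the
      -- first position of its pair.
      ... | inj₁ (s , 0<cl) = ≤-trans (≤-reflexive (sym (∑<-rotate k both both-periodic s))) (pairs s (odd-distance s 0<cl))
      ... | inj₂ h          = pairs 0 λ i i< → h (suc (i * 2)) (<-≤-trans (n<1+n _) (*-monoˡ-≤ 2 i<))

    candidacies≤ : ∑< k (λ s → ∑< r (extensions (λ t → a (s + t)) (λ t → b (s + t))) + closures (λ t → a (s + t)) (λ t → b (s + t)) r) ≤ 2 + r
    candidacies≤ = ≤-trans (∑<-mono k λ s _ → +-monoˡ-≤ (cl s) (∑extensions≤ (from s a) (from s b) r)) ∑both≤

  -- Scaled weights on a tree of choices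

  -- Integer reciprocals, scaled by N !.
  module Reciprocal (N : ℕ) where

    Q : ℕ
    Q = N !

    recip : ℕ → ℕ
    recip zero    = 0
    recip (suc n) = N ! / suc n

    recip-≤ : ∀ n → n * recip n ≤ Q
    recip-≤ zero    = z≤n
    recip-≤ (suc n) = ≤-trans (≤-reflexive (*-comm (suc n) _)) (m/n*n≤m (N !) (suc n))

    -- Every positive `n ≤ N` divides `N !`, so the quotient has no remainder.
    recip-≡ : ∀ n → 0 < n → n ≤ N → n * recip n ≡ Q
    recip-≡ (suc n) _ n≤N = m*[n/m]≡n (∣-trans (m∣m*n (n !)) (m≤n⇒m!∣n! n≤N))

  module _ {V E : Set} where

    extend : (E → List V → List V) → (List V → List E) → List (List V) → List (List V)
    extend ext cand = concatMap (λ p → map (λ e → ext e p) (cand p))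

    ∈-extend : ∀ (ext : E → List V → List V) (cand : List V → List E) {ps p e} → p ∈ ps → e ∈ cand p → ext e p ∈ extend ext cand ps
    ∈-extend ext cand p∈ e∈ = ∈-concatMap⁺ (λ p → map (λ e → ext e p) (cand p)) (lose p∈ (∈-map⁺ (λ e → ext e _) e∈))

    -- One stage of a random process: `κ p` is a conditional distribution scaled by `Q`, and
    -- possibly deficient. Each stage multiplies the total mass by at most `Q`, so `Q ^ i` stands
    -- for probability 1 after `i` stages.
    ∑-extend : ∀ (ext : E → List V → List V) (cand : List V → List E) (w : List V → ℕ)
      (κ : List V → E → ℕ) (w′ : List V → ℕ) Q → (∀ p e → w′ (ext e p) ≡ κ p e * w p) →
      (∀ p → ∑ (cand p) (κ p) ≤ Q) → ∀ ps →
      ∑ (extend ext cand ps) w′ ≤ Q * ∑ ps w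
    ∑-extend ext cand w κ w′ Q w′≡ κ≤ ps = begin
      ∑ (extend ext cand ps) w′                                  ≡⟨ ∑-concatMap _ ps w′ ⟩
      ∑ ps (λ p → ∑ (map (λ e → ext e p) (cand p)) w′)           ≡⟨ ∑-cong ps (λ {p} _ → ∑-map _ (cand p) w′) ⟩
      ∑ ps (λ p → ∑ (cand p) (λ e → w′ (ext e p)))               ≡⟨ ∑-cong ps (λ {p} _ → ∑-cong (cand p) λ {e} _ → trans (w′≡ p e) (*-comm (κ p e) (w p))) ⟩
      ∑ ps (λ p → ∑ (cand p) (λ e → w p * κ p e))                ≡⟨ ∑-cong ps (λ {p} _ → ∑-*ˡ (cand p) (w p) (κ p)) ⟩
      ∑ ps (λ p → w p * ∑ (cand p) (κ p))                        ≤⟨ ∑-mono ps (λ {p} _ → ≤-trans (*-monoʳ-≤ (w p) (κ≤ p)) (≤-reflexive (*-comm (w p) Q))) ⟩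
      ∑ ps (λ p → Q * w p)                                       ≡⟨ ∑-*ˡ ps Q w ⟩
      Q * ∑ ps w                                                 ∎
      where open ≤-Reasoning

  ∈-filterᵇ⁺ : ∀ {A : Set} (p : A → Bool) {xs x} → x ∈ xs → p x ≡ true → x ∈ filterᵇ p xs
  ∈-filterᵇ⁺ p {y ∷ xs} (here refl) e with p y
  ... | true = here refl
  ∈-filterᵇ⁺ p {y ∷ xs} (there x∈) e with p y
  ... | true  = there (∈-filterᵇ⁺ p x∈ e)
  ... | false = ∈-filterᵇ⁺ p x∈ e

  module _ {n} (G : Graph (Fin n)) where

    arcs : List (Fin n × Fin n)
    arcs = edges G ++ map swap (edges G)

    ∑-arcs : ∀ f → ∑ arcs f ≡ ∑ (edges G) (λ e → f e + f (swap e))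
    ∑-arcs f = trans (∑-++ (edges G) f) (trans (cong (∑ (edges G) f +_) (∑-map swap (edges G) f)) (sym (∑-+ (edges G) f (f ∘ swap))))

    length-arcs : length arcs ≡ 2 * ∣E G ∣
    length-arcs = trans (List.length-++ (edges G)) (cong (∣E G ∣ +_) (trans (List.length-map swap (edges G)) (sym (+-identityʳ _))))

    ∈-arcs : ∀ {u v} → adj G u v ≡ true → (u , v) ∈ arcs
    ∈-arcs {u} {v} a with Fin.<-cmp u v
    ... | tri< u<v _ _ = ∈-++⁺ˡ (MaximumExists.∈-edges⁺ G u<v a)
    ... | tri≈ _ u≡v _ = contradiction u≡v (MaximumExists.adj⇒≢ G a)
    ... | tri> _ _ v<u = ∈-++⁺ʳ (edges G) (∈-map⁺ swap (MaximumExists.∈-edges⁺ G v<u (trans (adj-sym G v u) a)))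

    length-filter-arcs : ∀ p → length (filterᵇ p arcs) ≡ ∑ (edges G) (λ e → 𝟙 (p e) + 𝟙 (p (swap e)))
    length-filter-arcs p = trans (length-filterᵇ p arcs) (∑-arcs (𝟙 ∘ p))

  ≡ᵇ-refl : ∀ i → (i ≡ᵇ i) ≡ true
  ≡ᵇ-refl zero    = refl
  ≡ᵇ-refl (suc i) = ≡ᵇ-refl i

  path-injective : ∀ {A : Set} {v w : ℕ → A} i → path v i ≡ path w i → ∀ t → t < i * 2 → v t ≡ w t
  path-injective (suc i) e t t<
    with e₁ , e′ ← List.∷-injective e
    with e₀ , e″ ← List.∷-injective e′
    with m≤n⇒m<n∨m≡n (s≤s⁻¹ t<)
  ... | inj₂ refl = e₁
  ... | inj₁ t<1+ with m≤n⇒m<n∨m≡n (s≤s⁻¹ t<1+)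
  ...   | inj₂ refl = e₀
  ...   | inj₁ t<i  = path-injective i e″ t t<i

  ∑-cartesianProduct : ∀ {A B : Set} (xs : List A) (ys : List B) (f : A × B → ℕ) →
    ∑ (cartesianProduct xs ys) f ≡ ∑ xs (λ x → ∑ ys (λ y → f (x , y)))
  ∑-cartesianProduct []       ys f = refl
  ∑-cartesianProduct (x ∷ xs) ys f = trans (∑-++ (map (x ,_) ys) f) (cong₂ _+_ (∑-map (x ,_) ys f) (∑-cartesianProduct xs ys f))

  ∑-tabulate : ∀ {A : Set} n (h : Fin n → A) (f : A → ℕ) (φ : ℕ → ℕ) → (∀ i → f (h i) ≡ φ (toℕ i)) → ∑ (List.tabulate h) f ≡ ∑< n φ
  ∑-tabulate zero    h f φ e = refl
  ∑-tabulate (suc n) h f φ e = cong₂ _+_ (e Fin.zero) (∑-tabulate n (h ∘ Fin.suc) f (φ ∘ suc) (e ∘ Fin.suc))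

  -- Induced cycles as periodic walks

  module _ (r : ℕ) where

    private
      k : ℕ
      k = (2 + r) * 2

    -- Indexing by all of ℕ turns a rotation into a shift of the index and avoids residues in the
    -- counting. The field `step`, by which a vertex determines its successor, is what tells the two
    -- directions of a copy apart.
    record Cycle {n} (G : Graph (Fin n)) : Set where
      field
        vertex      : ℕ → Fin n
        periodic    : ∀ t → vertex (k + t) ≡ vertex t
        consecutive : ∀ t → adj G (vertex (suc t)) (vertex t) ≡ true
        chordless   : ∀ t j → 2 ≤ j → 2 + j ≤ k → adj G (vertex (j + t)) (vertex t) ≡ false
        distinct    : ∀ t j → 0 < j → j < k → vertex (j + t) ≢ vertex t
        step        : ∀ s t → vertex s ≡ vertex t → vertex (suc s) ≡ vertex (suc t)

    module _ {n} {G : Graph (Fin n)} (g : Fin k → Fin n)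
             (g-inj : ∀ {i j} → g i ≡ g j → i ≡ j)
             (g-adj : ∀ i j → adj (C k) i j ≡ adj G (g i) (g j)) where

      private
        at : ℕ → Fin n
        at t = g (t mod k)

        toℕ-mod : ∀ t → toℕ (t mod k) ≡ t % k
        toℕ-mod t = Fin.toℕ-fromℕ< (m%n<n t k)

        mod-≡ : ∀ s t → s % k ≡ t % k → s mod k ≡ t mod k
        mod-≡ s t e = Fin.toℕ-injective (trans (toℕ-mod s) (trans e (sym (toℕ-mod t))))

        mod-% : ∀ s t → s mod k ≡ t mod k → s % k ≡ t % k
        mod-% s t e = trans (sym (toℕ-mod s)) (trans (cong toℕ e) (toℕ-mod t))

        C-adj : ∀ (i j : Fin k) {d} → ∣ toℕ i - toℕ j ∣ ≡ suc d → adj (C k) i j ≡ (suc d ≡ᵇ 1) ∨ (suc (suc d) ≡ᵇ k)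
        C-adj i j e rewrite e = refl

        %-≡ : ∀ s t j → s % k ≡ t % k → (j + s) % k ≡ (j + t) % k
        %-≡ s t j e = trans (%-distribˡ-+ j s k) (trans (cong (λ z → (j % k + z) % k) e) (sym (%-distribˡ-+ j t k)))

        -- Either `j + a` stays below `k`, or it wraps around exactly once and the complement `d` of
        -- `j` appears.
        gap′ : ∀ a j d → a < k → j + d ≡ k → 0 < j →
          ∣ (j + a) % k - a ∣ ≡ j ⊎ ∣ (j + a) % k - a ∣ ≡ d
        gap′ a j d a<k j+d≡k 0<j with j + a <? k
        ... | yes small = inj₁ (trans (cong ∣_- a ∣ (m<n⇒m%n≡m small)) (trans (cong ∣_- a ∣ (+-comm j a)) (trans (∣-∣-comm (a + j) a) (∣m-m+n∣≡n a j))))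
        ... | no large with b , eq ← m≤n⇒∃[o]m+o≡n (≮⇒≥ large) = inj₂ (begin
          ∣ (j + a) % k - a ∣    ≡⟨ cong (λ z → ∣ z % k - a ∣) (sym eq) ⟩
          ∣ (k + b) % k - a ∣    ≡⟨ cong ∣_- a ∣ (trans (cong (_% k) (+-comm k b)) ([m+n]%n≡m%n b k)) ⟩
          ∣ b % k - a ∣          ≡⟨ cong ∣_- a ∣ (m<n⇒m%n≡m b<k) ⟩
          ∣ b - a ∣              ≡⟨ cong (∣ b -_∣) a≡b+d ⟩
          ∣ b - b + d ∣          ≡⟨ ∣m-m+n∣≡n b d ⟩
          d                      ∎)
          where
          open ≡-Reasoning
          a≡b+d : a ≡ b + d
          a≡b+d = +-cancelˡ-≡ j a (b + d) (trans (sym eq) (trans (cong (_+ b) (sym j+d≡k)) (trans (+-assoc j d b) (cong (j +_) (+-comm d b)))))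
          b<k : b < k
          b<k = ≤-<-trans (subst (b ≤_) (sym a≡b+d) (m≤m+n b d)) a<k

        gap : ∀ t j d → j + d ≡ k → 0 < j →
          ∣ toℕ ((j + t) mod k) - toℕ (t mod k) ∣ ≡ j ⊎ ∣ toℕ ((j + t) mod k) - toℕ (t mod k) ∣ ≡ d
        gap t j d j+d≡k 0<j rewrite toℕ-mod (j + t) | toℕ-mod t | %-≡ t (t % k) j (sym (m%n%n≡m%n t k)) =
          gap′ (t % k) j d (m%n<n t k) j+d≡k 0<j

        adj-at : ∀ t j d → suc j + suc d ≡ k →
          adj G (at (suc j + t)) (at t) ≡ (suc j ≡ᵇ 1) ∨ (suc (suc j) ≡ᵇ k)
          ⊎ adj G (at (suc j + t)) (at t) ≡ (suc d ≡ᵇ 1) ∨ (suc (suc d) ≡ᵇ k)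
        adj-at t j d e with gap t (suc j) (suc d) e z<s
        ... | inj₁ p = inj₁ (trans (sym (g-adj _ _)) (C-adj ((suc j + t) mod k) (t mod k) p))
        ... | inj₂ p = inj₂ (trans (sym (g-adj _ _)) (C-adj ((suc j + t) mod k) (t mod k) p))

        ≡ᵇ-≢ : ∀ {a b} → a ≢ b → (a ≡ᵇ b) ≡ false
        ≡ᵇ-≢ {a} {b} ne with a ≡ᵇ b in e
        ... | false = refl
        ... | true  = contradiction (≡ᵇ⇒≡ a b (subst T (sym e) tt)) ne

        not-adjacent : ∀ j d → 2 + j + (2 + d) ≡ k → (2 + j ≡ᵇ 1) ∨ (3 + j ≡ᵇ k) ≡ false
        not-adjacent j d e = ≡ᵇ-≢ λ e′ → m≢1+m+n (3 + j) (trans e′ (trans (sym e) (shuffle j d)))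
          where
          shuffle : ∀ j d → 2 + j + (2 + d) ≡ suc (3 + j + d)
          shuffle = solve-∀

      cycle : Cycle G
      cycle = record
        { vertex      = at
        ; periodic    = λ t → cong g (mod-≡ (k + t) t (trans (cong (_% k) (+-comm k t)) ([m+n]%n≡m%n t k)))
        ; consecutive = λ t → con t
        ; chordless   = chord
        ; distinct    = dist
        ; step        = λ s t e → cong g (mod-≡ (suc s) (suc t) (%-≡ s t 1 (mod-% s t (g-inj e))))
        }
        where
        con : ∀ t → adj G (at (suc t)) (at t) ≡ true
        con t with adj-at t 0 (2 + r * 2) refl
        ... | inj₁ e = e
        ... | inj₂ e = trans e (≡ᵇ-refl (r * 2))
        shuffle : ∀ j d → 2 + j + (2 + d) ≡ 2 + (2 + j) + d
        shuffle = solve-∀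
        chord : ∀ t j → 2 ≤ j → 2 + j ≤ k → adj G (at (j + t)) (at t) ≡ false
        chord t (suc (suc j)) (s≤s (s≤s z≤n)) j≤
          with d , e ← m≤n⇒∃[o]m+o≡n j≤
          with e′ ← trans (shuffle j d) e
          with adj-at t (suc j) (suc d) e′
        ... | inj₁ p = trans p (not-adjacent j d e′)
        ... | inj₂ p = trans p (not-adjacent d j (trans (+-comm (2 + d) (2 + j)) e′))
        dist : ∀ t j → 0 < j → j < k → at (j + t) ≢ at t
        dist t j@(suc _) 0<j j<k e with d , eq ← m≤n⇒∃[o]m+o≡n j<k
          with gap t j (suc d) (trans (+-suc j d) eq) 0<j
        ... | inj₁ p = contradiction (trans (sym p) (trans (cong (λ i → ∣ toℕ i - toℕ (t mod k) ∣) (g-inj e)) (∣n-n∣≡0 (toℕ (t mod k))))) λ ()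
        ... | inj₂ p = contradiction (trans (sym p) (trans (cong (λ i → ∣ toℕ i - toℕ (t mod k) ∣) (g-inj e)) (∣n-n∣≡0 (toℕ (t mod k))))) λ ()

    open Cycle

    rotate : ∀ {n} {G : Graph (Fin n)} → ℕ → Cycle G → Cycle G
    rotate {G = G} s c = record
      { vertex      = v
      ; periodic    = λ t → trans (cong (vertex c) (x∙yz≈y∙xz s k t)) (periodic c (s + t))
      ; consecutive = λ t → subst (λ z → adj G (vertex c z) (v t) ≡ true) (sym (+-suc s t)) (consecutive c (s + t))
      ; chordless   = λ t j 2≤j j≤ → subst (λ z → adj G (vertex c z) (v t) ≡ false) (x∙yz≈y∙xz j s t) (chordless c (s + t) j 2≤j j≤)
      ; distinct    = λ t j 0<j j< → subst (λ z → vertex c z ≢ v t) (x∙yz≈y∙xz j s t) (distinct c (s + t) j 0<j j<)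
      ; step        = λ i j e → trans (cong (vertex c) (+-suc s i)) (trans (step c _ _ e) (cong (vertex c) (sym (+-suc s j))))
      }
      where
      v : ℕ → Fin _
      v t = vertex c (s + t)
      x∙yz≈y∙xz : ∀ a b c → a + (b + c) ≡ b + (a + c)
      x∙yz≈y∙xz = solve-∀

    vertex-% : ∀ {n} {G : Graph (Fin n)} (c : Cycle G) s t → vertex c (s + t % k) ≡ vertex c (s + t)
    vertex-% c s t = trans (sym (around (t / k))) (cong (vertex c) (trans (x∙yz≈y∙xz (t / k * k) s (t % k))
        (cong (s +_) (trans (+-comm (t / k * k) (t % k)) (sym (m≡m%n+[m/n]*n t k))))))
      where
      x∙yz≈y∙xz : ∀ a b c → a + (b + c) ≡ b + (a + c)
      x∙yz≈y∙xz = solve-∀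
      around : ∀ q → vertex c (q * k + (s + t % k)) ≡ vertex c (s + t % k)
      around zero    = refl
      around (suc q) = trans (cong (vertex c) (+-assoc k (q * k) _)) (trans (periodic c _) (around q))

    vertex-window : ∀ {n} {G : Graph (Fin n)} (c : Cycle G) s → s < k → ∀ j → ∃[ t ] (t < k × vertex c (s + t) ≡ vertex c j)
    vertex-window c s s<k j with d , e ← m≤n⇒∃[o]m+o≡n (<⇒≤ s<k) =
      (d + j) % k , m%n<n (d + j) k , trans (vertex-% c s (d + j)) (trans (cong (vertex c) (trans (sym (+-assoc s d j)) (cong (_+ j) e))) (periodic c j))

    private
      ahead : ∀ {n} {G : Graph (Fin n)} (c : Cycle G) {s s′} → s < s′ → s′ < k → vertex c s′ ≢ vertex c s
      ahead c {s} {s′} s<s′ s′<k with d , refl ← m≤n⇒∃[o]m+o≡n s<s′ =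
        subst (λ z → vertex c z ≢ vertex c s) (cong suc (+-comm d s)) (distinct c s (suc d) z<s (≤-<-trans (s≤s (m≤n+m d s)) s′<k))

    start-unique : ∀ {n} {G : Graph (Fin n)} (c : Cycle G) {s s′} → s < k → s′ < k → vertex c s ≡ vertex c s′ → s ≡ s′
    start-unique c {s} {s′} s<k s′<k e with <-cmp s s′
    ... | tri≈ _ s≡s′ _ = s≡s′
    ... | tri< s<s′ _ _ = contradiction (sym e) (ahead c s<s′ s′<k)
    ... | tri> _ _ s′<s = contradiction e (ahead c s′<s s<k)

    record Embedding {n} (G : Graph (Fin n)) : Set where
      field
        map-vertex : Fin k → Fin n
        injective  : ∀ {i j} → map-vertex i ≡ map-vertex j → i ≡ j
        preserves  : ∀ i j → adj (C k) i j ≡ adj G (map-vertex i) (map-vertex j)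

      toCycle : Cycle G
      toCycle = cycle map-vertex injective preserves

      private
        opposite-inj : ∀ {i j : Fin k} → opposite i ≡ opposite j → i ≡ j
        opposite-inj {i} {j} e = trans (sym (Fin.opposite-involutive i)) (trans (cong opposite e) (Fin.opposite-involutive j))

        opposite-gap : ∀ i j → ∣ toℕ (opposite i) - toℕ (opposite j) ∣ ≡ ∣ toℕ i - toℕ {k} j ∣
        opposite-gap i j = gap (toℕ i) (toℕ j) _ _ (complement i) (complement j)
          where
          complement : ∀ i → suc (toℕ i) + toℕ (opposite i) ≡ k
          complement i = trans (cong (suc (toℕ i) +_) (Fin.opposite-prop i)) (m+[n∸m]≡n (Fin.toℕ<n i))
          gap : ∀ a b c d → suc a + c ≡ k → suc b + d ≡ k → ∣ c - d ∣ ≡ ∣ a - b ∣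
          gap a b c d e e′ = trans (sym (∣m+n-m+o∣≡∣n-o∣ (a + b) c d)) (trans (cong₂ ∣_-_∣ left right) (trans (cong₂ ∣_-_∣ (+-comm b p) (+-comm a p)) (trans (∣m+n-m+o∣≡∣n-o∣ p b a) (∣-∣-comm b a))))
            where
            p : ℕ
            p = a + c
            left : a + b + c ≡ b + p
            left = regroup a b c
              where
              regroup : ∀ a b c → a + b + c ≡ b + (a + c)
              regroup = solve-∀
            right : a + b + d ≡ a + p
            right = trans (+-assoc a b d) (cong (a +_) (suc-injective (trans e′ (sym e))))

      reverse : Embedding G
      reverse = record
        { map-vertex = map-vertex ∘ opposite
        ; injective  = opposite-inj ∘ injective
        ; preserves  = λ i j → trans (C-cong i j (opposite i) (opposite j) (sym (opposite-gap i j))) (preserves (opposite i) (opposite j))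
        }
        where
        C-cong : ∀ (i j i′ j′ : Fin k) → ∣ toℕ i - toℕ j ∣ ≡ ∣ toℕ i′ - toℕ j′ ∣ → adj (C k) i j ≡ adj (C k) i′ j′
        C-cong i j i′ j′ e rewrite e = refl

      vertex-toℕ : ∀ j → vertex toCycle (toℕ j) ≡ map-vertex j
      vertex-toℕ j = cong map-vertex (Fin.toℕ-injective (trans (Fin.toℕ-fromℕ< (m%n<n (toℕ j) k)) (m<n⇒m%n≡m (Fin.toℕ<n j))))

    open Embedding

    private
      suc-% : ∀ t → suc t % k ≡ suc (t % k) % k
      suc-% t = trans (%-distribˡ-+ 1 t k) (sym (trans (%-distribˡ-+ 1 (t % k) k) (cong (λ z → (1 % k + z) % k) (m%n%n≡m%n t k))))

      opposite-mod : ∀ t b c → suc (t % k) + b ≡ k → c % k ≡ b → opposite (t mod k) ≡ c mod k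
      opposite-mod t b c e c≡b = Fin.toℕ-injective (begin
        toℕ (opposite (t mod k))   ≡⟨ Fin.opposite-prop (t mod k) ⟩
        k ∸ suc (toℕ (t mod k))    ≡⟨ cong (λ z → k ∸ suc z) (Fin.toℕ-fromℕ< (m%n<n t k)) ⟩
        k ∸ suc (t % k)            ≡⟨ cong (_∸ suc (t % k)) (sym e) ⟩
        suc (t % k) + b ∸ suc (t % k) ≡⟨ m+n∸m≡n (suc (t % k)) b ⟩
        b                          ≡⟨ c≡b ⟨
        c % k                      ≡⟨ Fin.toℕ-fromℕ< (m%n<n c k) ⟨
        toℕ (c mod k)              ∎)
        where open ≡-Reasoning

    -- An edge traversed by the reversed walk is traversed backwards by the original one. Only this
    -- much about reversal is needed to see that the two directions give different labellings.
    reverse-step : ∀ {n} {G : Graph (Fin n)} (g : Embedding G) t →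
      ∃[ t′ ] vertex (toCycle (reverse g)) t ≡ vertex (toCycle g) (suc t′) × vertex (toCycle (reverse g)) (suc t) ≡ vertex (toCycle g) t′
    reverse-step g t with m≤n⇒∃[o]m+o≡n (m%n<n t k)
    ... | suc b , e = b , cong (map-vertex g) (opposite-mod t (suc b) (suc b) e (m<n⇒m%n≡m (≤-trans (s≤s (m≤n+m (suc b) (t % k))) (≤-reflexive e)))) ,
      cong (map-vertex g) (opposite-mod (suc t) b b (trans (cong (λ z → suc z + b) next) (trans (sym (+-suc (suc (t % k)) b)) e)) (m<n⇒m%n≡m (≤-trans (s≤s (≤-trans (n≤1+n b) (m≤n+m (suc b) (t % k)))) (≤-reflexive e))))
      where
      next : suc t % k ≡ suc (t % k)
      next = trans (suc-% t) (m<n⇒m%n≡m (≤-trans (m≤m+n (suc (suc (t % k))) b) (≤-reflexive (trans (sym (+-suc (suc (t % k)) b)) e))))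
    -- The wrap-around: `t` has residue `k - 1`, so the reversed walk passes from index 0 to index
    -- `k - 1`. Index 0 is written as `suc (pred k)`.
    ... | zero , e = pred k , cong (map-vertex g) (opposite-mod t 0 k e (n%n≡0 k)) ,
      cong (map-vertex g) (opposite-mod (suc t) (pred k) (pred k) (cong (λ z → suc z + pred k) next) (m<n⇒m%n≡m (n<1+n (pred k))))
      where
      next : suc t % k ≡ 0
      next = trans (suc-% t) (trans (cong (_% k) (trans (sym (+-identityʳ _)) e)) (n%n≡0 k))

    -- The 2k labelled walks of every copy

    module Labellings {n} {G : Graph (Fin n)} (N : ℕ) (S : Fin N → Subset n) (S-injective : ∀ {i j} → S i ≡ S j → i ≡ j)
      (z : Fin N → Bool → Cycle G)
      (sound : ∀ i d t → vertex (z i d) t ∈ˢ S i)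
      (complete : ∀ i d {x} → x ∈ˢ S i → ∃[ j ] vertex (z i d) j ≡ x)
      (reversed : ∀ i t → ∃[ t′ ] vertex (z i false) t ≡ vertex (z i true) (suc t′) × vertex (z i false) (suc t) ≡ vertex (z i true) t′)
      where

      private
        Labelling : Set
        Labelling = Fin (N) × Bool × Fin k

        labellings : List Labelling
        labellings = cartesianProduct (allFin _) (cartesianProduct (true ∷ false ∷ []) (allFin k))

        walk : Fin N → Bool → ℕ → Fin n
        walk i d = vertex (z i d)

        leaf : Labelling → List (Fin n)
        leaf (i , d , s) = path (λ t → walk i d (toℕ s + t)) (2 + r)

        agree : ∀ i d s i′ d′ s′ → leaf (i , d , s) ≡ leaf (i′ , d′ , s′) → ∀ t → t < k → walk i d (toℕ s + t) ≡ walk i′ d′ (toℕ s′ + t)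
        agree i d s i′ d′ s′ = path-injective (2 + r)

        -- A full walk visits all `k` vertices of its copy, so it determines the vertex set.
        same-copy : ∀ i d s i′ d′ s′ → leaf (i , d , s) ≡ leaf (i′ , d′ , s′) → i ≡ i′
        same-copy i d s i′ d′ s′ e = S-injective (Subset.⊆-antisym (sub i d s i′ d′ s′ e) (sub i′ d′ s′ i d s (sym e)))
          where
          sub : ∀ i d s i′ d′ s′ → leaf (i , d , s) ≡ leaf (i′ , d′ , s′) → ∀ {x} → x ∈ˢ S i → x ∈ˢ S i′
          sub i d s i′ d′ s′ e {x} x∈
            with j , refl ← complete i d x∈
            with t , t<k , q ← vertex-window (z i d) (toℕ s) (Fin.toℕ<n s) j =
            subst (_∈ˢ S i′) (trans (sym (agree i d s i′ d′ s′ e t t<k)) q) (sound i′ d′ (toℕ s′ + t))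

        -- If both directions shared their first two vertices, the forward walk would come back to a
        -- vertex after two steps.
        opposite-directions : ∀ i s s′ → leaf (i , true , s) ≢ leaf (i , false , s′)
        opposite-directions i s s′ e
          with t′ , p , q ← reversed i (toℕ s′) =
          distinct c₀ t′ 2 z<s (s<s (s<s z<s)) (trans (sym (step c₀ (toℕ s) (suc t′) (trans at₀ p))) (trans at₁ q))
          where
          c₀ : Cycle G
          c₀ = z i true
          at₀ : walk i true (toℕ s) ≡ walk i false (toℕ s′)
          at₀ = subst₂ (λ x y → walk i true x ≡ walk i false y) (+-identityʳ _) (+-identityʳ _) (agree i true s i false s′ e 0 z<s)
          at₁ : walk i true (suc (toℕ s)) ≡ walk i false (suc (toℕ s′))
          at₁ = subst₂ (λ x y → walk i true x ≡ walk i false y) (+-comm (toℕ s) 1) (+-comm (toℕ s′) 1) (agree i true s i false s′ e 1 (s<s z<s))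

        same-start : ∀ i d s s′ → leaf (i , d , s) ≡ leaf (i , d , s′) → s ≡ s′
        same-start i d s s′ e = Fin.toℕ-injective (start-unique (z i d) (Fin.toℕ<n s) (Fin.toℕ<n s′)
          (subst₂ (λ x y → walk i d x ≡ walk i d y) (+-identityʳ _) (+-identityʳ _) (agree i d s i d s′ e 0 z<s)))

        leaf-injective : ∀ {x y} → leaf x ≡ leaf y → x ≡ y
        leaf-injective {i , d , s} {i′ , d′ , s′} e with same-copy i d s i′ d′ s′ e
        leaf-injective {i , true  , s} {_ , true  , s′} e | refl = cong (λ s → i , true , s) (same-start i true s s′ e)
        leaf-injective {i , false , s} {_ , false , s′} e | refl = cong (λ s → i , false , s) (same-start i false s s′ e)
        leaf-injective {i , true  , s} {_ , false , s′} e | refl = contradiction e (opposite-directions i s s′)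
        leaf-injective {i , false , s} {_ , true  , s′} e | refl = contradiction (sym e) (opposite-directions i s′ s)

      walks : List (List (Fin n))
      walks = map leaf labellings

      -- The hypothesis is averaged over rotations because no individual walk has a guaranteed
      -- weight. The factor 2 accounts for the two directions.
      walks-bound : ∀ F B →
        (∀ (y : Cycle G) → B ≤ ∑< k (λ s → F (path (λ t → vertex y (s + t)) (2 + r)))) →
        N * (2 * B) ≤ ∑ walks F
      walks-bound F B B≤ = begin
        N * (2 * B)                                        ≡⟨ cong (_* (2 * B)) (List.length-tabulate {n = N} (λ i → i)) ⟨
        length (allFin N) * (2 * B)                        ≡⟨ ∑-const (allFin N) (2 * B) ⟨
        ∑ (allFin N) (λ _ → 2 * B)                         ≤⟨ ∑-mono (allFin N) (λ {i} _ → +-mono-≤ (each i true) (+-monoˡ-≤ 0 (each i false))) ⟩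
        ∑ (allFin N) (λ i → ∑ (true ∷ false ∷ []) (λ d → ∑ (allFin k) (λ s → F (leaf (i , d , s)))))
          ≡⟨ ∑-cong (allFin N) (λ {i} _ → sym (∑-cartesianProduct (true ∷ false ∷ []) (allFin k) (λ w → F (leaf (i , w))))) ⟩
        ∑ (allFin N) (λ i → ∑ (cartesianProduct (true ∷ false ∷ []) (allFin k)) (λ w → F (leaf (i , w))))
          ≡⟨ ∑-cartesianProduct (allFin N) (cartesianProduct (true ∷ false ∷ []) (allFin k)) (F ∘ leaf) ⟨
        ∑ labellings (F ∘ leaf)                            ≡⟨ ∑-map leaf labellings F ⟨
        ∑ walks F                                          ∎
        where
        open ≤-Reasoning
        each : ∀ i d → B ≤ ∑ (allFin k) (λ s → F (leaf (i , d , s)))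
        each i d = ≤-trans (B≤ (z i d))
          (≤-reflexive (sym (∑-tabulate k id (λ s → F (leaf (i , d , s))) (λ s → F (path (λ t → walk i d (s + t)) (2 + r))) (λ _ → refl))))

      -- Distinct labellings give distinct leaves, so no leaf is counted twice. Separated from
      -- `walks-bound` so that a joint lower bound can be distributed over two different trees.
      walks-⊆ : ∀ (leaves : List (List (Fin n))) F → (∀ (y : Cycle G) → path (vertex y) (2 + r) ∈ leaves) → ∑ walks F ≤ ∑ leaves F
      walks-⊆ leaves F leaf∈ = ∑-⊆ F (Unique.map⁺ leaf-injective labellings-unique) sub
        where
        labellings-unique : Unique labellings
        labellings-unique = Unique.cartesianProduct⁺ (Unique.allFin⁺ _)
          (Unique.cartesianProduct⁺ (((λ ()) ∷ []) ∷ [] ∷ []) (Unique.allFin⁺ k))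
        sub : ∀ {p} → p ∈ walks → p ∈ leaves
        sub p∈ with (i , d , s) , _ , refl ← ∈-map⁻ leaf p∈ = leaf∈ (rotate (toℕ s) (z i d))

    module _ {n} (G : Graph (Fin n)) where

      copies : List (Subset n)
      copies = filter (λ S → induced≅? G S (C k)) (subsets n)

      private
        copy : Fin (c G (C k)) → Subset n
        copy = List.lookup copies

        copy-injective : ∀ i j → copy i ≡ copy j → i ≡ j
        copy-injective = MaximumExists.lookup-injective (Unique.filter⁺ _ (MaximumExists.subsets-unique n))

        module Copy (i : Fin (c G (C k))) where

          iso : G [ copy i ] ≅ C k
          iso = proj₂ (∈-filter⁻ (λ S → induced≅? G S (C k)) {xs = subsets n} (∈-lookup i))

          open Inverse (proj₁ iso)

          embedding : Embedding G
          embedding = record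
            { map-vertex = proj₁ ∘ from
            ; injective  = λ {i} {j} e → trans (sym (strictlyInverseˡ i)) (trans (cong to (Σ-≡ e)) (strictlyInverseˡ j))
            ; preserves  = λ i j → trans (sym (cong₂ (adj (C k)) (strictlyInverseˡ i) (strictlyInverseˡ j))) (sym (proj₂ iso (from i) (from j)))
            }

          directed : Bool → Embedding G
          directed true  = embedding
          directed false = reverse embedding

          sound : ∀ d t → vertex (toCycle (directed d)) t ∈ˢ copy i
          sound true  t = proj₂ (from (t mod k))
          sound false t = proj₂ (from (opposite (t mod k)))

          complete : ∀ d {x} → x ∈ˢ copy i → ∃[ j ] vertex (toCycle (directed d)) j ≡ x
          complete true  {x} x∈ = toℕ j , trans (vertex-toℕ embedding j) (cong proj₁ (strictlyInverseʳ (x , x∈)))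
            where
            j : Fin k
            j = to (x , x∈)
          complete false {x} x∈ = toℕ j , trans (vertex-toℕ (reverse embedding) j)
              (trans (cong (proj₁ ∘ from) (Fin.opposite-involutive (to (x , x∈)))) (cong proj₁ (strictlyInverseʳ (x , x∈))))
            where
            j : Fin k
            j = opposite (to (x , x∈))

      -- Each copy contributes its k rotations in both directions.
      open Labellings (c G (C k)) copy (λ {i} {j} → copy-injective i j) (λ i d → toCycle (Copy.directed i d))
        Copy.sound Copy.complete (λ i → reverse-step (Copy.embedding i)) public using (walks; walks-bound; walks-⊆)

      copies-bound : ∀ (leaves : List (List (Fin n))) F B →
        (∀ (z : Cycle G) → path (vertex z) (2 + r) ∈ leaves) →
        (∀ (z : Cycle G) → B ≤ ∑< k (λ s → F (path (λ t → vertex z (s + t)) (2 + r)))) →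
        c G (C k) * (2 * B) ≤ ∑ leaves F
      copies-bound leaves F B leaf∈ B≤ = ≤-trans (walks-bound F B B≤) (walks-⊆ leaves F leaf∈)

  -- The edge-by-edge process along a cycle

  extends-path⁺ : ∀ a b i → a (suc (i * 2)) ≡ true → (∀ j → j < suc (i * 2) → a j ≡ false) →
    (∀ j → j < suc i * 2 → b j ≡ false) → extends (path a (suc i)) (path b (suc i)) ≡ true
  extends-path⁺ a b i ha ha′ hb
    rewrite ha | hb (suc (i * 2)) ≤-refl | ha′ (i * 2) ≤-refl | hb (i * 2) (m<n⇒m<1+n (n<1+n (i * 2)))
          | none-path⁺ a i (λ j j< → ha′ j (m<n⇒m<1+n j<)) | none-path⁺ b i (λ j j< → hb j (m<n⇒m<1+n (m<n⇒m<1+n j<))) = refl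

  closes-path⁺ : ∀ a b i → a (suc (i * 2)) ≡ true → (∀ j → j < suc (i * 2) → a j ≡ false) →
    b 0 ≡ true → (∀ j → 0 < j → j < suc i * 2 → b j ≡ false) → closes (path a (suc i)) (path b (suc i)) ≡ true
  closes-path⁺ a b i ha ha′ hb hb′
    rewrite ha | ha′ (i * 2) ≤-refl | none-path⁺ a i (λ j j< → ha′ j (m<n⇒m<1+n j<)) = lastOnly-path⁺ i hb′
    where
    lastOnly-path⁺ : ∀ i → (∀ j → 0 < j → j < suc i * 2 → b j ≡ false) → lastOnly (path b (suc i)) ≡ true
    lastOnly-path⁺ zero    h rewrite h 1 z<s (s<s z<s) = hb
    lastOnly-path⁺ (suc i) h rewrite h (3 + i * 2) z<s ≤-refl | h (2 + i * 2) z<s (m<n⇒m<1+n ≤-refl) =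
      lastOnly-path⁺ i (λ j 0<j j< → h j 0<j (m<n⇒m<1+n (m<n⇒m<1+n j<)))

  -- The product of the reciprocals and of the numbers themselves is constant, so
  -- the arithmetic mean of them all is bounded below.
  am-gm-recip : ∀ a b q (w : ℕ → ℕ) ns → All (λ n → n * w n ≡ q) ns → let R = length ns in
    suc R * (a * b ^ R * q ^ R) ≤ a ^ suc R * product (map w ns) + b ^ suc R * q ^ R * sum ns
  am-gm-recip a b q w ns exact = begin
    suc R * g                              ≡⟨ cong (λ z → suc z * g) (List.length-map (K *_) ns) ⟨
    length xs * g                          ≤⟨ am-gm-bound g xs (trans prod (cong (λ z → g ^ suc z) (sym (List.length-map (K *_) ns)))) ⟩
    sum xs                                 ≡⟨ cong (a ^ suc R * product (map w ns) +_) (sum-* ns) ⟩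
    a ^ suc R * product (map w ns) + K * sum ns ∎
    where
    open ≤-Reasoning
    R K g : ℕ
    R = length ns
    K = b ^ suc R * q ^ R
    g = a * b ^ R * q ^ R
    xs : List ℕ
    -- The scaling makes every entry equal to `g` when all of `ns` equal a / b, the point at which
    -- the bound is tight.
    xs = a ^ suc R * product (map w ns) ∷ map (K *_) ns
    sum-* : ∀ ns → sum (map (K *_) ns) ≡ K * sum ns
    sum-* []       = sym (*-zeroʳ K)
    sum-* (n ∷ ns) = trans (cong (K * n +_) (sum-* ns)) (sym (*-distribˡ-+ K n _))
    interchange : ∀ a b c d → a * b * (c * d) ≡ a * c * (b * d)
    interchange = solve-∀
    products : ∀ ns → All (λ n → n * w n ≡ q) ns → product (map w ns) * product (map (K *_) ns) ≡ K ^ length ns * q ^ length ns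
    products []       []       = refl
    products (n ∷ ns) (e ∷ es) = trans (regroup (w n) (product (map w ns)) K n (product (map (K *_) ns)))
      (trans (cong₂ (λ x y → K * x * y) e (products ns es)) (interchange K q (K ^ length ns) (q ^ length ns)))
      where
      regroup : ∀ a b k n c → a * b * (k * n * c) ≡ k * (n * a) * (b * c)
      regroup = solve-∀
    prod : product xs ≡ g ^ suc R
    prod = let module ≡ = ≡-Reasoning in ≡.begin
      a ^ suc R * product (map w ns) * product (map (K *_) ns)       ≡.≡⟨ *-assoc (a ^ suc R) _ _ ⟩
      a ^ suc R * (product (map w ns) * product (map (K *_) ns))     ≡.≡⟨ cong (a ^ suc R *_) (products ns exact) ⟩
      a ^ suc R * (K ^ R * q ^ R)                                    ≡.≡⟨ cong (λ z → a ^ suc R * (z * q ^ R)) (^-distrib-* (b ^ suc R) (q ^ R) R) ⟩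
      a ^ suc R * ((b ^ suc R) ^ R * (q ^ R) ^ R * q ^ R)            ≡.≡⟨ cong (λ z → a ^ suc R * (z * (q ^ R) ^ R * q ^ R)) (trans (^-*-assoc b (suc R) R) (trans (cong (b ^_) (*-comm (suc R) R)) (sym (^-*-assoc b R (suc R))))) ⟩
      a ^ suc R * ((b ^ R) ^ suc R * (q ^ R) ^ R * q ^ R)            ≡.≡⟨ reassoc (a ^ suc R) ((b ^ R) ^ suc R) ((q ^ R) ^ R) (q ^ R) ⟩
      a ^ suc R * (b ^ R) ^ suc R * (q ^ R) ^ suc R                  ≡.≡⟨ cong (_* (q ^ R) ^ suc R) (^-distrib-* a (b ^ R) (suc R)) ⟨
      (a * b ^ R) ^ suc R * (q ^ R) ^ suc R                          ≡.≡⟨ ^-distrib-* (a * b ^ R) (q ^ R) (suc R) ⟨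
      g ^ suc R                                                      ≡.∎
      where
      reassoc : ∀ a b c d → a * (b * c * d) ≡ a * b * (d * c)
      reassoc = solve-∀

  length-filterᵇ-≤ : ∀ {A : Set} (p : A → Bool) xs → length (filterᵇ p xs) ≤ length xs
  length-filterᵇ-≤ p []       = z≤n
  length-filterᵇ-≤ p (x ∷ xs) with p x
  ... | true  = s≤s (length-filterᵇ-≤ p xs)
  ... | false = m≤n⇒m≤1+n (length-filterᵇ-≤ p xs)

  ∈⇒0<length : ∀ {A : Set} {x : A} {xs} → x ∈ xs → 0 < length xs
  ∈⇒0<length (here _)  = z<s
  ∈⇒0<length (there _) = z<s

  <⇒≡ᵇ-false : ∀ {i j} → i < j → (i ≡ᵇ j) ≡ false
  <⇒≡ᵇ-false {zero}  {suc j} _         = refl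
  <⇒≡ᵇ-false {suc i} {suc j} (s≤s i<j) = <⇒≡ᵇ-false i<j

  module Tree (r : ℕ) {n} (G : Graph (Fin n)) where

    V : Set
    V = Fin n

    k : ℕ
    k = (2 + r) * 2

    -- In use `p` consists of `suc i` pairs of vertices, so `i = r` is the step that completes the
    -- `(2 + r) * 2` vertices.
    fits : ℕ → List V → V × V → Bool
    fits i p (x , y) =
      if i ≡ᵇ r then closes (map (adj G x) p) (map (adj G y) p)
                else extends (map (adj G x) p) (map (adj G y) p)

    candidates : ℕ → List V → List (V × V)
    candidates zero    p = arcs G
    candidates (suc i) p = filterᵇ (fits i p) (arcs G)

    fits-extend : ∀ (v : ℕ → V) i x y → i < r →
      fits i (path v (suc i)) (x , y) ≡ extends (path (adj G x ∘ v) (suc i)) (path (adj G y ∘ v) (suc i))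
    fits-extend v i x y i<r = trans (cong (if_then closes as bs else extends as bs) (<⇒≡ᵇ-false i<r))
      (cong₂ extends (map-path (adj G x) v (suc i)) (map-path (adj G y) v (suc i)))
      where
      as bs : List Bool
      as = map (adj G x) (path v (suc i))
      bs = map (adj G y) (path v (suc i))

    fits-close : ∀ (v : ℕ → V) x y →
      fits r (path v (suc r)) (x , y) ≡ closes (path (adj G x ∘ v) (suc r)) (path (adj G y ∘ v) (suc r))
    fits-close v x y = trans (cong (if_then closes as bs else extends as bs) (≡ᵇ-refl r))
      (cong₂ closes (map-path (adj G x) v (suc r)) (map-path (adj G y) v (suc r)))
      where
      as bs : List Bool
      as = map (adj G x) (path v (suc r))
      bs = map (adj G y) (path v (suc r))

    push : V × V → List V → List V
    push (x , y) p = y ∷ x ∷ p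

    tree : ℕ → List (List V)
    tree zero    = [] ∷ []
    tree (suc i) = extend push (candidates i) (tree i)

    open Reciprocal (length (arcs G)) public
    open Cycle

    choices : Cycle r G → ℕ → ℕ
    choices z i = length (candidates i (path (vertex z) i))

    module _ (z : Cycle r G) where

      private
        v : ℕ → V
        v = vertex z

      -- The second hypothesis keeps the two indices at least 2 apart the other way round the cycle
      -- as well.
      far : ∀ i j → 2 + j ≤ i → 2 + i ≤ k + j → adj G (v i) (v j) ≡ false
      far i j 2+j≤i 2+i≤ with d , refl ← m≤n⇒∃[o]m+o≡n 2+j≤i =
        subst (λ w → adj G (v w) (v j) ≡ false) (cong (suc ∘ suc) (+-comm d j))
          (chordless z j (2 + d) (s≤s (s≤s z≤n)) (+-cancelʳ-≤ j _ _ (≤-trans (≤-reflexive (shuffle d j)) 2+i≤)))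
        where
        shuffle : ∀ d j → 2 + (2 + d) + j ≡ 2 + (2 + j + d)
        shuffle = solve-∀

      extend-true : ∀ i → i < r → extends (path (adj G (v (suc i * 2)) ∘ v) (suc i)) (path (adj G (v (suc (suc i * 2))) ∘ v) (suc i)) ≡ true
      extend-true i i<r = extends-path⁺ _ _ i (consecutive z (suc (i * 2)))
        (λ j j< → far _ j (s≤s j<) (≤-trans (n≤1+n _) (bound j)))
        (λ j j< → far _ j (s≤s j<) (bound j))
        where
        bound : ∀ j → 3 + suc i * 2 ≤ k + j
        bound j = ≤-trans (s≤s (s≤s (s≤s (s≤s (≤-trans (n≤1+n _) (*-monoˡ-≤ 2 i<r)))))) (m≤m+n k j)

      close-true : closes (path (adj G (v (suc r * 2)) ∘ v) (suc r)) (path (adj G (v (suc (suc r * 2))) ∘ v) (suc r)) ≡ true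
      close-true = closes-path⁺ _ _ r (consecutive z (suc (r * 2)))
        (λ j j< → far _ j (s≤s j<) (m≤m+n k j))
        (trans (adj-sym G _ _) (subst (λ w → adj G w (v (suc (suc r * 2))) ≡ true) (trans (cong v (sym (+-identityʳ k))) (periodic z 0)) (consecutive z (suc (suc r * 2)))))
        (λ j 0<j j< → far _ j (s≤s j<) (≤-trans (≤-reflexive (+-comm 1 k)) (+-monoʳ-≤ k 0<j)))

      next∈candidates : ∀ i → i < 2 + r → (v (i * 2) , v (suc (i * 2))) ∈ candidates i (path v i)
      next∈candidates zero    _ = ∈-arcs G (trans (adj-sym G _ _) (consecutive z 0))
      next∈candidates (suc i) i< = ∈-filterᵇ⁺ (fits i (path v (suc i))) (∈-arcs G (trans (adj-sym G _ _) (consecutive z (suc i * 2)))) ok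
        where
        ok : fits i (path v (suc i)) (v (suc i * 2) , v (suc (suc i * 2))) ≡ true
        ok with m≤n⇒m<n∨m≡n (s≤s⁻¹ (s≤s⁻¹ i<))
        ... | inj₁ i<r  = trans (fits-extend v i _ _ i<r) (extend-true i i<r)
        ... | inj₂ refl = trans (fits-close v _ _) close-true

      path∈tree : ∀ i → i ≤ 2 + r → path v i ∈ tree i
      path∈tree zero    _  = here refl
      path∈tree (suc i) i< = ∈-extend push (candidates i) (path∈tree i (<⇒≤ i<)) (next∈candidates i i<)

      -- The edge of the cycle itself is a choice, so the number is positive; as a number of arcs it
      -- is at most the `N` of the scaling.
      choices-recip : ∀ i → i < 2 + r → choices z i * recip (choices z i) ≡ Q
      choices-recip i i< = recip-≡ _ (∈⇒0<length (next∈candidates i i<)) (bounded i)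
        where
        bounded : ∀ i → choices z i ≤ length (arcs G)
        bounded zero    = ≤-refl
        bounded (suc i) = length-filterᵇ-≤ (fits i (path v (suc i))) (arcs G)

      private
        choices-edges : ∀ i → choices z (suc i) ≡ ∑ (edges G) (λ e → 𝟙 (fits i (path v (suc i)) e) + 𝟙 (fits i (path v (suc i)) (swap e)))
        choices-edges i = length-filter-arcs G (fits i (path v (suc i)))

      choices-extend : ∀ i → i < r → choices z (suc i) ≡ ∑ (edges G) (λ (x , y) → extensions (adj G x ∘ v) (adj G y ∘ v) i)
      choices-extend i i<r = trans (choices-edges i) (∑-cong (edges G) λ {(x , y)} _ → cong₂ _+_ (cong 𝟙 (fits-extend v i x y i<r)) (cong 𝟙 (fits-extend v i y x i<r)))

      choices-close : choices z (suc r) ≡ ∑ (edges G) (λ (x , y) → closures (adj G x ∘ v) (adj G y ∘ v) r)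
      choices-close = trans (choices-edges r) (∑-cong (edges G) λ {(x , y)} _ → cong₂ _+_ (cong 𝟙 (fits-close v x y)) (cong 𝟙 (fits-close v y x)))

      -- Last step first.
      later : ℕ → List ℕ
      later zero    = []
      later (suc i) = choices z (suc i) ∷ later i

      length-later : ∀ i → length (later i) ≡ i
      length-later zero    = refl
      length-later (suc i) = cong suc (length-later i)

      later-exact : ∀ i → i < 2 + r → All (λ n → n * recip n ≡ Q) (later i)
      later-exact zero    _  = []
      later-exact (suc i) i< = choices-recip (suc i) i< ∷ later-exact i (<⇒≤ i<)

      -- Turns a total over steps into a total over edges, each edge contributing the number of
      -- steps and orientations in which it is a choice.
      sum-later : sum (later (suc r)) ≡ ∑ (edges G) (λ (x , y) → ∑< r (extensions (adj G x ∘ v) (adj G y ∘ v)) + closures (adj G x ∘ v) (adj G y ∘ v) r)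
      sum-later = begin
        choices z (suc r) + sum (later r)   ≡⟨ +-comm (choices z (suc r)) _ ⟩
        sum (later r) + choices z (suc r)   ≡⟨ cong₂ _+_ (extended r ≤-refl) choices-close ⟩
        _                                   ≡⟨ ∑-+ (edges G) _ _ ⟨
        _                                   ∎
        where
        open ≡-Reasoning
        extended : ∀ i → i ≤ r → sum (later i) ≡ ∑ (edges G) (λ (x , y) → ∑< i (extensions (adj G x ∘ v) (adj G y ∘ v)))
        extended zero    _  = sym (trans (∑-const (edges G) 0) (*-zeroʳ ∣E G ∣))
        extended (suc i) i< = trans (cong₂ _+_ (choices-extend i i<) (extended i (<⇒≤ i<)))
          (trans (sym (∑-+ (edges G) _ _)) (∑-cong (edges G) λ {(x , y)} _ → trans (+-comm (extensions (adj G x ∘ v) (adj G y ∘ v) i) _) (sym (∑<-snoc i (extensions (adj G x ∘ v) (adj G y ∘ v))))))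

    weight : ℕ → List V → ℕ
    weight (suc i) (y ∷ x ∷ p) = recip (length (candidates i p)) * weight i p
    weight (suc i) _           = 0
    weight zero    _           = 1

    ∑weight≤ : ∀ i → ∑ (tree i) (weight i) ≤ Q ^ i
    ∑weight≤ zero    = ≤-refl
    ∑weight≤ (suc i) = ≤-trans
      (∑-extend push (candidates i) (weight i) (λ p _ → recip (length (candidates i p))) (weight (suc i)) Q (λ _ _ → refl)
        (λ p → ≤-trans (≤-reflexive (∑-const (candidates i p) _)) (recip-≤ (length (candidates i p)))) (tree i))
      (*-monoʳ-≤ Q (∑weight≤ i))

    -- The first choice always has 2m possibilities; the factor `length (arcs G)` cancels its
    -- reciprocal and leaves the reciprocals of the later choices.
    weight-path : ∀ z i → i < 2 + r → length (arcs G) * weight (suc i) (path (vertex z) (suc i)) ≡ Q * product (map recip (later z i))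
    weight-path z zero    _  = trans (cong (length (arcs G) *_) (*-identityʳ _)) (trans (choices-recip z 0 z<s) (sym (*-identityʳ Q)))
    weight-path z (suc i) i< = trans (swap-left (length (arcs G)) (recip (choices z (suc i))) _) (trans (cong (recip (choices z (suc i)) *_) (weight-path z i (<⇒≤ i<))) (swap-left (recip (choices z (suc i))) Q _))
      where
      swap-left : ∀ a b c → a * (b * c) ≡ b * (a * c)
      swap-left = solve-∀

  -- Four-cycles

  module _ {n} (G : Graph (Fin n)) where

    -- Plain counting suffices: 8 walks per copy, against 2m first arcs and, by `closes-exclusive`,
    -- at most m closing ones.
    4-cycles≤ : 0 < ∣E G ∣ → 4 * c G (C 4) ≤ ∣E G ∣ ^ 2
    4-cycles≤ 0<m = *-cancelˡ-≤ 2 (begin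
      2 * (4 * c G (C 4))                                  ≡⟨ regroup (c G (C 4)) ⟩
      c G (C 4) * (2 * 4)                                  ≤⟨ copies-bound 0 G (tree 2) (λ _ → 1) 4 (λ z → path∈tree z 2 ≤-refl) (λ _ → ≤-refl) ⟩
      ∑ (tree 2) (λ _ → 1)                                 ≤⟨ ∑-extend push (candidates 1) (λ _ → 1) (λ _ _ → 1) (λ _ → 1) ∣E G ∣ (λ _ _ → refl) few (tree 1) ⟩
      ∣E G ∣ * ∑ (tree 1) (λ _ → 1)                        ≤⟨ *-monoʳ-≤ ∣E G ∣ (∑-extend push (candidates 0) (λ _ → 1) (λ _ _ → 1) (λ _ → 1) (2 * ∣E G ∣) (λ _ _ → refl) (λ _ → ≤-reflexive (trans (∑-const (arcs G) 1) (trans (*-identityʳ _) (length-arcs G)))) (tree 0)) ⟩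
      ∣E G ∣ * (2 * ∣E G ∣ * 1)                            ≡⟨ regroup′ ∣E G ∣ ⟩
      2 * ∣E G ∣ ^ 2                                       ∎)
      where
      open Tree 0 G
      open ≤-Reasoning
      regroup : ∀ x → 2 * (4 * x) ≡ x * (2 * 4)
      regroup = solve-∀
      regroup′ : ∀ x → x * (2 * x * 1) ≡ 2 * (x * (x * 1))
      regroup′ = solve-∀
      few : ∀ p → ∑ (candidates 1 p) (λ _ → 1) ≤ ∣E G ∣
      few p = begin
        ∑ (candidates 1 p) (λ _ → 1)        ≡⟨ trans (∑-const (candidates 1 p) 1) (*-identityʳ _) ⟩
        length (candidates 1 p)             ≡⟨ length-filter-arcs G (fits 0 p) ⟩
        _                                   ≤⟨ ∑-mono (edges G) (λ {(x , y)} _ → closes-exclusive (map (adj G x) p) (map (adj G y) p)) ⟩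
        ∑ (edges G) (λ _ → 1)               ≡⟨ trans (∑-const (edges G) 1) (*-identityʳ _) ⟩
        ∣E G ∣                              ∎

  -- Even cycles of length at least eight

  module _ {n} (G : Graph (Fin n)) (r : ℕ) (2≤r : 2 ≤ r) where

    private
      open Tree r G
      open Cycle
      m R l : ℕ
      m = ∣E G ∣
      R = suc r
      l = 2 + r

      P : ℕ
      P = (2 * R) ^ R

      -- Exchanging the sums over rotations and over edges reduces the bound to `candidacies≤` for a
      -- single edge.
      choices-total : (z : Cycle r G) → ∑< k (λ s → sum (later (rotate r s z) R)) ≤ m * l
      choices-total z = begin
        ∑< k (λ s → sum (later (rotate r s z) R))                ≡⟨ ∑<-cong k (λ s _ → sum-later (rotate r s z)) ⟩
        ∑< k (λ s → ∑ (edges G) (λ (x , y) → count x y s))       ≡⟨ ∑<-∑-swap k (edges G) (λ s (x , y) → count x y s) ⟩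
        ∑ (edges G) (λ (x , y) → ∑< k (count x y))               ≤⟨ ∑-mono (edges G) (λ {(x , y)} _ → candidacies≤ r 2≤r (adj G x ∘ vertex z) (adj G y ∘ vertex z)
                                                                       (λ t → cong (adj G x) (periodic z t)) (λ t → cong (adj G y) (periodic z t))) ⟩
        ∑ (edges G) (λ _ → l)                                    ≡⟨ ∑-const (edges G) l ⟩
        m * l                                                    ∎
        where
        open ≤-Reasoning
        count : Fin n → Fin n → ℕ → ℕ
        count x y s = ∑< r (extensions (λ t → adj G x (vertex z (s + t))) (λ t → adj G y (vertex z (s + t))))
          + closures (λ t → adj G x (vertex z (s + t))) (λ t → adj G y (vertex z (s + t))) r

      product-later : (z : Cycle r G) → ℕ
      product-later z = product (map recip (later z R))

      -- AM-GM is applied to each rotation with its equality point at m / (2R). In units of m P Qᴿ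
      -- the k = 2l rotations supply 2l · l, of which the sums of choices consume 2R · l. As l - R =
      -- 1, exactly 2l remains.
      products-total : (z : Cycle r G) → 2 * l * m * P * Q ^ R ≤ m ^ l * ∑< k (λ s → product-later (rotate r s z))
      products-total z = +-cancelʳ-≤ ((2 * R) ^ l * Q ^ R * (m * l)) _ _ (begin
        2 * l * m * P * Q ^ R + (2 * R) ^ l * Q ^ R * (m * l)                         ≡⟨ regroup r m P (Q ^ R) ⟩
        k * (l * (m * P * Q ^ R))                                                     ≡⟨ ∑<-const k (l * (m * P * Q ^ R)) ⟨
        ∑< k (λ _ → l * (m * P * Q ^ R))                                              ≤⟨ ∑<-mono k (λ s _ → each (rotate r s z)) ⟩
        ∑< k (λ s → m ^ l * product-later (rotate r s z) + (2 * R) ^ l * Q ^ R * sum (later (rotate r s z) R))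
          ≡⟨ trans (∑<-+ k (λ s → m ^ l * product-later (rotate r s z)) (λ s → (2 * R) ^ l * Q ^ R * sum (later (rotate r s z) R)))
               (cong₂ _+_ (∑<-*ˡ k (m ^ l) (λ s → product-later (rotate r s z))) (∑<-*ˡ k ((2 * R) ^ l * Q ^ R) (λ s → sum (later (rotate r s z) R)))) ⟩
        m ^ l * ∑< k (λ s → product-later (rotate r s z)) + (2 * R) ^ l * Q ^ R * ∑< k (λ s → sum (later (rotate r s z) R))
          ≤⟨ +-monoʳ-≤ (m ^ l * ∑< k (λ s → product-later (rotate r s z))) (*-monoʳ-≤ ((2 * R) ^ l * Q ^ R) (choices-total z)) ⟩
        m ^ l * ∑< k (λ s → product-later (rotate r s z)) + (2 * R) ^ l * Q ^ R * (m * l) ∎)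
        where
        open ≤-Reasoning
        each : ∀ y → l * (m * P * Q ^ R) ≤ m ^ l * product-later y + (2 * R) ^ l * Q ^ R * sum (later y R)
        each y = subst (λ i → suc i * (m * (2 * R) ^ i * Q ^ i) ≤ m ^ suc i * product-later y + (2 * R) ^ suc i * Q ^ i * sum (later y R)) (length-later y R)
          (am-gm-recip m (2 * R) Q recip (later y R) (later-exact y R ≤-refl))
        regroup : ∀ r m p q → 2 * (2 + r) * m * p * q + (2 * (1 + r) * p) * q * (m * (2 + r)) ≡ (2 + r) * 2 * ((2 + r) * (m * p * q))
        regroup = solve-∀

    long-even-cycles≤ : 0 < m → 2 * l * P * c G (C k) ≤ m ^ l
    long-even-cycles≤ 0<m = *-cancelʳ-≤ _ _ (2 * m * Q ^ l) {{m*n≢0 (2 * m) (Q ^ l) {{m*n≢0 2 m {{_}} {{>-nonZero 0<m}}}} {{m^n≢0 Q l {{length (arcs G) !≢0}}}}}} (begin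
      2 * l * P * c G (C k) * (2 * m * Q ^ l)                   ≡⟨ regroup l P (c G (C k)) m Q (Q ^ R) ⟩
      c G (C k) * (2 * (Q * (2 * l * m * P * Q ^ R)))           ≤⟨ copies-bound r G (tree l) F (Q * (2 * l * m * P * Q ^ R)) (λ z → path∈tree z l ≤-refl) enough ⟩
      ∑ (tree l) F                                              ≡⟨ trans (∑-*ˡ (tree l) (m ^ l) (λ p → length (arcs G) * weight l p)) (cong (m ^ l *_) (∑-*ˡ (tree l) (length (arcs G)) (weight l))) ⟩
      m ^ l * (length (arcs G) * ∑ (tree l) (weight l))         ≤⟨ *-monoʳ-≤ (m ^ l) (*-mono-≤ (≤-reflexive (length-arcs G)) (∑weight≤ l)) ⟩
      m ^ l * (2 * m * Q ^ l)                                   ∎)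
      where
      open ≤-Reasoning
      F : List V → ℕ
      F p = m ^ l * (length (arcs G) * weight l p)
      regroup : ∀ l p c m q s → 2 * l * p * c * (2 * m * (q * s)) ≡ c * (2 * (q * (2 * l * m * p * s)))
      regroup = solve-∀
      swap-left : ∀ a b c → a * (b * c) ≡ b * (a * c)
      swap-left = solve-∀
      enough : ∀ z → Q * (2 * l * m * P * Q ^ R) ≤ ∑< k (λ s → F (path (vertex (rotate r s z)) l))
      enough z = begin
        Q * (2 * l * m * P * Q ^ R)                                      ≤⟨ *-monoʳ-≤ Q (products-total z) ⟩
        Q * (m ^ l * ∑< k (λ s → product-later (rotate r s z)))          ≡⟨ swap-left Q (m ^ l) _ ⟩
        m ^ l * (Q * ∑< k (λ s → product-later (rotate r s z)))          ≡⟨ cong (m ^ l *_) (∑<-*ˡ k Q (λ s → product-later (rotate r s z))) ⟨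
        m ^ l * ∑< k (λ s → Q * product-later (rotate r s z))            ≡⟨ ∑<-*ˡ k (m ^ l) (λ s → Q * product-later (rotate r s z)) ⟨
        ∑< k (λ s → m ^ l * (Q * product-later (rotate r s z)))          ≡⟨ ∑<-cong k (λ s _ → cong (m ^ l *_) (sym (weight-path (rotate r s z) R ≤-refl))) ⟩
        ∑< k (λ s → F (path (vertex (rotate r s z)) l))                  ∎

  -- Hexagons: the mean over all rotations

  ∏< : ℕ → (ℕ → ℕ) → ℕ
  ∏< zero    f = 1
  ∏< (suc n) f = f 0 * ∏< n (f ∘ suc)

  ∏<-cong : ∀ n {f g : ℕ → ℕ} → (∀ i → f i ≡ g i) → ∏< n f ≡ ∏< n g
  ∏<-cong zero    h = refl
  ∏<-cong (suc n) h = cong₂ _*_ (h 0) (∏<-cong n (h ∘ suc))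

  ∏<-* : ∀ n (f g : ℕ → ℕ) → ∏< n (λ i → f i * g i) ≡ ∏< n f * ∏< n g
  ∏<-* zero    f g = refl
  ∏<-* (suc n) f g = trans (cong (f 0 * g 0 *_) (∏<-* n (f ∘ suc) (g ∘ suc))) (interchange (f 0) (g 0) _ _)
    where
    interchange : ∀ a b c d → a * b * (c * d) ≡ a * c * (b * d)
    interchange = solve-∀

  ∏<-const : ∀ n x → ∏< n (λ _ → x) ≡ x ^ n
  ∏<-const zero    x = refl
  ∏<-const (suc n) x = cong (x *_) (∏<-const n x)

  -- Only the product over all blocks has to be a power of `g`; a single block may be off by a
  -- factor that cancels against the others.
  am-gm-blocks : ∀ g b K (L : ℕ → List ℕ) → (∀ s → length (L s) ≡ b) → ∏< K (product ∘ L) ≡ (g ^ b) ^ K →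
    K * b * g ≤ ∑< K (sum ∘ L)
  am-gm-blocks g b K L len prod = begin
    K * b * g                 ≡⟨ cong (_* g) (length-blocks K L len) ⟨
    length (blocks K L) * g   ≤⟨ am-gm-bound g (blocks K L) (trans (product-blocks K L) (trans prod (trans (^-*-assoc g b K) (cong (g ^_) (trans (*-comm b K) (sym (length-blocks K L len))))))) ⟩
    sum (blocks K L)          ≡⟨ sum-blocks K L ⟩
    ∑< K (sum ∘ L)            ∎
    where
    open ≤-Reasoning
    blocks : ℕ → (ℕ → List ℕ) → List ℕ
    blocks zero    L = []
    blocks (suc K) L = L 0 ++ blocks K (L ∘ suc)
    length-blocks : ∀ K L → (∀ s → length (L s) ≡ b) → length (blocks K L) ≡ K * b
    length-blocks zero    L h = refl
    length-blocks (suc K) L h = trans (List.length-++ (L 0)) (cong₂ _+_ (h 0) (length-blocks K (L ∘ suc) (h ∘ suc)))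
    product-blocks : ∀ K L → product (blocks K L) ≡ ∏< K (product ∘ L)
    product-blocks zero    L = refl
    product-blocks (suc K) L = trans (ListAction.product-++ (L 0) _) (cong (product (L 0) *_) (product-blocks K (L ∘ suc)))
    sum-blocks : ∀ K L → sum (blocks K L) ≡ ∑< K (sum ∘ L)
    sum-blocks zero    L = refl
    sum-blocks (suc K) L = trans (ListAction.sum-++ (L 0) _) (cong (sum (L 0) +_) (sum-blocks K (L ∘ suc)))

  -- The weights for hexagons. The ratio d (5 + s) / d (3 + s) cancels only in the
  -- product over a full turn, so the mean is taken over all six rotations.
  module HexagonMean (e : ℕ) (3*6≡e : 3 * 6 ≡ e) (m q : ℕ) (q≢0 : q ≢ 0)
    (n₂ n₃ W d w₂ w₃ wW wd : ℕ → ℕ)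
    (e₂ : ∀ s → n₂ s * w₂ s ≡ q) (e₃ : ∀ s → n₃ s * w₃ s ≡ q) (eW : ∀ s → W s * wW s ≡ q) (ed : ∀ s → d s * wd s ≡ q)
    (d-periodic : ∀ s → d (6 + s) ≡ d s) where

    -- The weights of one walk under the two processes, up to a common factor. Both are homogeneous
    -- of degree three in the scaled quantities, which explains the extra `q` in `t₁`.
    t₁ t₂ : ℕ → ℕ
    t₁ s = m * m * m * (q * w₂ s * w₃ s)
    t₂ s = m * m * m * (w₂ s * wW s * (d (5 + s) * wd (3 + s)))

    private
      q³ g : ℕ
      q³ = q * q * q
      g = e * m * q³

      -- `n₂` is listed twice because its reciprocal occurs in both `t₁` and `t₂`. The coefficients
      -- 3 and 6 make all six entries equal to `g` at n₂ = m / 3 and n₃ = W = m / 6 with degree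
      -- ratio 1, and they give `n₂`, `n₃` and `W` the same total coefficient.
      block : ℕ → List ℕ
      block s = t₁ s ∷ t₂ s ∷ 3 * e * q³ * n₂ s ∷ 3 * e * q³ * n₂ s ∷ 6 * e * q³ * n₃ s ∷ 6 * e * q³ * W s ∷ []

      block-product : ∀ s → product (block s) * q ≡ g ^ 6 * (d (5 + s) * wd (3 + s))
      block-product s = begin
        product (block s) * q
          ≡⟨ collect 3 6 e m q (q * q * q) (n₂ s) (n₃ s) (W s) (w₂ s) (w₃ s) (wW s) (d (5 + s) * wd (3 + s)) ⟩
        (m * m * m) * (m * m * m) * (q * q) * (3 * 6 * (e * e) * (3 * 6 * (e * e))) * (q³ * q³ * q³ * q³)
          * (n₂ s * w₂ s * (n₂ s * w₂ s) * (n₃ s * w₃ s) * (W s * wW s)) * (d (5 + s) * wd (3 + s))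
          ≡⟨ cong₂ (λ x y → (m * m * m) * (m * m * m) * (q * q) * x * (q³ * q³ * q³ * q³) * y * (d (5 + s) * wd (3 + s)))
               (cong (λ x → x * (e * e) * (x * (e * e))) 3*6≡e)
               (cong₂ _*_ (cong₂ _*_ (cong₂ _*_ (e₂ s) (e₂ s)) (e₃ s)) (eW s)) ⟩
        (m * m * m) * (m * m * m) * (q * q) * (e * (e * e) * (e * (e * e))) * (q³ * q³ * q³ * q³) * (q * q * q * q) * (d (5 + s) * wd (3 + s))
          ≡⟨ finish e m q (d (5 + s) * wd (3 + s)) ⟩
        g ^ 6 * (d (5 + s) * wd (3 + s)) ∎
        where
        open ≡-Reasoning
        collect : ∀ x y e m q r n₂ n₃ W w₂ w₃ wW z →
          m * m * m * (q * w₂ * w₃) * (m * m * m * (w₂ * wW * z) * (x * e * r * n₂ * (x * e * r * n₂ * (y * e * r * n₃ * (y * e * r * W * 1))))) * q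
          ≡ (m * m * m) * (m * m * m) * (q * q) * (x * y * (e * e) * (x * y * (e * e))) * (r * r * r * r) * (n₂ * w₂ * (n₂ * w₂) * (n₃ * w₃) * (W * wW)) * z
        collect = solve-∀
        finish : ∀ e m q z → (m * m * m) * (m * m * m) * (q * q) * (e * (e * e) * (e * (e * e))) * (q * q * q * (q * q * q) * (q * q * q) * (q * q * q)) * (q * q * q * q) * z
          ≡ (e * m * (q * q * q)) * ((e * m * (q * q * q)) * ((e * m * (q * q * q)) * ((e * m * (q * q * q)) * ((e * m * (q * q * q)) * ((e * m * (q * q * q)) * 1))))) * z
        finish = solve-∀

      ratios : ∏< 6 (λ s → d (5 + s)) ≡ ∏< 6 (λ s → d (3 + s))
      ratios = trans (cong₂ (λ x y → d 5 * (d 6 * (d 7 * (d 8 * (x * (y * 1)))))) (d-periodic 3) (d-periodic 4)) (turn (d 5) (d 6) (d 7) (d 8) (d 3) (d 4))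
        where
        turn : ∀ a b c e f g → a * (b * (c * (e * (f * (g * 1))))) ≡ f * (g * (a * (b * (c * (e * 1)))))
        turn = solve-∀

      total-product : ∏< 6 (product ∘ block) ≡ (g ^ 6) ^ 6
      total-product = *-cancelʳ-≡ _ _ (q ^ 6) {{m^n≢0 q 6 {{≢-nonZero q≢0}}}} (begin
        ∏< 6 (product ∘ block) * q ^ 6                                                     ≡⟨ cong (∏< 6 (product ∘ block) *_) (∏<-const 6 q) ⟨
        ∏< 6 (product ∘ block) * ∏< 6 (λ _ → q)                                            ≡⟨ ∏<-* 6 (product ∘ block) (λ _ → q) ⟨
        ∏< 6 (λ s → product (block s) * q)                                                 ≡⟨ ∏<-cong 6 block-product ⟩
        ∏< 6 (λ s → g ^ 6 * (d (5 + s) * wd (3 + s)))                                      ≡⟨ ∏<-* 6 (λ _ → g ^ 6) (λ s → d (5 + s) * wd (3 + s)) ⟩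
        ∏< 6 (λ _ → g ^ 6) * ∏< 6 (λ s → d (5 + s) * wd (3 + s))                           ≡⟨ cong₂ _*_ (∏<-const 6 (g ^ 6)) (∏<-* 6 (λ s → d (5 + s)) (λ s → wd (3 + s))) ⟩
        (g ^ 6) ^ 6 * (∏< 6 (λ s → d (5 + s)) * ∏< 6 (λ s → wd (3 + s)))                   ≡⟨ cong (λ z → (g ^ 6) ^ 6 * (z * ∏< 6 (λ s → wd (3 + s)))) ratios ⟩
        (g ^ 6) ^ 6 * (∏< 6 (λ s → d (3 + s)) * ∏< 6 (λ s → wd (3 + s)))                   ≡⟨ cong ((g ^ 6) ^ 6 *_) (trans (sym (∏<-* 6 (λ s → d (3 + s)) (λ s → wd (3 + s)))) (trans (∏<-cong 6 (λ s → ed (3 + s))) (∏<-const 6 q))) ⟩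
        (g ^ 6) ^ 6 * q ^ 6                                                                ∎)
        where open ≡-Reasoning

    mean : 36 * (e * m * q³) ≤ ∑< 6 (λ s → t₁ s + t₂ s) + 6 * e * q³ * ∑< 6 (λ s → n₂ s + n₃ s + W s)
    mean = begin
      36 * g                                                   ≤⟨ am-gm-blocks g 6 6 block (λ _ → refl) total-product ⟩
      ∑< 6 (sum ∘ block)                                       ≡⟨ ∑<-cong 6 (λ s _ → split (t₁ s) (t₂ s) e q³ (n₂ s) (n₃ s) (W s)) ⟩
      ∑< 6 (λ s → t₁ s + t₂ s + 6 * e * q³ * (n₂ s + n₃ s + W s)) ≡⟨ ∑<-+ 6 (λ s → t₁ s + t₂ s) (λ s → 6 * e * q³ * (n₂ s + n₃ s + W s)) ⟩
      ∑< 6 (λ s → t₁ s + t₂ s) + ∑< 6 (λ s → 6 * e * q³ * (n₂ s + n₃ s + W s)) ≡⟨ cong (∑< 6 (λ s → t₁ s + t₂ s) +_) (∑<-*ˡ 6 (6 * e * q³) (λ s → n₂ s + n₃ s + W s)) ⟩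
      ∑< 6 (λ s → t₁ s + t₂ s) + 6 * e * q³ * ∑< 6 (λ s → n₂ s + n₃ s + W s) ∎
      where
      open ≤-Reasoning
      split : ∀ t₁ t₂ e r n₂ n₃ W → t₁ + (t₂ + (3 * e * r * n₂ + (3 * e * r * n₂ + (6 * e * r * n₃ + (6 * e * r * W + 0))))) ≡ t₁ + t₂ + 6 * e * r * (n₂ + n₃ + W)
      split = solve-∀

  -- Hexagons: how often an edge is counted

  bridges : List Bool → Bool
  bridges (a ∷ as@(_ ∷ _)) = a ∧ lastOnly as
  bridges _                = false

  -- The contributions of an edge to `n₂`, `n₃` and `W` for one starting point. As `W` is a sum of
  -- degrees, the edge counts there once for each endpoint adjacent to exactly the two ends of the
  -- path on five vertices.
  roles : (a b : ℕ → Bool) → ℕ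
  roles a b = extensions a b 0 + closures a b 1 + (𝟙 (bridges (a 4 ∷ path a 2)) + 𝟙 (bridges (b 4 ∷ path b 2)))

  turns : (a b : ℕ → Bool) → ℕ
  turns a b = ∑< 6 (λ s → roles (λ t → a (s + t)) (λ t → b (s + t)))

  private
    cyclic : Vec Bool 6 → ℕ → Bool
    cyclic (a ∷ _) 0 = a
    cyclic (_ ∷ a ∷ _) 1 = a
    cyclic (_ ∷ _ ∷ a ∷ _) 2 = a
    cyclic (_ ∷ _ ∷ _ ∷ a ∷ _) 3 = a
    cyclic (_ ∷ _ ∷ _ ∷ _ ∷ a ∷ _) 4 = a
    cyclic (_ ∷ _ ∷ _ ∷ _ ∷ _ ∷ a ∷ _) 5 = a
    cyclic as (suc (suc (suc (suc (suc (suc t)))))) = cyclic as t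

    all : ∀ n → (Vec Bool n → Bool) → Bool
    all zero    f = f []
    all (suc n) f = all n (f ∘ (true ∷_)) ∧ all n (f ∘ (false ∷_))

    all-sound : ∀ n f → all n f ≡ true → ∀ as → f as ≡ true
    all-sound zero    f h []           = h
    all-sound (suc n) f h (true  ∷ as) = all-sound n _ (proj₁ (∧-true (all n (f ∘ (true ∷_))) h)) as
    all-sound (suc n) f h (false ∷ as) = all-sound n _ (proj₂ (∧-true (all n (f ∘ (true ∷_))) h)) as

    small : Vec Bool 6 → Vec Bool 6 → Bool
    small as bs = turns (cyclic as) (cyclic bs) ≤ᵇ 4

    checked : all 6 (λ as → all 6 (small as)) ≡ true
    checked = refl

    turns-cong : ∀ {a a′ b b′ : ℕ → Bool} → (∀ t → a t ≡ a′ t) → (∀ t → b t ≡ b′ t) → turns a b ≡ turns a′ b′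
    turns-cong {a} {a′} {b} {b′} ha hb = ∑<-cong 6 λ s _ → cong-roles (λ t → ha (s + t)) (λ t → hb (s + t))
      where
      cong-roles : ∀ {a a′ b b′ : ℕ → Bool} → (∀ t → a t ≡ a′ t) → (∀ t → b t ≡ b′ t) → roles a b ≡ roles a′ b′
      cong-roles ha hb = cong₂ _+_
        (cong₂ _+_ (cong₂ (λ x y → 𝟙 (extends x y) + 𝟙 (extends y x)) (path-cong ha 1) (path-cong hb 1))
                   (cong₂ (λ x y → 𝟙 (closes x y) + 𝟙 (closes y x)) (path-cong ha 2) (path-cong hb 2)))
        (cong₂ (λ x y → 𝟙 (bridges x) + 𝟙 (bridges y)) (cong₂ _∷_ (ha 4) (path-cong ha 2)) (cong₂ _∷_ (hb 4) (path-cong hb 2)))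

    cyclic-≡ : ∀ (a : ℕ → Bool) → (∀ t → a (6 + t) ≡ a t) → ∀ t → a t ≡ cyclic (a 0 ∷ a 1 ∷ a 2 ∷ a 3 ∷ a 4 ∷ a 5 ∷ []) t
    cyclic-≡ a h 0 = refl
    cyclic-≡ a h 1 = refl
    cyclic-≡ a h 2 = refl
    cyclic-≡ a h 3 = refl
    cyclic-≡ a h 4 = refl
    cyclic-≡ a h 5 = refl
    cyclic-≡ a h (suc (suc (suc (suc (suc (suc t)))))) = trans (h t) (cyclic-≡ a h t)

  -- Six values of each sequence determine everything, and the resulting 2¹² patterns are settled by
  -- evaluation in `checked`. The value 4 is attained by an edge attached to two opposite vertices,
  -- one endpoint to each.
  turns≤4 : ∀ a b → (∀ t → a (6 + t) ≡ a t) → (∀ t → b (6 + t) ≡ b t) → turns a b ≤ 4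
  turns≤4 a b ha hb = ≤-trans (≤-reflexive (turns-cong (cyclic-≡ a ha) (cyclic-≡ b hb)))
    (≤ᵇ⇒≤ _ 4 (subst T (sym (all-sound 6 (small as) (all-sound 6 (λ as → all 6 (small as)) checked as) bs)) tt))
    where
    as bs : Vec Bool 6
    as = a 0 ∷ a 1 ∷ a 2 ∷ a 3 ∷ a 4 ∷ a 5 ∷ []
    bs = b 0 ∷ b 1 ∷ b 2 ∷ b 3 ∷ b 4 ∷ b 5 ∷ []

  ∑-point : ∀ {A : Set} (eq : A → Bool) (f : A → ℕ) xs x → Unique xs → (∀ {a} → eq a ≡ true → a ≡ x) →
    ∑ xs (λ a → f a * 𝟙 (eq a)) ≤ f x
  ∑-point eq f []       x u        h = z≤n
  ∑-point eq f (a ∷ xs) x (a∉ ∷ u) h with eq a in e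
  ... | false rewrite *-zeroʳ (f a) = ∑-point eq f xs x u h
  ... | true with refl ← h e = ≤-reflexive (trans (cong₂ _+_ (*-identityʳ (f a)) rest) (+-identityʳ (f a)))
    where
    rest : ∑ xs (λ b → f b * 𝟙 (eq b)) ≡ 0
    rest = trans (∑-cong xs λ {b} b∈ → trans (cong (f b *_) (𝟙-false λ e′ → All.lookup a∉ b∈ (sym (h e′)))) (*-zeroʳ (f b)))
      (trans (∑-const xs 0) (*-zeroʳ (length xs)))

  -- Hexagons: the second process and the final bound

  module _ {n} (G : Graph (Fin n)) where

    private
      open Tree 1 G
      open Cycle

      m : ℕ
      m = ∣E G ∣

      starts-at : V → V × V → Bool
      starts-at u (x , _) = ⌊ u Fin.≟ x ⌋

      degree : V → ℕ
      degree u = length (filterᵇ (starts-at u) (arcs G))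

      headDegree : List V → ℕ
      headDegree []      = 0
      headDegree (u ∷ _) = degree u

      outgoing : List V → List (V × V)
      outgoing []      = []
      outgoing (u ∷ _) = filterᵇ (starts-at u) (arcs G)

      bridge : List V → V → Bool
      bridge p a = bridges (map (adj G a) p)

      closers : List V → List V
      closers p = filterᵇ (bridge p) (allFin n)

      closerDegree : List V → ℕ
      closerDegree p = ∑ (closers p) degree

      pushHead : V × V → List V → List V
      pushHead (_ , y) p = y ∷ p

      -- A second way to complete a path of four vertices: a random neighbour of
      -- the last vertex, then a common neighbour with probability proportional to
      -- its degree.
      tree₁ tree₂ : List (List V)
      tree₁ = extend pushHead outgoing (tree 2)
      tree₂ = extend _∷_ closers tree₁

      weight₁ weight₂ : List V → ℕ
      weight₁ []      = 0
      weight₁ (_ ∷ p) = recip (headDegree p) * weight 2 p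
      weight₂ []      = 0
      weight₂ (a ∷ p) = degree a * recip (closerDegree p) * weight₁ p

      ∑weight₂≤ : ∑ tree₂ weight₂ ≤ Q * (Q * Q ^ 2)
      ∑weight₂≤ = ≤-trans
        (∑-extend _∷_ closers weight₁ (λ p a → degree a * recip (closerDegree p)) weight₂ Q (λ _ _ → refl) κ≤ tree₁)
        (*-monoʳ-≤ Q (≤-trans
          (∑-extend pushHead outgoing (weight 2) (λ p _ → recip (headDegree p)) weight₁ Q (λ _ _ → refl) κ₁≤ (tree 2))
          (*-monoʳ-≤ Q (∑weight≤ 2))))
        where
        κ≤ : ∀ p → ∑ (closers p) (λ a → degree a * recip (closerDegree p)) ≤ Q
        κ≤ p = ≤-trans (≤-reflexive (trans (∑-cong (closers p) λ {a} _ → *-comm (degree a) (recip (closerDegree p)))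
          (trans (∑-*ˡ (closers p) (recip (closerDegree p)) degree) (*-comm (recip (closerDegree p)) (closerDegree p))))) (recip-≤ (closerDegree p))
        κ₁≤ : ∀ p → ∑ (outgoing p) (λ _ → recip (headDegree p)) ≤ Q
        κ₁≤ []      = z≤n
        κ₁≤ (u ∷ p) = ≤-trans (≤-reflexive (∑-const (outgoing (u ∷ p)) (recip (degree u)))) (recip-≤ (degree u))

      -- Double counting: the degrees of the closing vertices add up to the number of arcs that
      -- start at one of them.
      closerDegree≤ : ∀ p → closerDegree p ≤ ∑ (edges G) (λ (x , y) → 𝟙 (bridge p x) + 𝟙 (bridge p y))
      closerDegree≤ p = begin
        ∑ (closers p) degree                                                              ≡⟨ ∑-filterᵇ (bridge p) (allFin n) degree ⟩
        ∑ (allFin n) (λ a → 𝟙 (bridge p a) * degree a)                                    ≡⟨ ∑-cong (allFin n) (λ {a} _ → trans (cong (𝟙 (bridge p a) *_) (length-filterᵇ (starts-at a) (arcs G))) (sym (∑-*ˡ (arcs G) (𝟙 (bridge p a)) (𝟙 ∘ starts-at a)))) ⟩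
        ∑ (allFin n) (λ a → ∑ (arcs G) (λ w → 𝟙 (bridge p a) * 𝟙 (starts-at a w)))     ≡⟨ ∑-swap (allFin n) (arcs G) (λ a w → 𝟙 (bridge p a) * 𝟙 (starts-at a w)) ⟩
        ∑ (arcs G) (λ w → ∑ (allFin n) (λ a → 𝟙 (bridge p a) * 𝟙 (starts-at a w)))     ≤⟨ ∑-mono (arcs G) (λ {(x , y)} _ → ∑-point (λ a → ⌊ a Fin.≟ x ⌋) (𝟙 ∘ bridge p) (allFin n) x (Unique.allFin⁺ n) (from-≟ x)) ⟩
        ∑ (arcs G) (λ (x , _) → 𝟙 (bridge p x))                                           ≡⟨ ∑-arcs G (λ (x , _) → 𝟙 (bridge p x)) ⟩
        ∑ (edges G) (λ (x , y) → 𝟙 (bridge p x) + 𝟙 (bridge p y))                         ∎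
        where
        open ≤-Reasoning
        from-≟ : ∀ x {a} → ⌊ a Fin.≟ x ⌋ ≡ true → a ≡ x
        from-≟ x {a} e with a Fin.≟ x
        ... | yes a≡x = a≡x

      module _ (z : Cycle 1 G) where

        private
          v : ℕ → V
          v = vertex z

        starts-at-refl : ∀ u w → starts-at u (u , w) ≡ true
        starts-at-refl u w with u Fin.≟ u
        ... | yes _  = refl
        ... | no u≢u = contradiction refl u≢u

        next-out : ∀ t → (v t , v (suc t)) ∈ filterᵇ (starts-at (v t)) (arcs G)
        next-out t = ∈-filterᵇ⁺ (starts-at (v t)) (∈-arcs G (trans (adj-sym G _ _) (consecutive z t))) (starts-at-refl (v t) (v (suc t)))

        path₄ : List V
        path₄ = v 4 ∷ path v 2

        v₅-closes : v 5 ∈ closers path₄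
        v₅-closes = ∈-filterᵇ⁺ (bridge path₄) (∈-allFin (v 5)) ok
          where
          ok : bridge path₄ (v 5) ≡ true
          ok rewrite consecutive z 4 | far z 5 3 ≤-refl (s≤s (s≤s (s≤s (s≤s (s≤s (s≤s (s≤s z≤n)))))))
                   | far z 5 2 (s≤s (s≤s (s≤s (s≤s z≤n)))) (s≤s (s≤s (s≤s (s≤s (s≤s (s≤s (s≤s z≤n)))))))
                   | far z 5 1 (s≤s (s≤s (s≤s z≤n))) ≤-refl
                   = trans (adj-sym G _ _) (subst (λ w → adj G w (v 5) ≡ true) (periodic z 0) (consecutive z 5))

        path∈tree₂ : path v 3 ∈ tree₂
        path∈tree₂ = ∈-extend _∷_ closers (∈-extend pushHead outgoing (path∈tree z 2 (n≤1+n 2)) (next-out 3)) v₅-closes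

        degree-recip : ∀ t → degree (v t) * recip (degree (v t)) ≡ Q
        degree-recip t = recip-≡ _ (∈⇒0<length (next-out t)) (length-filterᵇ-≤ (starts-at (v t)) (arcs G))

        -- `v 5` closes the path and has an outgoing arc, so the total degree is positive. Each edge
        -- enters at most twice, so the total is at most 2m, within the range of exact reciprocals.
        closerDegree-recip : closerDegree path₄ * recip (closerDegree path₄) ≡ Q
        closerDegree-recip = recip-≡ _ (≤-trans (∈⇒0<length (next-out 5)) (∑-member degree v₅-closes)) (≤-trans (closerDegree≤ path₄) (begin
          ∑ (edges G) (λ (x , y) → 𝟙 (bridge path₄ x) + 𝟙 (bridge path₄ y))  ≤⟨ ∑-mono (edges G) (λ {(x , y)} _ → +-mono-≤ (𝟙≤1 (bridge path₄ x)) (𝟙≤1 (bridge path₄ y))) ⟩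
          ∑ (edges G) (λ _ → 2)                                               ≡⟨ trans (∑-const (edges G) 2) (*-comm m 2) ⟩
          2 * m                                                               ≡⟨ length-arcs G ⟨
          length (arcs G)                                                     ∎))
          where open ≤-Reasoning

        burden : ℕ
        burden = choices z 1 + choices z 2 + closerDegree path₄

        burden≤ : burden ≤ ∑ (edges G) (λ (x , y) → roles (adj G x ∘ v) (adj G y ∘ v))
        burden≤ = begin
          choices z 1 + choices z 2 + closerDegree path₄
            ≤⟨ +-mono-≤ (≤-reflexive (cong₂ _+_ (choices-extend z 0 z<s) (choices-close z))) (closerDegree≤ path₄) ⟩
          ∑ (edges G) (λ (x , y) → extensions (adj G x ∘ v) (adj G y ∘ v) 0) + ∑ (edges G) (λ (x , y) → closures (adj G x ∘ v) (adj G y ∘ v) 1)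
            + ∑ (edges G) (λ (x , y) → 𝟙 (bridge path₄ x) + 𝟙 (bridge path₄ y))
            ≡⟨ cong (_+ ∑ (edges G) (λ (x , y) → 𝟙 (bridge path₄ x) + 𝟙 (bridge path₄ y)))
                 (∑-+ (edges G) (λ (x , y) → extensions (adj G x ∘ v) (adj G y ∘ v) 0) (λ (x , y) → closures (adj G x ∘ v) (adj G y ∘ v) 1)) ⟨
          ∑ (edges G) (λ (x , y) → extensions (adj G x ∘ v) (adj G y ∘ v) 0 + closures (adj G x ∘ v) (adj G y ∘ v) 1)
            + ∑ (edges G) (λ (x , y) → 𝟙 (bridge path₄ x) + 𝟙 (bridge path₄ y))
            ≡⟨ ∑-+ (edges G) (λ (x , y) → extensions (adj G x ∘ v) (adj G y ∘ v) 0 + closures (adj G x ∘ v) (adj G y ∘ v) 1) (λ (x , y) → 𝟙 (bridge path₄ x) + 𝟙 (bridge path₄ y)) ⟨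
          ∑ (edges G) (λ (x , y) → roles (adj G x ∘ v) (adj G y ∘ v)) ∎
          where open ≤-Reasoning

      burdens≤ : ∀ z → ∑< 6 (λ s → burden (rotate 1 s z)) ≤ m * 4
      burdens≤ z = begin
        ∑< 6 (λ s → burden (rotate 1 s z))                               ≤⟨ ∑<-mono 6 (λ s _ → burden≤ (rotate 1 s z)) ⟩
        ∑< 6 (λ s → ∑ (edges G) (λ (x , y) → roles (λ t → adj G x (vertex z (s + t))) (λ t → adj G y (vertex z (s + t)))))
          ≡⟨ ∑<-∑-swap 6 (edges G) (λ s (x , y) → roles (λ t → adj G x (vertex z (s + t))) (λ t → adj G y (vertex z (s + t)))) ⟩
        ∑ (edges G) (λ (x , y) → turns (adj G x ∘ vertex z) (adj G y ∘ vertex z))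
          ≤⟨ ∑-mono (edges G) (λ {(x , y)} _ → turns≤4 _ _ (λ t → cong (adj G x) (periodic z t)) (λ t → cong (adj G y) (periodic z t))) ⟩
        ∑ (edges G) (λ _ → 4)                                            ≡⟨ ∑-const (edges G) 4 ⟩
        m * 4                                                            ∎
        where open ≤-Reasoning

      M N : ℕ
      M = m * m * m
      N = length (arcs G)

      -- The first process makes three random choices and the second one four, so their weights are
      -- scaled by Q³ and Q⁴. The factor `Q` in `F₁` makes up the difference.
      F₁ F₂ : List V → ℕ
      F₁ p = Q * (M * (N * weight 3 p))
      F₂ p = M * (N * weight₂ p)

      -- The constant 18 enters as a variable, so that the identities below stay polynomial in it
      -- instead of computing with a numeral.
      module _ (e : ℕ) (3*6≡e : 3 * 6 ≡ e) where

        module Mean (z : Cycle 1 G) where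

          y : ℕ → Cycle 1 G
          y s = rotate 1 s z

          open HexagonMean e 3*6≡e m Q (λ eq → ≢-nonZero⁻¹ Q {{N !≢0}} eq)
            (λ s → choices (y s) 1) (λ s → choices (y s) 2) (λ s → closerDegree (path₄ (y s))) (λ s → degree (vertex z s))
            (λ s → recip (choices (y s) 1)) (λ s → recip (choices (y s) 2)) (λ s → recip (closerDegree (path₄ (y s)))) (λ s → recip (degree (vertex z s)))
            (λ s → choices-recip (y s) 1 (s<s z<s)) (λ s → choices-recip (y s) 2 (s<s (s<s z<s))) (λ s → closerDegree-recip (y s)) (degree-recip z)
            (λ s → cong degree (periodic z s)) public

          weights : ∀ s → F₁ (path (vertex (y s)) 3) + F₂ (path (vertex (y s)) 3) ≡ Q * (t₁ s + t₂ s)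
          weights s = begin
            Q * (M * (N * weight 3 (path (vertex (y s)) 3))) + M * (N * (degree (vertex (y s) 5) * recip W * (recip (degree (vertex (y s) 3)) * weight 2 (path (vertex (y s)) 2))))
              ≡⟨ cong₂ (λ a b → Q * (M * a) + M * b) (weight-path (y s) 2 ≤-refl)
                   (trans (reorder N (degree (vertex (y s) 5)) (recip W) (recip (degree (vertex (y s) 3))) (weight 2 (path (vertex (y s)) 2)))
                     (cong₂ _*_ (weight-path (y s) 1 (s<s z<s)) (cong₂ (λ a b → degree (vertex z a) * recip W * recip (degree (vertex z b))) (+-comm s 5) (+-comm s 3)))) ⟩
            Q * (M * (Q * (w₃ * (w₂ * 1)))) + M * (Q * (w₂ * 1) * (degree (vertex z (5 + s)) * recip W * recip (degree (vertex z (3 + s)))))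
              ≡⟨ regroup Q M w₂ w₃ (recip W) (degree (vertex z (5 + s))) (recip (degree (vertex z (3 + s)))) ⟩
            Q * (t₁ s + t₂ s) ∎
            where
            open ≡-Reasoning
            W w₂ w₃ : ℕ
            W  = closerDegree (path₄ (y s))
            w₂ = recip (choices (y s) 1)
            w₃ = recip (choices (y s) 2)
            reorder : ∀ n d w c x → n * (d * w * (c * x)) ≡ n * x * (d * w * c)
            reorder = solve-∀
            regroup : ∀ q m w₂ w₃ w d c → q * (m * (q * (w₃ * (w₂ * 1)))) + m * (q * (w₂ * 1) * (d * w * c)) ≡ q * (m * (q * w₂ * w₃) + m * (w₂ * w * (d * c)))
            regroup = solve-∀

          -- The mean has 36 entries of size `g`; the linear terms cost 6 times the bound 4 m on the
          -- burdens, that is 24 of them, so 12 are left for the weights.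
          enough : Q * (12 * (e * m * (Q * Q * Q))) ≤ ∑< 6 (λ s → F₁ (path (vertex (y s)) 3) + F₂ (path (vertex (y s)) 3))
          enough = begin
            Q * (12 * (e * m * (Q * Q * Q)))          ≤⟨ *-monoʳ-≤ Q (+-cancelʳ-≤ (6 * e * (Q * Q * Q) * (m * 4)) _ _ (begin
               12 * (e * m * (Q * Q * Q)) + 6 * e * (Q * Q * Q) * (m * 4)   ≡⟨ combine e m (Q * Q * Q) ⟩
               36 * (e * m * (Q * Q * Q))                                   ≤⟨ mean ⟩
               ∑< 6 (λ s → t₁ s + t₂ s) + 6 * e * (Q * Q * Q) * ∑< 6 (λ s → burden (y s))  ≤⟨ +-monoʳ-≤ (∑< 6 (λ s → t₁ s + t₂ s)) (*-monoʳ-≤ (6 * e * (Q * Q * Q)) (burdens≤ z)) ⟩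
               ∑< 6 (λ s → t₁ s + t₂ s) + 6 * e * (Q * Q * Q) * (m * 4)     ∎)) ⟩
            Q * ∑< 6 (λ s → t₁ s + t₂ s)              ≡⟨ ∑<-*ˡ 6 Q (λ s → t₁ s + t₂ s) ⟨
            ∑< 6 (λ s → Q * (t₁ s + t₂ s))            ≡⟨ ∑<-cong 6 (λ s _ → sym (weights s)) ⟩
            _                                         ∎
            where
            open ≤-Reasoning
            combine : ∀ e m q → 12 * (e * m * q) + 6 * e * q * (m * 4) ≡ 36 * (e * m * q)
            combine = solve-∀

        -- The lower bound concerns only `F₁ + F₂` on the common set of walks, whereas the upper
        -- bounds come from each summand's own tree.
        hexagons≤ : 0 < m → e * 6 * c G (C 6) ≤ m ^ 3
        hexagons≤ 0<m = *-cancelʳ-≤ _ _ (4 * m * (Q * Q * Q * Q)) {{4mQ⁴≢0}} (begin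
          e * 6 * c G (C 6) * (4 * m * (Q * Q * Q * Q))            ≡⟨ regroup e m Q (c G (C 6)) ⟩
          c G (C 6) * (2 * (Q * (12 * (e * m * (Q * Q * Q)))))     ≤⟨ walks-bound 1 G (λ p → F₁ p + F₂ p) _ (λ z → Mean.enough z) ⟩
          ∑ (walks 1 G) (λ p → F₁ p + F₂ p)                        ≡⟨ ∑-+ (walks 1 G) F₁ F₂ ⟩
          ∑ (walks 1 G) F₁ + ∑ (walks 1 G) F₂                      ≤⟨ +-mono-≤ (walks-⊆ 1 G (tree 3) F₁ (λ z → path∈tree z 3 ≤-refl)) (walks-⊆ 1 G tree₂ F₂ path∈tree₂) ⟩
          ∑ (tree 3) F₁ + ∑ tree₂ F₂
            ≡⟨ cong₂ _+_ (trans (∑-*ˡ (tree 3) Q (λ p → M * (N * weight 3 p))) (cong (Q *_) (trans (∑-*ˡ (tree 3) M (λ p → N * weight 3 p)) (cong (M *_) (∑-*ˡ (tree 3) N (weight 3))))))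
                         (trans (∑-*ˡ tree₂ M (λ p → N * weight₂ p)) (cong (M *_) (∑-*ˡ tree₂ N weight₂))) ⟩
          Q * (M * (N * ∑ (tree 3) (weight 3))) + M * (N * ∑ tree₂ weight₂)
            ≤⟨ +-mono-≤ (*-monoʳ-≤ Q (*-monoʳ-≤ M (*-monoʳ-≤ N (∑weight≤ 3)))) (*-monoʳ-≤ M (*-monoʳ-≤ N ∑weight₂≤)) ⟩
          Q * (M * (N * Q ^ 3)) + M * (N * (Q * (Q * Q ^ 2)))      ≡⟨ cong (λ x → Q * (M * (x * Q ^ 3)) + M * (x * (Q * (Q * Q ^ 2)))) (length-arcs G) ⟩
          Q * (M * (2 * m * Q ^ 3)) + M * (2 * m * (Q * (Q * Q ^ 2)))  ≡⟨ collect m Q ⟩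
          m ^ 3 * (4 * m * (Q * Q * Q * Q))                        ∎)
          where
          open ≤-Reasoning
          instance
            Q≢0 : NonZero Q
            Q≢0 = N !≢0
            m≢0 : NonZero m
            m≢0 = >-nonZero 0<m
          4mQ⁴≢0 : NonZero (4 * m * (Q * Q * Q * Q))
          4mQ⁴≢0 = m*n≢0 (4 * m) (Q * Q * Q * Q) {{m*n≢0 4 m}} {{m*n≢0 (Q * Q * Q) Q {{m*n≢0 (Q * Q) Q {{m*n≢0 Q Q}}}}}}
          regroup : ∀ e m q c → e * 6 * c * (4 * m * (q * q * q * q)) ≡ c * (2 * (q * (12 * (e * m * (q * q * q)))))
          regroup = solve-∀
          collect : ∀ m q → q * (m * m * m * (2 * m * (q * (q * (q * 1))))) + m * m * m * (2 * m * (q * (q * (q * (q * 1))))) ≡ m * (m * (m * 1)) * (4 * m * (q * q * q * q))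
          collect = solve-∀

    6-cycles≤ : 0 < ∣E G ∣ → 108 * c G (C 6) ≤ ∣E G ∣ ^ 3
    6-cycles≤ = hexagons≤ 18 refl

module Hosts where

  open Sums
  open UpperBounds using (∑-tabulate; ∑-cartesianProduct; ∧-true)
  open import Defs hiding (_^_)
  open import Data.Bool using (Bool; true; false; _∧_; _∨_; if_then_else_; T; _xor_)
  import Data.Bool.Properties as Bool
  open import Data.Fin as Fin using (Fin; zero; suc; toℕ; combine; remQuot; finToFun; funToFin)
  import Data.Fin.Properties as Fin
  open import Data.Fin.Subset using (Subset; outside) renaming (_∈_ to _∈ˢ_)
  open import Data.List using (List; []; _∷_; map; length; filter; allFin; cartesianProduct; filterᵇ)
  import Data.List.Properties as List
  open import Data.List.Membership.Propositional using (_∈_)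
  open import Data.List.Membership.Propositional.Properties using (∈-filter⁺; ∈-filter⁻; ∈-map⁺; ∈-map⁻; ∈-allFin; ∈-cartesianProduct⁺; ∈-cartesianProduct⁻)
  open import Data.List.Relation.Unary.All as All using (All; []; _∷_)
  open import Data.List.Relation.Unary.AllPairs using ([]; _∷_)
  open import Data.List.Relation.Unary.Any using (here; there)
  open import Data.List.Relation.Unary.Unique.Propositional using (Unique)
  import Data.List.Relation.Unary.Unique.Propositional.Properties as Unique
  open import Data.Nat
  open import Data.Nat.DivMod
  open import Data.Nat.Properties
  open import Data.Nat.Tactic.RingSolver using (solve-∀)
  open import Data.Product using (_×_; _,_; proj₁; proj₂; ∃-syntax; swap)
  open import Data.Sum using (_⊎_; inj₁; inj₂)
  open import Data.Unit using (tt)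
  open import Data.Vec using (tabulate; here; there; _∷_)
  import Data.Vec.Properties as Vec
  open import Function using (_∘_; id; Inverse; mk↔ₛ′)
  open import Relation.Binary.PropositionalEquality hiding ([_])
  open import Relation.Nullary using (Dec; yes; no; does; contradiction)
  open import Relation.Nullary.Decidable using (dec-true; toWitness)

  open MaximumExists using (length-≤; ∈-subsets; subsets-unique; ∈-edges⁺; ∈-edges⁻; edges-unique; adj⇒≢)

  -- Exhibiting copies, adding edges, bounding edges

  does-true : ∀ {P : Set} (P? : Dec P) → does P? ≡ true → P
  does-true (yes p) _ = p

  module _ {n h} (G : Graph (Fin n)) (H : Graph (Fin h)) where

    record Spans (g : Fin h → Fin n) (S : Subset n) : Set where
      field
        injective : ∀ {i j} → g i ≡ g j → i ≡ j
        preserves : ∀ i j → adj H i j ≡ adj G (g i) (g j)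
        sound     : ∀ i → g i ∈ˢ S
        complete  : ∀ {v} → v ∈ˢ S → ∃[ i ] g i ≡ v

    open Spans

    spans⇒≅ : ∀ {g S} → Spans g S → G [ S ] ≅ H
    spans⇒≅ {g} {S} s =
      mk↔ₛ′ (λ (v , v∈) → proj₁ (complete s v∈)) (λ i → g i , sound s i)
        (λ i → injective s (proj₂ (complete s (sound s i)))) (λ (v , v∈) → Σ-≡ (proj₂ (complete s v∈))) ,
      λ (u , u∈) (v , v∈) → sym (trans (preserves s _ _) (cong₂ (adj G) (proj₂ (complete s u∈)) (proj₂ (complete s v∈))))

    ≅⇒spans : ∀ {S} → G [ S ] ≅ H → ∃[ g ] Spans g S
    ≅⇒spans {S} (f , p) = proj₁ ∘ from , record
      { injective = λ {i} {j} e → trans (sym (strictlyInverseˡ i)) (trans (cong to (Σ-≡ e)) (strictlyInverseˡ j))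
      ; preserves = λ i j → trans (sym (cong₂ (adj H) (strictlyInverseˡ i) (strictlyInverseˡ j))) (sym (p (from i) (from j)))
      ; sound     = proj₂ ∘ from
      ; complete  = λ {v} v∈ → to (v , v∈) , cong proj₁ (strictlyInverseʳ (v , v∈))
      }
      where open Inverse f

    copy-∈ : ∀ {g S} → Spans g S → S ∈ filter (λ S → induced≅? G S H) (subsets n)
    copy-∈ s = ∈-filter⁺ (λ S → induced≅? G S H) (∈-subsets _) (spans⇒≅ s)

    image : (Fin h → Fin n) → Subset n
    image g = tabulate (λ v → does (Fin.any? (λ i → g i Fin.≟ v)))

    ∈-image⁺ : ∀ g i → g i ∈ˢ image g
    ∈-image⁺ g i = Vec.lookup⇒[]= (g i) _ (trans (Vec.lookup∘tabulate _ (g i)) (dec-true (Fin.any? (λ j → g j Fin.≟ g i)) (i , refl)))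

    ∈-image⁻ : ∀ g {v} → v ∈ˢ image g → ∃[ i ] g i ≡ v
    ∈-image⁻ g {v} v∈ = does-true (Fin.any? (λ i → g i Fin.≟ v))
      (trans (sym (Vec.lookup∘tabulate _ v)) (Vec.[]=⇒lookup v∈))

    -- Each parametrisation is replaced by its image. The last hypothesis lets containment of images
    -- identify the indices, so different indices yield different copies.
    copies≥ : ∀ {X : Set} (xs : List X) → Unique xs → (g : X → Fin h → Fin n) →
      (∀ {x} → x ∈ xs → ∀ {i j} → g x i ≡ g x j → i ≡ j) →
      (∀ {x} → x ∈ xs → ∀ i j → adj H i j ≡ adj G (g x i) (g x j)) →
      (∀ {x y} → x ∈ xs → y ∈ xs → (∀ i → ∃[ j ] g y j ≡ g x i) → x ≡ y) →
      length xs ≤ c G H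
    copies≥ {X} xs unique g inj pres separated = length-≤ R xs _ unique
      (λ {x} x∈ → image (g x) , copy-∈ {g x} (record { injective = inj x∈ ; preserves = pres x∈ ; sound = ∈-image⁺ (g x) ; complete = ∈-image⁻ (g x) }) , x∈ , refl)
      (λ { {x} {y} (x∈ , refl) (y∈ , e) → separated x∈ y∈ (λ i → ∈-image⁻ (g y) (subst (g x i ∈ˢ_) (sym e) (∈-image⁺ (g x) i))) })
      where
      R : X → Subset n → Set
      R x S = x ∈ xs × image (g x) ≡ S

  module _ {n} (G : Graph (Fin n)) where

    addEdge : Graph (Fin (2 + n))
    addEdge = record { adj = a ; adj-sym = a-sym ; adj-irrefl = a-irrefl }
      where
      a : Fin (2 + n) → Fin (2 + n) → Bool
      a zero          (suc zero)    = true
      a (suc zero)    zero          = true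
      a (suc (suc u)) (suc (suc v)) = adj G u v
      a _             _             = false
      a-sym : ∀ u v → a u v ≡ a v u
      a-sym zero          zero          = refl
      a-sym zero          (suc zero)    = refl
      a-sym zero          (suc (suc _)) = refl
      a-sym (suc zero)    zero          = refl
      a-sym (suc zero)    (suc zero)    = refl
      a-sym (suc zero)    (suc (suc _)) = refl
      a-sym (suc (suc _)) zero          = refl
      a-sym (suc (suc _)) (suc zero)    = refl
      a-sym (suc (suc u)) (suc (suc v)) = adj-sym G u v
      a-irrefl : ∀ v → a v v ≡ false
      a-irrefl zero          = refl
      a-irrefl (suc zero)    = refl
      a-irrefl (suc (suc v)) = adj-irrefl G v

    private
      shift : Fin n × Fin n → Fin (2 + n) × Fin (2 + n)
      shift (u , v) = suc (suc u) , suc (suc v)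

      shift-injective : ∀ {x y} → shift x ≡ shift y → x ≡ y
      shift-injective refl = refl

      edges⁺ : List (Fin (2 + n) × Fin (2 + n))
      edges⁺ = (zero , suc zero) ∷ map shift (edges G)

      new : ∀ {e} → e ∈ edges addEdge → e ∈ edges⁺
      new {u , v} e∈ with u<v , a ← ∈-edges⁻ addEdge e∈ = go u v u<v a
        where
        go : ∀ u v → u Fin.< v → adj addEdge u v ≡ true → (u , v) ∈ edges⁺
        go zero          (suc zero)    _ _ = here refl
        go (suc (suc u)) (suc (suc v)) (s≤s (s≤s u<v)) a = there (∈-map⁺ shift (∈-edges⁺ G u<v a))
        go zero          zero          () _
        go zero          (suc (suc _)) _ ()
        go (suc zero)    zero          () _
        go (suc zero)    (suc zero)    (s≤s ()) _
        go (suc zero)    (suc (suc _)) _ ()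
        go (suc (suc _)) zero          () _
        go (suc (suc _)) (suc zero)    (s≤s ()) _

      old : ∀ {e} → e ∈ edges⁺ → e ∈ edges addEdge
      old (here refl) = ∈-edges⁺ addEdge z<s refl
      old (there e∈) with (u , v) , e∈ , refl ← ∈-map⁻ shift e∈ with u<v , a ← ∈-edges⁻ G e∈ =
        ∈-edges⁺ addEdge (s≤s (s≤s u<v)) a

      edges⁺-unique : Unique edges⁺
      edges⁺-unique = All.tabulate fresh ∷ Unique.map⁺ shift-injective (edges-unique G)
        where
        fresh : ∀ {e} → e ∈ map shift (edges G) → (zero , suc zero) ≢ e
        fresh e∈ refl with _ , _ , () ← ∈-map⁻ shift e∈

    addEdge-edges : ∣E addEdge ∣ ≡ suc ∣E G ∣
    addEdge-edges = trans (≤-antisym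
        (length-≤ _≡_ (edges addEdge) edges⁺ (edges-unique addEdge) (λ e∈ → _ , new e∈ , refl) (λ { refl refl → refl }))
        (length-≤ _≡_ edges⁺ (edges addEdge) edges⁺-unique (λ e∈ → _ , old e∈ , refl) (λ { refl refl → refl })))
      (cong suc (List.length-map shift (edges G)))

    addEdge-copies : ∀ {h} (H : Graph (Fin h)) → c G H ≤ c addEdge H
    addEdge-copies H = length-≤ (λ S S′ → outside ∷ outside ∷ S ≡ S′) _ _ (Unique.filter⁺ _ (subsets-unique n))
      (λ S∈ → _ , found S∈ , refl) (λ { refl e → sym (Vec.∷-injectiveʳ (Vec.∷-injectiveʳ e)) })
      where
      found : ∀ {S} → S ∈ filter (λ S → induced≅? G S H) (subsets n) → outside ∷ outside ∷ S ∈ filter (λ S → induced≅? addEdge S H) (subsets (2 + n))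
      found {S} S∈ with g , s ← ≅⇒spans G H (proj₂ (∈-filter⁻ (λ S → induced≅? G S H) {xs = subsets n} S∈)) =
        copy-∈ addEdge H {g = λ i → suc (suc (g i))} (record
          { injective = Spans.injective s ∘ Fin.suc-injective ∘ Fin.suc-injective
          ; preserves = Spans.preserves s
          ; sound     = λ i → there (there (Spans.sound s i))
          ; complete  = complete
          })
        where
        complete : ∀ {v} → v ∈ˢ outside ∷ outside ∷ S → ∃[ i ] suc (suc (g i)) ≡ v
        complete {zero}        ()
        complete {suc zero}    (there ())
        complete {suc (suc v)} (there (there v∈)) = let (i , e) = Spans.complete s v∈ in i , cong (λ u → suc (suc u)) e

  copies≤ρ : ∀ k → 3 ≤ k → ∀ {m n} (G : Graph (Fin n)) → ∣E G ∣ ≤ m → c G (C k) ≤ ρ (C k) m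
  copies≤ρ k 3≤k {m} G ≤m with d , eq ← m≤n⇒∃[o]m+o≡n ≤m = go d G eq
    where
    go : ∀ d {n} (G : Graph (Fin n)) → ∣E G ∣ + d ≡ m → c G (C k) ≤ ρ (C k) m
    go zero    G eq = proj₂ (ρ-C-isMaximum k 3≤k m) _ G (trans (sym (+-identityʳ _)) eq)
    go (suc d) G eq = ≤-trans (addEdge-copies G (C k)) (go d (addEdge G) (trans (cong (_+ d) (addEdge-edges G)) (trans (sym (+-suc _ d)) eq)))

  -- The cover may list an edge in either orientation; since `edges` keeps only `u < v`, no entry of
  -- `ws` can account for two edges.
  edges≤ : ∀ {n} (G : Graph (Fin n)) {W : Set} (ws : List W) (α β : W → Fin n) →
    (∀ u v → adj G u v ≡ true → ∃[ w ] w ∈ ws × ((u , v) ≡ (α w , β w) ⊎ (v , u) ≡ (α w , β w))) →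
    ∣E G ∣ ≤ length ws
  edges≤ {n} G {W} ws α β cover = length-≤ R (edges G) ws (edges-unique G)
    (λ {(u , v)} e∈ → let (u<v , a) = ∈-edges⁻ G e∈ ; (w , w∈ , e) = cover u v a in w , w∈ , u<v , e) inj
    where
    R : Fin n × Fin n → W → Set
    R (u , v) w = u Fin.< v × ((u , v) ≡ (α w , β w) ⊎ (v , u) ≡ (α w , β w))
    inj : ∀ {e e′ w} → R e w → R e′ w → e ≡ e′
    inj (_ , inj₁ e)   (_ , inj₁ e′) = trans e (sym e′)
    inj (_ , inj₂ e)   (_ , inj₂ e′) = cong swap (trans e (sym e′))
    inj (p , inj₁ e)   (q , inj₂ e′) with refl ← trans e (sym e′) = contradiction q (Fin.<-asym p)
    inj (p , inj₂ e)   (q , inj₁ e′) with refl ← trans e (sym e′) = contradiction q (Fin.<-asym p)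

  C-adj⁻ : ∀ k (i j : Fin k) → adj (C k) i j ≡ true → ∣ toℕ i - toℕ j ∣ ≡ 1 ⊎ suc ∣ toℕ i - toℕ j ∣ ≡ k
  C-adj⁻ k i j a with ∣ toℕ i - toℕ j ∣
  ... | suc zero    = inj₁ refl
  ... | suc (suc d) = inj₂ (≡ᵇ⇒≡ _ k (subst T (sym a) tt))

  length-cartesianProduct : ∀ {A B : Set} (xs : List A) (ys : List B) → length (cartesianProduct xs ys) ≡ length xs * length ys
  length-cartesianProduct []       ys = refl
  length-cartesianProduct (x ∷ xs) ys = trans (List.length-++ (map (x ,_) ys)) (cong₂ _+_ (List.length-map (x ,_) ys) (length-cartesianProduct xs ys))

  funToFin-cong : ∀ {m n} {f g : Fin m → Fin n} → (∀ i → f i ≡ g i) → funToFin f ≡ funToFin g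
  funToFin-cong {zero}  h = refl
  funToFin-cong {suc m} h = cong₂ combine (h zero) (funToFin-cong (h ∘ suc))

  -- Blow-ups of even cycles

  module Blowup (l′ q′ : ℕ) where

    private
      l k q : ℕ
      l = suc l′
      k = l * 2
      q = suc q′

    bit : Fin 2 → Bool
    bit zero    = false
    bit (suc _) = true

    isOdd : Fin k → Bool
    isOdd p = bit (proj₂ (remQuot {l} 2 p))

    isZero : Fin q → Bool
    isZero zero    = true
    isZero (suc _) = false

    position : Fin (k * q) → Fin k
    position v = proj₁ (remQuot {k} q v)

    -- Only copy 0 of an even position is used; the other copies are isolated.
    active : Fin (k * q) → Bool
    active v = isOdd (position v) ∨ isZero (proj₂ (remQuot {k} q v))

    blowup : Graph (Fin (k * q))
    blowup = record
      { adj        = λ u v → adj (C k) (position u) (position v) ∧ (active u ∧ active v)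
      ; adj-sym    = λ u v → cong₂ _∧_ (adj-sym (C k) (position u) (position v)) (Bool.∧-comm (active u) (active v))
      ; adj-irrefl = λ v → cong (_∧ (active v ∧ active v)) (adj-irrefl (C k) (position v))
      }

    private
      isOdd-odd : ∀ x → isOdd (combine x (suc zero)) ≡ true
      isOdd-odd x = cong (bit ∘ proj₂) (Fin.remQuot-combine {l} {2} x (suc zero))

      isOdd-even : ∀ x → isOdd (combine x zero) ≡ false
      isOdd-even x = cong (bit ∘ proj₂) (Fin.remQuot-combine {l} {2} x zero)

      copyIndex : (Fin l → Fin q) → Fin k → Fin q
      copyIndex f p = if isOdd p then f (proj₁ (remQuot {l} 2 p)) else zero

      section : (Fin l → Fin q) → Fin k → Fin (k * q)
      section f p = combine p (copyIndex f p)

      position-section : ∀ f p → position (section f p) ≡ p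
      position-section f p = cong proj₁ (Fin.remQuot-combine {k} {q} p (copyIndex f p))

      active-section : ∀ f p → active (section f p) ≡ true
      active-section f p = trans (cong (λ (p , j) → isOdd p ∨ isZero j) (Fin.remQuot-combine {k} {q} p (copyIndex f p))) (ok (isOdd p))
        where
        ok : ∀ b → b ∨ isZero (if b then f (proj₁ (remQuot {l} 2 p)) else zero) ≡ true
        ok true  = refl
        ok false = refl

      section-odd : ∀ f x → section f (combine x (suc zero)) ≡ combine {k} {q} (combine x (suc zero)) (f x)
      section-odd f x = cong (combine {k} {q} (combine x (suc zero))) eq
        where
        eq : copyIndex f (combine x (suc zero)) ≡ f x
        eq = cong₂ (λ b y → if b then f y else zero) (isOdd-odd x) (cong proj₁ (Fin.remQuot-combine {l} {2} x (suc zero)))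

      -- A transversal has one vertex at each position, so an inclusion of images must match
      -- positions; the copy used at the odd positions then reveals `f`.
      separated : ∀ f f′ → (∀ p → ∃[ p′ ] section f′ p′ ≡ section f p) → ∀ x → f x ≡ f′ x
      separated f f′ h x with p′ , e ← h (combine x (suc zero)) =
        sym (proj₂ (Fin.combine-injective p (f′ x) p (f x) (trans (sym (section-odd f′ x)) (trans (cong (section f′) (sym same)) (trans e (section-odd f x))))))
        where
        p : Fin k
        p = combine x (suc zero)
        same : p′ ≡ p
        same = trans (sym (position-section f′ p′)) (trans (cong position e) (position-section f p))

    -- Every choice of one copy at each odd position spans an induced cycle, and `finToFun`
    -- enumerates these choices.
    blowup-copies : q ^ l ≤ c blowup (C k)
    blowup-copies = ≤-trans (≤-reflexive (sym (List.length-tabulate {n = q ^ l} id)))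
      (copies≥ blowup (C k) (allFin (q ^ l)) (Unique.allFin⁺ (q ^ l)) (λ i → section (finToFun i))
        (λ {i} _ {p} {p′} e → trans (sym (position-section (finToFun i) p)) (trans (cong position e) (position-section (finToFun i) p′)))
        (λ {i} _ p p′ → sym (trans (cong₂ _∧_ (cong₂ (adj (C k)) (position-section (finToFun i) p) (position-section (finToFun i) p′)) (cong₂ _∧_ (active-section (finToFun i) p) (active-section (finToFun i) p′))) (Bool.∧-identityʳ _)))
        (λ {i} {i′} _ _ h → trans (sym (Fin.funToFin-finToFin {l} {q} i)) (trans (funToFin-cong (separated (finToFun i) (finToFun i′) h)) (Fin.funToFin-finToFin {l} {q} i′))))

    private
      next : Fin l → Fin l
      next x = suc (toℕ x) mod l

      -- Positions of equal parity differ by an even number, while adjacency needs a difference of 1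
      -- or `k - 1`, both odd.
      even-even : ∀ (x y : Fin l) (b : Fin 2) → adj (C k) (combine x b) (combine y b) ≡ false
      even-even x y b with adj (C k) (combine x b) (combine y b) in e
      ... | false = refl
      ... | true  = contradiction (C-adj⁻ k (combine x b) (combine y b) e) λ { (inj₁ p) → even≢odd ∣ toℕ x - toℕ y ∣ 0 (trans (sym gap) p)
                                                   ; (inj₂ p) → even≢odd l ∣ toℕ x - toℕ y ∣ (trans (*-comm 2 l) (trans (sym p) (cong suc gap))) }
        where
        gap : ∣ toℕ (combine x b) - toℕ (combine y b) ∣ ≡ 2 * ∣ toℕ x - toℕ y ∣
        gap rewrite Fin.toℕ-combine x b | Fin.toℕ-combine y b =
          trans (cong₂ ∣_-_∣ (+-comm (2 * toℕ x) (toℕ b)) (+-comm (2 * toℕ y) (toℕ b)))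
            (trans (∣m+n-m+o∣≡∣n-o∣ (toℕ b) _ _) (sym (*-distribˡ-∣-∣ 2 (toℕ x) (toℕ y))))

      -- Position 2x + 1 has only the neighbours 2x and 2x + 2 modulo k. The latter wraps to 0 when
      -- x is the last index, which is the second case of `below`.
      odd-even : ∀ x y → adj (C k) (combine x (suc zero)) (combine y zero) ≡ true → y ≢ x → y ≡ next x
      odd-even x y a y≢x = split (≤-<-connex Y X)
        where
        X Y : ℕ
        X = toℕ x
        Y = toℕ y
        diff : ∀ {d} → ∣ suc (2 * X) - 2 * Y ∣ ≡ suc (2 * d) → d ≡ 0 ⊎ suc d ≡ l
        diff {d} e with C-adj⁻ k (combine x (suc zero)) (combine y zero) a
        ... | inj₁ p = inj₁ (m+n≡0⇒m≡0 d (suc-injective (trans (sym (trans gap e)) p)))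
          where
          gap : ∣ toℕ (combine x (suc {n = 1} zero)) - toℕ (combine y (zero {n = 1})) ∣ ≡ ∣ suc (2 * X) - 2 * Y ∣
          gap = cong₂ ∣_-_∣ (trans (Fin.toℕ-combine x (suc {n = 1} zero)) (+-comm (2 * X) 1)) (trans (Fin.toℕ-combine y (zero {n = 1})) (+-identityʳ (2 * Y)))
        ... | inj₂ p = inj₂ (*-cancelˡ-≡ (suc d) l 2 (trans (*-suc 2 d) (trans (cong suc (sym (trans gap e))) (trans p (*-comm l 2)))))
          where
          gap : ∣ toℕ (combine x (suc {n = 1} zero)) - toℕ (combine y (zero {n = 1})) ∣ ≡ ∣ suc (2 * X) - 2 * Y ∣
          gap = cong₂ ∣_-_∣ (trans (Fin.toℕ-combine x (suc {n = 1} zero)) (+-comm (2 * X) 1)) (trans (Fin.toℕ-combine y (zero {n = 1})) (+-identityʳ (2 * Y)))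
        toℕ-next : toℕ (next x) ≡ suc X % l
        toℕ-next = Fin.toℕ-fromℕ< (m%n<n (suc X) l)
        below : ∀ d → Y + d ≡ X → y ≡ next x
        below d e with diff {d} (trans (cong (λ z → ∣ suc (2 * z) - 2 * Y ∣) (sym e)) (trans (cong (λ z → ∣ z - 2 * Y ∣) (shuffle Y d)) (∣m-m+n∣≡n′ (2 * Y) (suc (2 * d)))))
          where
          shuffle : ∀ y d → suc (2 * (y + d)) ≡ 2 * y + suc (2 * d)
          shuffle = solve-∀
          ∣m-m+n∣≡n′ : ∀ m n → ∣ m + n - m ∣ ≡ n
          ∣m-m+n∣≡n′ m n = trans (∣-∣-comm (m + n) m) (∣m-m+n∣≡n m n)
        ... | inj₁ refl = contradiction (Fin.toℕ-injective (trans (sym (+-identityʳ Y)) e)) y≢x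
        ... | inj₂ p = Fin.toℕ-injective (trans Y≡0 (sym (trans toℕ-next (trans (cong (_% l) X+1≡l) (n%n≡0 l)))))
          where
          Y≡0 : Y ≡ 0
          Y≡0 = n<1⇒n≡0 (+-cancelʳ-< d Y 1 (subst (_< suc d) (sym e) (subst (X <_) (sym p) (Fin.toℕ<n x))))
          X+1≡l : suc X ≡ l
          X+1≡l = trans (cong suc (trans (sym e) (cong (_+ d) Y≡0))) p
        above : ∀ d → suc X + d ≡ Y → y ≡ next x
        above d e with diff {d} (trans (cong (λ z → ∣ suc (2 * X) - 2 * z ∣) (sym e)) (trans (cong (∣ suc (2 * X) -_∣) (shuffle X d)) (∣m-m+n∣≡n (suc (2 * X)) (suc (2 * d)))))
          where
          shuffle : ∀ x d → 2 * (suc x + d) ≡ suc (2 * x) + suc (2 * d)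
          shuffle = solve-∀
        ... | inj₁ refl = Fin.toℕ-injective (trans Y≡ (sym (trans toℕ-next (m<n⇒m%n≡m (subst (_< l) Y≡ (Fin.toℕ<n y))))))
          where
          Y≡ : Y ≡ suc X
          Y≡ = trans (sym e) (+-identityʳ (suc X))
        ... | inj₂ p = contradiction (subst (l ≤_) (trans (+-suc X d) e) (subst (_≤ X + suc d) p (m≤n+m (suc d) X))) (<⇒≱ (Fin.toℕ<n y))
        split : Y ≤ X ⊎ X < Y → y ≡ next x
        split (inj₁ Y≤X) with d , e ← m≤n⇒∃[o]m+o≡n Y≤X = below d e
        split (inj₂ X<Y) with d , e ← m≤n⇒∃[o]m+o≡n X<Y = above d e

      -- One slot per possible edge: copy `j` of the odd position 2x + 1 is a leaf, and the Boolean
      -- selects the hub before or after it.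
      Slot : Set
      Slot = Fin l × Bool × Fin q

      slots : List Slot
      slots = cartesianProduct (allFin l) (cartesianProduct (true ∷ false ∷ []) (allFin q))

      spot : Fin l → Fin 2 → Fin q → Fin (k * q)
      spot x b j = combine (combine x b) j

      leaf hub : Slot → Fin (k * q)
      leaf (x , _ , j) = spot x (suc zero) j
      hub  (x , b , _) = spot (if b then x else next x) zero zero

      slot-∈ : ∀ w → w ∈ slots
      slot-∈ (x , b , j) = ∈-cartesianProduct⁺ (∈-allFin x) (∈-cartesianProduct⁺ (bool b) (∈-allFin j))
        where
        bool : ∀ b → b ∈ true ∷ false ∷ []
        bool true  = here refl
        bool false = there (here refl)

      length-slots : length slots ≡ k * q
      length-slots = trans (length-cartesianProduct (allFin l) (cartesianProduct (true ∷ false ∷ []) (allFin q)))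
        (trans (cong₂ _*_ (List.length-tabulate {n = l} id) (trans (length-cartesianProduct (true ∷ false ∷ []) (allFin q)) (cong (2 *_) (List.length-tabulate {n = q} id))))
          (sym (*-assoc l 2 q)))

      vertex-view : ∀ v → ∃[ x ] ∃[ b ] ∃[ j ] v ≡ spot x b j
      vertex-view v with p , j , refl ← Fin.combine-surjective {k} {q} v with x , b , refl ← Fin.combine-surjective {l} {2} p = x , b , j , refl

      adj-position : ∀ p p′ j j′ → adj blowup (combine p j) (combine p′ j′) ≡ true → adj (C k) p p′ ≡ true × (isOdd p ∨ isZero j ≡ true × isOdd p′ ∨ isZero j′ ≡ true)
      adj-position p p′ j j′ a
        with a₁ , a′ ← ∧-true (adj (C k) p p′) (trans (sym (cong₂ (λ (p , j) (p′ , j′) → adj (C k) p p′ ∧ ((isOdd p ∨ isZero j) ∧ (isOdd p′ ∨ isZero j′)))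
          (Fin.remQuot-combine {k} {q} p j) (Fin.remQuot-combine {k} {q} p′ j′))) a) = a₁ , ∧-true (isOdd p ∨ isZero j) a′

      isZero-true : ∀ {j} → isZero j ≡ true → j ≡ zero
      isZero-true {zero} _ = refl

      spoke : ∀ x y j j′ → adj (C k) (combine x (suc zero)) (combine y zero) ≡ true → isOdd (combine y zero) ∨ isZero j′ ≡ true →
        ∃[ w ] w ∈ slots × (spot x (suc zero) j , spot y zero j′) ≡ (leaf w , hub w)
      spoke x y j j′ a act with refl ← isZero-true {j′} (subst (λ b → b ∨ isZero j′ ≡ true) (isOdd-even y) act) with y Fin.≟ x
      ... | yes refl = (x , true , j) , slot-∈ _ , refl
      ... | no y≢x with refl ← odd-even x y a y≢x = (x , false , j) , slot-∈ _ , refl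

    blowup-edges : ∣E blowup ∣ ≤ k * q
    blowup-edges = ≤-trans (edges≤ blowup slots leaf hub cover) (≤-reflexive length-slots)
      where
      cover : ∀ u v → adj blowup u v ≡ true → ∃[ w ] w ∈ slots × ((u , v) ≡ (leaf w , hub w) ⊎ (v , u) ≡ (leaf w , hub w))
      cover u v a with x , b , j , refl ← vertex-view u | y , b′ , j′ , refl ← vertex-view v
        with aC , act , act′ ← adj-position (combine x b) (combine y b′) j j′ a = go b b′ aC act act′
        where
        go : ∀ b b′ → adj (C k) (combine x b) (combine y b′) ≡ true → isOdd (combine x b) ∨ isZero j ≡ true → isOdd (combine y b′) ∨ isZero j′ ≡ true →
          ∃[ w ] w ∈ slots × ((spot x b j , spot y b′ j′) ≡ (leaf w , hub w) ⊎ (spot y b′ j′ , spot x b j) ≡ (leaf w , hub w))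
        go zero       zero       aC _ _ = contradiction (trans (sym aC) (even-even x y zero)) λ ()
        go (suc zero) (suc zero) aC _ _ = contradiction (trans (sym aC) (even-even x y (suc zero))) λ ()
        go (suc zero) zero       aC _ act′ = let (w , w∈ , e) = spoke x y j j′ aC act′ in w , w∈ , inj₁ e
        go zero       (suc zero) aC act _  = let (w , w∈ , e) = spoke y x j′ j (trans (adj-sym (C k) (combine y (suc zero)) (combine x zero)) aC) act in w , w∈ , inj₂ e

  -- Complete bipartite hosts

  module Bipartite (a : ℕ) where

    bit : Fin 2 → Bool
    bit zero    = false
    bit (suc _) = true

    side : Fin (2 * a) → Bool
    side v = bit (proj₁ (remQuot {2} a v))

    bipartite : Graph (Fin (2 * a))
    bipartite = record
      { adj        = λ u v → side u xor side v
      ; adj-sym    = λ u v → Bool.xor-comm (side u) (side v)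
      ; adj-irrefl = λ v → Bool.xor-same (side v)
      }

    private
      vertex : Fin 2 → Fin a → Fin (2 * a)
      vertex = combine

      side-vertex : ∀ b i → side (vertex b i) ≡ bit b
      side-vertex b i = cong (bit ∘ proj₁) (Fin.remQuot-combine {2} {a} b i)

    bipartite-edges : ∣E bipartite ∣ ≤ a * a
    bipartite-edges = ≤-trans (edges≤ bipartite (cartesianProduct (allFin a) (allFin a)) (vertex zero ∘ proj₁) (vertex (suc zero) ∘ proj₂) cover)
      (≤-reflexive (trans (length-cartesianProduct (allFin a) (allFin a)) (cong₂ _*_ (List.length-tabulate {n = a} id) (List.length-tabulate {n = a} id))))
      where
      cover : ∀ u v → adj bipartite u v ≡ true → ∃[ w ] w ∈ cartesianProduct (allFin a) (allFin a) ×
        ((u , v) ≡ (vertex zero (proj₁ w) , vertex (suc zero) (proj₂ w)) ⊎ (v , u) ≡ (vertex zero (proj₁ w) , vertex (suc zero) (proj₂ w)))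
      cover u v e with b , i , refl ← Fin.combine-surjective {2} {a} u | b′ , j , refl ← Fin.combine-surjective {2} {a} v =
        go b b′ (trans (sym (cong₂ _xor_ (side-vertex b i) (side-vertex b′ j))) e)
        where
        go : ∀ b b′ → bit b xor bit b′ ≡ true → ∃[ w ] w ∈ cartesianProduct (allFin a) (allFin a) ×
          ((vertex b i , vertex b′ j) ≡ (vertex zero (proj₁ w) , vertex (suc zero) (proj₂ w)) ⊎ (vertex b′ j , vertex b i) ≡ (vertex zero (proj₁ w) , vertex (suc zero) (proj₂ w)))
        go zero       (suc zero) _ = (i , j) , ∈-cartesianProduct⁺ (∈-allFin i) (∈-allFin j) , inj₁ refl
        go (suc zero) zero       _ = (j , i) , ∈-cartesianProduct⁺ (∈-allFin j) (∈-allFin i) , inj₂ refl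

    private
      -- Ascending pairs represent the two-element subsets of one side, each exactly once.
      ascending : Fin a × Fin a → Bool
      ascending (i , j) = toℕ i <ᵇ toℕ j

      pairs : List (Fin a × Fin a)
      pairs = filterᵇ ascending (cartesianProduct (allFin a) (allFin a))

      ∈-pairs : ∀ {i j} → (i , j) ∈ pairs → toℕ i < toℕ j
      ∈-pairs {i} {j} p = <ᵇ⇒< (toℕ i) (toℕ j) (proj₂ (∈-filter⁻ (Bool.T? ∘ ascending) {xs = cartesianProduct (allFin a) (allFin a)} p))

      -- The binomial coefficient n choose 2, in the shape of the count that `length-pairs`
      -- produces.
      triangle : ℕ → ℕ
      triangle n = ∑< n (λ i → ∑< n (λ j → 𝟙 (i <ᵇ j)))

      triangle-≡ : ∀ n → 2 * triangle n + n ≡ n * n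
      triangle-≡ zero    = refl
      triangle-≡ (suc n) = trans (cong (λ x → 2 * (x + triangle n) + suc n) (trans (∑<-const n 1) (*-identityʳ n)))
        (trans (regroup n (triangle n)) (trans (cong (suc (2 * n) +_) (triangle-≡ n)) (square n)))
        where
        regroup : ∀ n t → 2 * (n + t) + suc n ≡ suc (2 * n) + (2 * t + n)
        regroup = solve-∀
        square : ∀ n → suc (2 * n) + n * n ≡ suc n * suc n
        square = solve-∀

      length-pairs : length pairs ≡ triangle a
      length-pairs = begin
        length pairs                                                           ≡⟨ length-filterᵇ ascending (cartesianProduct (allFin a) (allFin a)) ⟩
        ∑ (cartesianProduct (allFin a) (allFin a)) (𝟙 ∘ ascending)             ≡⟨ ∑-cartesianProduct (allFin a) (allFin a) (𝟙 ∘ ascending) ⟩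
        ∑ (allFin a) (λ i → ∑ (allFin a) (λ j → 𝟙 (toℕ i <ᵇ toℕ j)))          ≡⟨ ∑-cong (allFin a) (λ {i} _ → ∑-tabulate a id (λ j → 𝟙 (toℕ i <ᵇ toℕ j)) (λ j → 𝟙 (toℕ i <ᵇ j)) (λ _ → refl)) ⟩
        ∑ (allFin a) (λ i → ∑< a (λ j → 𝟙 (toℕ i <ᵇ j)))                       ≡⟨ ∑-tabulate a id (λ i → ∑< a (λ j → 𝟙 (toℕ i <ᵇ j))) (λ i → ∑< a (λ j → 𝟙 (i <ᵇ j))) (λ _ → refl) ⟩
        triangle a                                                             ∎
        where open ≡-Reasoning

      Pairs : Set
      Pairs = (Fin a × Fin a) × (Fin a × Fin a)

      square : Pairs → Fin 4 → Fin (2 * a)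
      square ((i , _) , _) zero                   = vertex zero i
      square (_ , (j , _)) (suc zero)             = vertex (suc zero) j
      square ((_ , i) , _) (suc (suc zero))       = vertex zero i
      square (_ , (_ , j)) (suc (suc (suc zero))) = vertex (suc zero) j

      alternating : Fin 4 → Bool
      alternating zero                   = false
      alternating (suc zero)             = true
      alternating (suc (suc zero))       = false
      alternating (suc (suc (suc zero))) = true

      side-square : ∀ x t → side (square x t) ≡ alternating t
      side-square ((i , _) , _) zero                   = side-vertex zero i
      side-square (_ , (j , _)) (suc zero)             = side-vertex (suc zero) j
      side-square ((_ , i) , _) (suc (suc zero))       = side-vertex zero i
      side-square (_ , (_ , j)) (suc (suc (suc zero))) = side-vertex (suc zero) j

      -- The four-cycle is the complete bipartite graph on 2 + 2 vertices, so any two vertices from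
      -- each side induce a copy; sixteen cases are evaluated.
      C₄-alternating : ∀ s t → adj (C 4) s t ≡ alternating s xor alternating t
      C₄-alternating = toWitness {a? = Fin.all? λ s → Fin.all? λ t → adj (C 4) s t Bool.≟ (alternating s xor alternating t)} tt

      index-≡ : ∀ b {i j} → vertex b i ≡ vertex b j → i ≡ j
      index-≡ b {i} {j} e = proj₂ (Fin.combine-injective b i b j e)

      square-injective : ∀ {i i′ j j′} → toℕ i < toℕ i′ → toℕ j < toℕ j′ → ∀ s t → square ((i , i′) , (j , j′)) s ≡ square ((i , i′) , (j , j′)) t → s ≡ t
      square-injective {i} {i′} {j} {j′} i< j< s t e = go s t (trans (sym (side-square x s)) (trans (cong side e) (side-square x t))) e
        where
        x : Pairs
        x = (i , i′) , (j , j′)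
        go : ∀ s t → alternating s ≡ alternating t → square x s ≡ square x t → s ≡ t
        go zero                   zero                   _ _ = refl
        go (suc zero)             (suc zero)             _ _ = refl
        go (suc (suc zero))       (suc (suc zero))       _ _ = refl
        go (suc (suc (suc zero))) (suc (suc (suc zero))) _ _ = refl
        go zero                   (suc (suc zero))       _ e = contradiction (cong toℕ (index-≡ zero e)) (<⇒≢ i<)
        go (suc (suc zero))       zero                   _ e = contradiction (cong toℕ (sym (index-≡ zero e))) (<⇒≢ i<)
        go (suc zero)             (suc (suc (suc zero))) _ e = contradiction (cong toℕ (index-≡ (suc zero) e)) (<⇒≢ j<)
        go (suc (suc (suc zero))) (suc zero)             _ e = contradiction (cong toℕ (sym (index-≡ (suc zero) e))) (<⇒≢ j<)

        go zero (suc zero) () _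
        go zero (suc (suc (suc zero))) () _
        go (suc zero) zero () _
        go (suc zero) (suc (suc zero)) () _
        go (suc (suc zero)) (suc zero) () _
        go (suc (suc zero)) (suc (suc (suc zero))) () _
        go (suc (suc (suc zero))) zero () _
        go (suc (suc (suc zero))) (suc (suc zero)) () _

      ordered : ∀ {i i′ u u′ : Fin a} → toℕ i < toℕ i′ → toℕ u < toℕ u′ → i ≡ u ⊎ i ≡ u′ → i′ ≡ u ⊎ i′ ≡ u′ → (i , i′) ≡ (u , u′)
      ordered i< u< (inj₁ refl) (inj₁ refl) = contradiction refl (<⇒≢ i<)
      ordered i< u< (inj₁ refl) (inj₂ refl) = refl
      ordered i< u< (inj₂ refl) (inj₁ refl) = contradiction u< (<-asym i<)
      ordered i< u< (inj₂ refl) (inj₂ refl) = contradiction refl (<⇒≢ i<)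

      even-vertex : ∀ u u′ w w′ i s → square ((u , u′) , (w , w′)) s ≡ vertex zero i → i ≡ u ⊎ i ≡ u′
      even-vertex _ _ _ _ i zero             e = inj₁ (sym (index-≡ zero e))
      even-vertex _ _ _ _ i (suc (suc zero)) e = inj₂ (sym (index-≡ zero e))
      even-vertex _ _ w _ i (suc zero)             e = contradiction (trans (sym (side-vertex (suc zero) w)) (trans (cong side e) (side-vertex zero i))) λ ()
      even-vertex _ _ _ w′ i (suc (suc (suc zero))) e = contradiction (trans (sym (side-vertex (suc zero) w′)) (trans (cong side e) (side-vertex zero i))) λ ()

      odd-vertex : ∀ u u′ w w′ j s → square ((u , u′) , (w , w′)) s ≡ vertex (suc zero) j → j ≡ w ⊎ j ≡ w′
      odd-vertex _ _ _ _ j (suc zero)             e = inj₁ (sym (index-≡ (suc zero) e))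
      odd-vertex _ _ _ _ j (suc (suc (suc zero))) e = inj₂ (sym (index-≡ (suc zero) e))
      odd-vertex u _ _ _ j zero             e = contradiction (trans (sym (side-vertex zero u)) (trans (cong side e) (side-vertex (suc zero) j))) λ ()
      odd-vertex _ u′ _ _ j (suc (suc zero)) e = contradiction (trans (sym (side-vertex zero u′)) (trans (cong side e) (side-vertex (suc zero) j))) λ ()

      squares≤ : triangle a * triangle a ≤ c bipartite (C 4)
      squares≤ = ≤-trans (≤-reflexive (sym (trans (length-cartesianProduct pairs pairs) (cong₂ _*_ length-pairs length-pairs))))
        (copies≥ bipartite (C 4) (cartesianProduct pairs pairs) (Unique.cartesianProduct⁺ unique unique) square
          (λ {x} x∈ {s} {t} e → let (p , q) = ∈-cartesianProduct⁻ pairs pairs x∈ in square-injective (∈-pairs p) (∈-pairs q) s t e)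
          (λ {x} _ s t → trans (C₄-alternating s t) (sym (cong₂ _xor_ (side-square x s) (side-square x t))))
          separated)
        where
        unique : Unique pairs
        unique = Unique.filter⁺ (Bool.T? ∘ ascending) (Unique.cartesianProduct⁺ (Unique.allFin⁺ a) (Unique.allFin⁺ a))
        separated : ∀ {x y} → x ∈ cartesianProduct pairs pairs → y ∈ cartesianProduct pairs pairs → (∀ t → ∃[ s ] square y s ≡ square x t) → x ≡ y
        separated {(i , i′) , (j , j′)} {(u , u′) , (w , w′)} x∈ y∈ h
          with p , q ← ∈-cartesianProduct⁻ pairs pairs x∈ | p′ , q′ ← ∈-cartesianProduct⁻ pairs pairs y∈ =
          cong₂ _,_ (ordered (∈-pairs p) (∈-pairs p′) (found (even-vertex u u′ w w′ i) (h zero)) (found (even-vertex u u′ w w′ i′) (h (suc (suc zero)))))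
                    (ordered (∈-pairs q) (∈-pairs q′) (found (odd-vertex u u′ w w′ j) (h (suc zero))) (found (odd-vertex u u′ w w′ j′) (h (suc (suc (suc zero))))))
          where
          found : ∀ {P : Fin 4 → Set} {R : Set} → (∀ s → P s → R) → ∃[ s ] P s → R
          found f (s , p) = f s p

    -- (a choose 2)² squares, with the denominators cleared.
    bipartite-copies : ∃[ t ] (2 * t + a ≡ a * a) × (t * t ≤ c bipartite (C 4))
    bipartite-copies = triangle a , triangle-≡ a , squares≤

open Sums using (^-distrib-*)
open UpperBounds using (4-cycles≤; 6-cycles≤; long-even-cycles≤)
open Hosts using (copies≤ρ; module Blowup; module Bipartite)

open import Defs
open import Data.Integer as ℤ using (+_; +[1+_]; -[1+_]; +≤+)
open import Data.Nat as ℕ using (ℕ; zero; suc; _∸_; _!; s≤s; z≤n; z<s)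
import Data.Integer.Properties as ℤ
import Data.Nat.Properties as ℕ
open import Data.Nat.Tactic.RingSolver using (solve-∀)
open import Data.Product using (_×_; _,_; proj₁; proj₂; ∃-syntax)
open import Data.Rational.Unnormalised as ℚᵘ using (ℚᵘ; mkℚᵘ; 0ℚᵘ; 1ℚᵘ; _≃_; _≤_; _+_; _*_; _-_; -_; ∣_∣; *≤*; *≡*; *<*)
import Data.Rational.Unnormalised.Properties as ℚᵘ
import Data.Rational.Unnormalised.Solver as ℚᵘ-Solver
open import Data.Sum using (inj₁; inj₂)
open import Relation.Binary.PropositionalEquality using (_≡_; refl; sym; trans; cong; cong₂; subst; subst₂)
open import Relation.Nullary using (contradiction; yes; no)
open import Data.Nat.DivMod using (_/_; _%_; m/n*n≤m; m≡m%n+[m/n]*n; m%n<n)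
open import Data.Fin using (Fin)

-- Fractions of natural numbers and null sequences

÷-≤ : ∀ a b c d → 0 ℕ.< b → 0 ℕ.< d → a ℕ.* d ℕ.≤ c ℕ.* b → a ÷ b ≤ c ÷ d
÷-≤ a (suc b) c (suc d) _ _ h = *≤* (subst₂ ℤ._≤_ (ℤ.pos-* a (suc d)) (ℤ.pos-* c (suc b)) (+≤+ h))

÷-≃ : ∀ a b c d → 0 ℕ.< b → 0 ℕ.< d → a ℕ.* d ≡ c ℕ.* b → a ÷ b ≃ c ÷ d
÷-≃ a (suc b) c (suc d) _ _ h = *≡* (trans (sym (ℤ.pos-* a (suc d))) (trans (cong +_ h) (ℤ.pos-* c (suc b))))

÷-* : ∀ a b c d → 0 ℕ.< b → 0 ℕ.< d → (a ÷ b) * (c ÷ d) ≃ (a ℕ.* c) ÷ (b ℕ.* d)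
÷-* a (suc b) c (suc d) _ _ = *≡* (cong (ℤ._* (+ (suc b ℕ.* suc d))) (sym (ℤ.pos-* a c)))

÷-+ : ∀ a b c d → 0 ℕ.< b → 0 ℕ.< d → (a ÷ b) + (c ÷ d) ≃ (a ℕ.* d ℕ.+ c ℕ.* b) ÷ (b ℕ.* d)
÷-+ a (suc b) c (suc d) _ _ = *≡* (cong (ℤ._* (+ (suc b ℕ.* suc d)))
  (trans (cong₂ ℤ._+_ (sym (ℤ.pos-* a (suc d))) (sym (ℤ.pos-* c (suc b)))) (sym (ℤ.pos-+ (a ℕ.* suc d) (c ℕ.* suc b)))))

0≤÷ : ∀ a b → 0ℚᵘ ≤ a ÷ b
0≤÷ a zero    = ℚᵘ.≤-refl
0≤÷ a (suc b) = ℚᵘ.nonNegative⁻¹ (mkℚᵘ (+ a) b)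

0<^ : ∀ b n → 0 ℕ.< b → 0 ℕ.< b ℕ.^ n
0<^ (suc b) n _ = ℕ.m^n>0 (suc b) n

0<* : ∀ {a b} → 0 ℕ.< a → 0 ℕ.< b → 0 ℕ.< a ℕ.* b
0<* = ℕ.*-mono-<

÷-^ : ∀ a b n → 0 ℕ.< b → (a ÷ b) ^ n ≃ (a ℕ.^ n) ÷ (b ℕ.^ n)
÷-^ a b zero    0<b = ℚᵘ.≃-refl
÷-^ a b (suc n) 0<b = ℚᵘ.≃-trans (ℚᵘ.*-congˡ {a ÷ b} (÷-^ a b n 0<b)) (÷-* a b _ _ 0<b (0<^ b n 0<b))

^-congˡ : ∀ {p q} n → p ≃ q → p ^ n ≃ q ^ n
^-congˡ zero    e = ℚᵘ.≃-refl
^-congˡ (suc n) e = ℚᵘ.*-cong e (^-congˡ n e)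

1+1÷ : ∀ n → 1ℚᵘ + 1 ÷ suc n ≃ suc (suc n) ÷ suc n
1+1÷ n = ℚᵘ.≃-trans (÷-+ 1 1 1 (suc n) z<s z<s) (÷-≃ _ _ _ _ (0<* {1} {suc n} z<s z<s) z<s (cancel n))
  where
  cancel : ∀ n → (1 ℕ.* suc n ℕ.+ 1 ℕ.* 1) ℕ.* suc n ≡ suc (suc n) ℕ.* (1 ℕ.* suc n)
  cancel = solve-∀

∣∣-≤ : ∀ {p d} → p ≤ d → - p ≤ d → ∣ p ∣ ≤ d
∣∣-≤ {p} p≤d -p≤d with ℚᵘ.∣p∣≡p∨∣p∣≡-p p
... | inj₁ e = ℚᵘ.≤-trans (ℚᵘ.≤-reflexive-≡ e) p≤d
... | inj₂ e = ℚᵘ.≤-trans (ℚᵘ.≤-reflexive-≡ e) -p≤d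

-- The last hypothesis is 1 ≤ K / s + A / B with the denominators cleared.
near-one : ∀ A B K s → 0 ℕ.< B → 0 ℕ.< s → A ℕ.≤ B → B ℕ.* s ℕ.≤ K ℕ.* B ℕ.+ A ℕ.* s → ∣ A ÷ B - 1ℚᵘ ∣ ≤ K ÷ s
near-one A B K s 0<B 0<s A≤B h = ∣∣-≤ upper lower
  where
  upper : A ÷ B - 1ℚᵘ ≤ K ÷ s
  upper = ℚᵘ.≤-trans (ℚᵘ.+-monoˡ-≤ (- 1ℚᵘ) (÷-≤ A B 1 1 0<B z<s (ℕ.≤-trans (ℕ.≤-reflexive (ℕ.*-identityʳ A)) (ℕ.≤-trans A≤B (ℕ.≤-reflexive (sym (ℕ.*-identityˡ B)))))))
    (ℚᵘ.≤-trans (ℚᵘ.≤-reflexive (ℚᵘ.+-inverseʳ 1ℚᵘ)) (0≤÷ K s))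
  swap : ∀ x → - (x - 1ℚᵘ) ≃ 1ℚᵘ - x
  swap = solve 1 (λ x → :- (x :- con 1ℚᵘ) := con 1ℚᵘ :- x) ℚᵘ.≃-refl
    where open ℚᵘ-Solver.+-*-Solver
  cancel : ∀ d x → d + x - x ≃ d
  cancel = solve 2 (λ d x → d :+ x :- x := d) ℚᵘ.≃-refl
    where open ℚᵘ-Solver.+-*-Solver
  one≤ : 1ℚᵘ ≤ K ÷ s + A ÷ B
  one≤ = ℚᵘ.≤-trans (÷-≤ 1 1 _ (s ℕ.* B) z<s (0<* 0<s 0<B) (ℕ.≤-trans (ℕ.≤-reflexive (flip s B)) (ℕ.≤-trans h (ℕ.≤-reflexive (sym (ℕ.*-identityʳ _))))))
    (ℚᵘ.≤-reflexive (ℚᵘ.≃-sym (÷-+ K s A B 0<s 0<B)))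
    where
    flip : ∀ s B → 1 ℕ.* (s ℕ.* B) ≡ B ℕ.* s
    flip = solve-∀
  lower : - (A ÷ B - 1ℚᵘ) ≤ K ÷ s
  lower = ℚᵘ.≤-trans (ℚᵘ.≤-reflexive (swap (A ÷ B))) (ℚᵘ.≤-trans (ℚᵘ.+-monoˡ-≤ (- (A ÷ B)) one≤) (ℚᵘ.≤-reflexive (cancel (K ÷ s) (A ÷ B))))

-- The rate is left as an unbounded `s`, because it is `m` for the blow-ups but only the root of `m`
-- for four-cycles.
÷-→0 : ∀ δ K (s : ℕ → ℕ) → (∀ N → ∃[ M ] (∀ m → M ℕ.≤ m → N ℕ.≤ s m)) →
  (∀ m → 0 ℕ.< m → ∣ δ m ∣ ≤ K ÷ s m) → δ →0
÷-→0 δ K s unbounded h (mkℚᵘ (+ 0) _) (*<* (ℤ.+<+ ()))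
÷-→0 δ K s unbounded h (mkℚᵘ -[1+ _ ] _) (*<* ())
÷-→0 δ K s unbounded h (mkℚᵘ +[1+ p ] q) _ with unbounded (suc (K ℕ.* suc q))
... | M , large = suc M , λ m M<m → ℚᵘ.≤-trans (h m (ℕ.≤-trans (s≤s z≤n) M<m))
    (small m (large m (ℕ.<⇒≤ M<m)))
  where
  small : ∀ m → suc (K ℕ.* suc q) ℕ.≤ s m → K ÷ s m ≤ mkℚᵘ +[1+ p ] q
  small m N≤s = ÷-≤ K (s m) (suc p) (suc q) (ℕ.≤-trans (s≤s z≤n) N≤s) z<s
    (ℕ.≤-trans (ℕ.<⇒≤ N≤s) (ℕ.m≤m+n (s m) (p ℕ.* s m)))

-- Comparison of (1 + 1/R)ᴿ with e

module _ (R : ℕ) where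

  -- truncated n j is Rⁿ n! times the Taylor polynomial Σ_{i ≤ n} yⁱ / i! of the
  -- exponential at y = j / R.
  truncated : ℕ → ℕ → ℕ
  truncated zero    j = 1
  truncated (suc n) j = R ℕ.* suc n ℕ.* truncated n j ℕ.+ j ℕ.^ suc n

  private
    -- The two leading terms of the binomial expansion of (j + 1)ⁿ⁺¹.
    ^-suc : ∀ j n → j ℕ.^ suc n ℕ.+ suc n ℕ.* j ℕ.^ n ℕ.≤ suc j ℕ.^ suc n
    ^-suc j zero    = ℕ.≤-reflexive (lemma j)
      where
      lemma : ∀ j → j ℕ.* 1 ℕ.+ 1 ℕ.* 1 ≡ (1 ℕ.+ j) ℕ.* 1
      lemma = solve-∀
    ^-suc j (suc n) = ℕ.≤-trans (ℕ.≤-trans (ℕ.m≤m+n _ (suc n ℕ.* j ℕ.^ n)) (ℕ.≤-reflexive (lemma n j (j ℕ.^ n)))) (ℕ.*-monoʳ-≤ (suc j) (^-suc j n))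
      where
      lemma : ∀ n j p → j ℕ.* (j ℕ.* p) ℕ.+ (2 ℕ.+ n) ℕ.* (j ℕ.* p) ℕ.+ (1 ℕ.+ n) ℕ.* p ≡ (1 ℕ.+ j) ℕ.* (j ℕ.* p ℕ.+ (1 ℕ.+ n) ℕ.* p)
      lemma = solve-∀

    -- The derivative of a Taylor polynomial of the exponential is the preceding one, so after
    -- scaling this is the tangent inequality for an increment of 1 / R.
    truncated-suc : ∀ n j → truncated (suc n) j ℕ.+ suc n ℕ.* truncated n j ℕ.≤ truncated (suc n) (suc j)
    truncated-suc zero    j = ℕ.≤-reflexive (lemma R j)
      where
      lemma : ∀ R j → R ℕ.* 1 ℕ.* 1 ℕ.+ j ℕ.* 1 ℕ.+ 1 ℕ.* 1 ≡ R ℕ.* 1 ℕ.* 1 ℕ.+ (1 ℕ.+ j) ℕ.* 1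
      lemma = solve-∀
    truncated-suc (suc n) j = ℕ.≤-trans (ℕ.≤-reflexive (lemma R n (truncated n j) (j ℕ.^ suc n) (j ℕ.^ suc (suc n))))
      (ℕ.+-mono-≤ (ℕ.*-monoʳ-≤ (R ℕ.* suc (suc n)) (truncated-suc n j)) (^-suc j (suc n)))
      where
      lemma : ∀ R n t p q → R ℕ.* (2 ℕ.+ n) ℕ.* (R ℕ.* (1 ℕ.+ n) ℕ.* t ℕ.+ p) ℕ.+ q ℕ.+ (2 ℕ.+ n) ℕ.* (R ℕ.* (1 ℕ.+ n) ℕ.* t ℕ.+ p)
        ≡ R ℕ.* (2 ℕ.+ n) ℕ.* (R ℕ.* (1 ℕ.+ n) ℕ.* t ℕ.+ p ℕ.+ (1 ℕ.+ n) ℕ.* t) ℕ.+ (q ℕ.+ (2 ℕ.+ n) ℕ.* p)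
      lemma = solve-∀

  -- (1 + 1/R)ʲ ≤ Σ_{i ≤ j} (j/R)ⁱ / i!
  power≤truncated : ∀ j → suc R ℕ.^ j ℕ.* j ! ℕ.≤ truncated j j
  power≤truncated zero    = ℕ.≤-refl
  power≤truncated (suc j) = begin
    suc R ℕ.* suc R ℕ.^ j ℕ.* (suc j ℕ.* j !)                                         ≡⟨ regroup R j (suc R ℕ.^ j) (j !) ⟩
    suc R ℕ.* suc j ℕ.* (suc R ℕ.^ j ℕ.* j !)                                         ≤⟨ ℕ.*-monoʳ-≤ (suc R ℕ.* suc j) (power≤truncated j) ⟩
    suc R ℕ.* suc j ℕ.* truncated j j                                                 ≡⟨ expand R j (truncated j j) ⟩
    R ℕ.* suc j ℕ.* truncated j j ℕ.+ suc j ℕ.* truncated j j                         ≤⟨ ℕ.+-monoˡ-≤ _ (ℕ.m≤m+n (R ℕ.* suc j ℕ.* truncated j j) (j ℕ.^ suc j)) ⟩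
    truncated (suc j) j ℕ.+ suc j ℕ.* truncated j j                                   ≤⟨ truncated-suc j j ⟩
    truncated (suc j) (suc j)                                                         ∎
    where
    open ℕ.≤-Reasoning
    regroup : ∀ R j p f → (1 ℕ.+ R) ℕ.* p ℕ.* ((1 ℕ.+ j) ℕ.* f) ≡ (1 ℕ.+ R) ℕ.* (1 ℕ.+ j) ℕ.* (p ℕ.* f)
    regroup = solve-∀
    expand : ∀ R j t → (1 ℕ.+ R) ℕ.* (1 ℕ.+ j) ℕ.* t ≡ R ℕ.* (1 ℕ.+ j) ℕ.* t ℕ.+ (1 ℕ.+ j) ℕ.* t
    expand = solve-∀

  e-partialSum-truncated : 0 ℕ.< R → ∀ n → e-partialSum n ≃ truncated n R ÷ (R ℕ.^ n ℕ.* n !)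
  e-partialSum-truncated 0<R zero    = ℚᵘ.≃-refl
  e-partialSum-truncated 0<R (suc n) = ℚᵘ.≃-trans (ℚᵘ.+-congˡ (1 ÷ (suc n !)) (e-partialSum-truncated 0<R n))
    (ℚᵘ.≃-trans (÷-+ (truncated n R) (R ℕ.^ n ℕ.* n !) 1 (suc n !) 0<D (ℕ.1≤n! (suc n)))
      (÷-≃ _ _ _ _ (0<* 0<D (ℕ.1≤n! (suc n))) (0<* (0<^ R (suc n) 0<R) (ℕ.1≤n! (suc n))) (cross R n (R ℕ.^ n) (n !) (truncated n R))))
    where
    0<D : 0 ℕ.< R ℕ.^ n ℕ.* n !
    0<D = 0<* (0<^ R n 0<R) (ℕ.1≤n! n)
    cross : ∀ R n p f t → (t ℕ.* ((1 ℕ.+ n) ℕ.* f) ℕ.+ 1 ℕ.* (p ℕ.* f)) ℕ.* (R ℕ.* p ℕ.* ((1 ℕ.+ n) ℕ.* f))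
      ≡ (R ℕ.* (1 ℕ.+ n) ℕ.* t ℕ.+ R ℕ.* p) ℕ.* (p ℕ.* f ℕ.* ((1 ℕ.+ n) ℕ.* f))
    cross = solve-∀

e-partialSum-mono : ∀ {i n} → i ℕ.≤ n → e-partialSum i ≤ e-partialSum n
e-partialSum-mono i≤n = go (ℕ.≤⇒≤′ i≤n)
  where
  go : ∀ {i n} → i ℕ.≤′ n → e-partialSum i ≤ e-partialSum n
  go ℕ.≤′-refl                 = ℚᵘ.≤-refl
  go (ℕ.≤′-step {n = n} i≤n) = ℚᵘ.≤-trans (go i≤n) (ℚᵘ.p≤p+q (e-partialSum n) (1 ÷ (suc n !)) {{ℚᵘ.nonNegative (0≤÷ 1 (suc n !))}})

-- For j = R the argument j / R is 1, and the truncated exponential becomes the partial sum of e.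
compound≤e : ∀ R n → suc R ℕ.≤ n → (1ℚᵘ + 1 ÷ suc R) ^ suc R ≤ e-partialSum n
compound≤e r n R≤n = begin
  (1ℚᵘ + 1 ÷ R) ^ R                       ≃⟨ ^-congˡ R (1+1÷ r) ⟩
  (suc R ÷ R) ^ R                         ≃⟨ ÷-^ (suc R) R R z<s ⟩
  (suc R ℕ.^ R) ÷ (R ℕ.^ R)               ≤⟨ ÷-≤ _ _ _ _ (0<^ R R z<s) (0<* (0<^ R R z<s) (ℕ.1≤n! R)) cross ⟩
  truncated R R R ÷ (R ℕ.^ R ℕ.* R !)     ≃⟨ e-partialSum-truncated R z<s R ⟨
  e-partialSum R                          ≤⟨ e-partialSum-mono R≤n ⟩
  e-partialSum n                          ∎
  where
  open ℚᵘ.≤-Reasoning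
  R : ℕ
  R = suc r
  cross : suc R ℕ.^ R ℕ.* (R ℕ.^ R ℕ.* R !) ℕ.≤ truncated R R R ℕ.* R ℕ.^ R
  cross = ℕ.≤-trans (ℕ.≤-reflexive (regroup (suc R ℕ.^ R) (R ℕ.^ R) (R !))) (ℕ.*-monoˡ-≤ (R ℕ.^ R) (power≤truncated R R))
    where
    regroup : ∀ a b c → a ℕ.* (b ℕ.* c) ≡ a ℕ.* c ℕ.* b
    regroup = solve-∀

≤⇒·e : ∀ x → 0ℚᵘ ≤ x → ∀ r → fromℚᵘ (x * (1ℚᵘ + 1 ÷ suc r) ^ suc r) ≤ᴿ x · e
-- From index `suc r` on every partial sum already dominates, so `ε` is mere slack.
≤⇒·e x 0≤x r ε 0<ε = suc r , λ n r<n → ℚᵘ.≤-trans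
  (ℚᵘ.*-monoʳ-≤-nonNeg x {{ℚᵘ.nonNegative 0≤x}} (compound≤e r n r<n))
  (ℚᵘ.p≤p+q (x * e-partialSum n) ε {{ℚᵘ.nonNegative (ℚᵘ.<⇒≤ 0<ε)}})

-- Bounds for `ρ` and their asymptotic form

ρ≤ : ∀ k → 3 ℕ.≤ k → ∀ m a b → (∀ {n} (G : Graph (Fin n)) → ∣E G ∣ ≡ m → a ℕ.* c G (C k) ℕ.≤ b) → a ℕ.* ρ (C k) m ℕ.≤ b
ρ≤ k 3≤k m a b h with (_ , G , ∣E∣≡m , e) , _ ← ρ-C-isMaximum k 3≤k m = subst (λ x → a ℕ.* x ℕ.≤ b) e (h G ∣E∣≡m)

4ρ≤ : ∀ m → 0 ℕ.< m → 4 ℕ.* ρ (C 4) m ℕ.≤ m ℕ.^ 2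
4ρ≤ m 0<m = ρ≤ 4 (ℕ.n≤1+n 3) m 4 (m ℕ.^ 2) λ { G refl → 4-cycles≤ G 0<m }

108ρ≤ : ∀ m → 0 ℕ.< m → 108 ℕ.* ρ (C 6) m ℕ.≤ m ℕ.^ 3
108ρ≤ m 0<m = ρ≤ 6 (s≤s (s≤s (s≤s z≤n))) m 108 (m ℕ.^ 3) λ { G refl → 6-cycles≤ G 0<m }

ρ-even≤ : ∀ r → 2 ℕ.≤ r → ∀ m → 0 ℕ.< m → 2 ℕ.* (2 ℕ.+ r) ℕ.* (2 ℕ.* suc r) ℕ.^ suc r ℕ.* ρ (C ((2 ℕ.+ r) ℕ.* 2)) m ℕ.≤ m ℕ.^ (2 ℕ.+ r)
ρ-even≤ r 2≤r m 0<m = ρ≤ ((2 ℕ.+ r) ℕ.* 2) (s≤s (s≤s (s≤s z≤n))) m (2 ℕ.* (2 ℕ.+ r) ℕ.* (2 ℕ.* suc r) ℕ.^ suc r) (m ℕ.^ (2 ℕ.+ r)) λ { G refl → long-even-cycles≤ G r 2≤r 0<m }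

ρ-even≥ : ∀ l′ → 3 ℕ.≤ suc l′ ℕ.* 2 → ∀ m → (m / (suc l′ ℕ.* 2)) ℕ.^ suc l′ ℕ.≤ ρ (C (suc l′ ℕ.* 2)) m
ρ-even≥ l′ 3≤k m with m / (suc l′ ℕ.* 2) in e
-- For m < k the blow-up would have no copies of a vertex; the power of 0 has a positive exponent,
-- so the bound is 0.
... | zero   = z≤n
... | suc q′ = ℕ.≤-trans (Blowup.blowup-copies l′ q′) (copies≤ρ (suc l′ ℕ.* 2) 3≤k (Blowup.blowup l′ q′)
  (ℕ.≤-trans (Blowup.blowup-edges l′ q′) (ℕ.≤-trans (ℕ.≤-reflexive (trans (ℕ.*-comm (suc l′ ℕ.* 2) (suc q′)) (cong (ℕ._* (suc l′ ℕ.* 2)) (sym e)))) (m/n*n≤m m (suc l′ ℕ.* 2)))))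

-- The estimate mˡ - xˡ ≤ l d mˡ⁻¹, multiplied by `m` to avoid the exponent l - 1 and rearranged
-- without subtraction.
^-close : ∀ x d m l → x ℕ.≤ m → m ℕ.≤ x ℕ.+ d → m ℕ.^ l ℕ.* m ℕ.≤ l ℕ.* d ℕ.* m ℕ.^ l ℕ.+ x ℕ.^ l ℕ.* m
^-close x d m zero    x≤m m≤x+d = ℕ.≤-refl
^-close x d m (suc l) x≤m m≤x+d = begin
  m ℕ.* m ℕ.^ l ℕ.* m                                                          ≡⟨ regroup₁ m (m ℕ.^ l) ⟩
  m ℕ.* (m ℕ.^ l ℕ.* m)                                                        ≤⟨ ℕ.*-monoʳ-≤ m (^-close x d m l x≤m m≤x+d) ⟩
  m ℕ.* (l ℕ.* d ℕ.* m ℕ.^ l ℕ.+ x ℕ.^ l ℕ.* m)                                ≡⟨ regroup₂ m l d (m ℕ.^ l) (x ℕ.^ l) ⟩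
  l ℕ.* d ℕ.* (m ℕ.* m ℕ.^ l) ℕ.+ x ℕ.^ l ℕ.* m ℕ.* m                          ≤⟨ ℕ.+-monoʳ-≤ (l ℕ.* d ℕ.* (m ℕ.* m ℕ.^ l)) (ℕ.*-monoʳ-≤ (x ℕ.^ l ℕ.* m) m≤x+d) ⟩
  l ℕ.* d ℕ.* (m ℕ.* m ℕ.^ l) ℕ.+ x ℕ.^ l ℕ.* m ℕ.* (x ℕ.+ d)                  ≡⟨ regroup₃ m l d (m ℕ.* m ℕ.^ l) (x ℕ.^ l) x ⟩
  l ℕ.* d ℕ.* (m ℕ.* m ℕ.^ l) ℕ.+ d ℕ.* (m ℕ.* x ℕ.^ l) ℕ.+ x ℕ.* x ℕ.^ l ℕ.* m ≤⟨ ℕ.+-monoˡ-≤ _ (ℕ.+-monoʳ-≤ (l ℕ.* d ℕ.* (m ℕ.* m ℕ.^ l)) (ℕ.*-monoʳ-≤ d (ℕ.*-monoʳ-≤ m (ℕ.^-monoˡ-≤ l x≤m)))) ⟩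
  l ℕ.* d ℕ.* (m ℕ.* m ℕ.^ l) ℕ.+ d ℕ.* (m ℕ.* m ℕ.^ l) ℕ.+ x ℕ.* x ℕ.^ l ℕ.* m ≡⟨ regroup₄ l d (m ℕ.* m ℕ.^ l) (x ℕ.* x ℕ.^ l ℕ.* m) ⟩
  suc l ℕ.* d ℕ.* (m ℕ.* m ℕ.^ l) ℕ.+ x ℕ.* x ℕ.^ l ℕ.* m                      ∎
  where
  open ℕ.≤-Reasoning
  regroup₁ : ∀ m p → m ℕ.* p ℕ.* m ≡ m ℕ.* (p ℕ.* m)
  regroup₁ = solve-∀
  regroup₂ : ∀ m l d p q → m ℕ.* (l ℕ.* d ℕ.* p ℕ.+ q ℕ.* m) ≡ l ℕ.* d ℕ.* (m ℕ.* p) ℕ.+ q ℕ.* m ℕ.* m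
  regroup₂ = solve-∀
  regroup₃ : ∀ m l d p q x → l ℕ.* d ℕ.* p ℕ.+ q ℕ.* m ℕ.* (x ℕ.+ d) ≡ l ℕ.* d ℕ.* p ℕ.+ d ℕ.* (m ℕ.* q) ℕ.+ x ℕ.* q ℕ.* m
  regroup₃ = solve-∀
  regroup₄ : ∀ l d p z → l ℕ.* d ℕ.* p ℕ.+ d ℕ.* p ℕ.+ z ≡ (1 ℕ.+ l) ℕ.* d ℕ.* p ℕ.+ z
  regroup₄ = solve-∀

1+x-1 : ∀ x → 1ℚᵘ + (x - 1ℚᵘ) ≃ x
1+x-1 = solve 1 (λ x → con 1ℚᵘ :+ (x :- con 1ℚᵘ) := x) ℚᵘ.≃-refl
  where open ℚᵘ-Solver.+-*-Solver

even-lower : ∀ l′ → 3 ℕ.≤ suc l′ ℕ.* 2 → let l = suc l′ ; k = l ℕ.* 2 in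
  ∃[ δ ] (δ →0) × (∀ m → 0 ℕ.< m → (1ℚᵘ + δ m) * (m ÷ k) ^ l ≤ ρ (C k) m ÷ 1)
even-lower l′ 3≤k = δ , ÷-→0 δ (l ℕ.* k) (λ m → m) (λ N → N , λ _ N≤m → N≤m) small , bound
  where
  l k : ℕ
  l = suc l′
  k = l ℕ.* 2
  below : ℕ → ℕ
  below m = m / k ℕ.* k
  δ : ℕ → ℚᵘ
  -- The relative loss from rounding m down to a multiple of k; it is of order l k / m.
  δ m = (below m ℕ.^ l) ÷ (m ℕ.^ l) - 1ℚᵘ
  small : ∀ m → 0 ℕ.< m → ℚᵘ.∣ δ m ∣ ≤ (l ℕ.* k) ÷ m
  small m 0<m = near-one (below m ℕ.^ l) (m ℕ.^ l) (l ℕ.* k) m (0<^ m l 0<m) 0<m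
    (ℕ.^-monoˡ-≤ l (m/n*n≤m m k))
    (^-close (below m) k m l (m/n*n≤m m k) (ℕ.≤-trans (ℕ.≤-reflexive (trans (m≡m%n+[m/n]*n m k) (ℕ.+-comm (m % k) (below m)))) (ℕ.+-monoʳ-≤ (below m) (ℕ.<⇒≤ (m%n<n m k)))))
  bound : ∀ m → 0 ℕ.< m → (1ℚᵘ + δ m) * (m ÷ k) ^ l ≤ ρ (C k) m ÷ 1
  bound m 0<m = begin
    (1ℚᵘ + δ m) * (m ÷ k) ^ l                                             ≃⟨ ℚᵘ.*-cong (1+x-1 ((below m ℕ.^ l) ÷ (m ℕ.^ l))) (÷-^ m k l z<s) ⟩
    ((below m ℕ.^ l) ÷ (m ℕ.^ l)) * ((m ℕ.^ l) ÷ (k ℕ.^ l))               ≃⟨ ÷-* _ _ _ _ (0<^ m l 0<m) (0<^ k l z<s) ⟩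
    (below m ℕ.^ l ℕ.* m ℕ.^ l) ÷ (m ℕ.^ l ℕ.* k ℕ.^ l)                   ≤⟨ ÷-≤ _ _ _ _ (0<* (0<^ m l 0<m) (0<^ k l z<s)) z<s cross ⟩
    ρ (C k) m ÷ 1                                                         ∎
    where
    open ℚᵘ.≤-Reasoning
    cross : below m ℕ.^ l ℕ.* m ℕ.^ l ℕ.* 1 ℕ.≤ ρ (C k) m ℕ.* (m ℕ.^ l ℕ.* k ℕ.^ l)
    cross = ℕ.≤-trans (ℕ.≤-reflexive (trans (cong (λ z → z ℕ.* m ℕ.^ l ℕ.* 1) (^-distrib-* (m / k) k l)) (regroup ((m / k) ℕ.^ l) (k ℕ.^ l) (m ℕ.^ l))))
      (ℕ.*-monoˡ-≤ (m ℕ.^ l ℕ.* k ℕ.^ l) (ρ-even≥ l′ 3≤k m))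
      where
      regroup : ∀ a b c → a ℕ.* b ℕ.* c ℕ.* 1 ≡ a ℕ.* (c ℕ.* b)
      regroup = solve-∀

√-floor : ∀ m → ∃[ a ] a ℕ.* a ℕ.≤ m × m ℕ.< suc a ℕ.* suc a
√-floor zero    = 0 , z≤n , s≤s z≤n
√-floor (suc m) with a , a²≤m , m<a⁺² ← √-floor m with suc m ℕ.<? suc a ℕ.* suc a
... | yes small = a , ℕ.m≤n⇒m≤1+n a²≤m , small
... | no large  = suc a , ℕ.≮⇒≥ large , ℕ.≤-<-trans m<a⁺² (ℕ.*-mono-< (ℕ.n<1+n (suc a)) (ℕ.n<1+n (suc a)))

4-cycle-asymptotics : ∃[ δ ] (δ →0) × (∀ m → 0 ℕ.< m → ρ (C 4) m ÷ 1 ≃ (1ℚᵘ + δ m) * ((m ℕ.^ 2) ÷ 4))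
4-cycle-asymptotics = δ , ÷-→0 δ 6 √_ unbounded small , exact
  where
  √_ : ℕ → ℕ
  √ m = proj₁ (√-floor m)
  √-large : ∀ N m → N ℕ.* N ℕ.≤ m → N ℕ.≤ √ m
  √-large N m N²≤m with N ℕ.≤? √ m
  ... | yes N≤√m = N≤√m
  ... | no N≰√m  = contradiction (ℕ.≤-trans (ℕ.*-mono-≤ (ℕ.≰⇒> N≰√m) (ℕ.≰⇒> N≰√m)) N²≤m) (ℕ.<⇒≱ (proj₂ (proj₂ (√-floor m))))
  unbounded : ∀ N → ∃[ M ] (∀ m → M ℕ.≤ m → N ℕ.≤ √ m)
  unbounded N = N ℕ.* N , √-large N
  δ : ℕ → ℚᵘ
  -- Taking the exact relative error makes the asymptotic equation an identity and leaves only its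
  -- convergence to prove.
  δ m = (4 ℕ.* ρ (C 4) m) ÷ (m ℕ.^ 2) - 1ℚᵘ
  small : ∀ m → 0 ℕ.< m → ℚᵘ.∣ δ m ∣ ≤ 6 ÷ √ m
  small m 0<m = near-one (4 ℕ.* ρ (C 4) m) (m ℕ.^ 2) 6 (√ m) (0<^ m 2 0<m) (√-large 1 m 0<m) (4ρ≤ m 0<m) close
    where
    open ℕ.≤-Reasoning
    a t u : ℕ
    a = √ m
    t = proj₁ (Bipartite.bipartite-copies a)
    u = 2 ℕ.* t
    u+a≡a² : u ℕ.+ a ≡ a ℕ.* a
    u+a≡a² = proj₁ (proj₂ (Bipartite.bipartite-copies a))
    a²≤m : a ℕ.* a ℕ.≤ m
    a²≤m = proj₁ (proj₂ (√-floor m))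
    t²≤ρ : t ℕ.* t ℕ.≤ ρ (C 4) m
    t²≤ρ = ℕ.≤-trans (proj₂ (proj₂ (Bipartite.bipartite-copies a))) (copies≤ρ 4 (ℕ.n≤1+n 3) (Bipartite.bipartite a) (ℕ.≤-trans (Bipartite.bipartite-edges a) a²≤m))
    u≤m : u ℕ.≤ m
    u≤m = ℕ.≤-trans (ℕ.m≤m+n u a) (ℕ.≤-trans (ℕ.≤-reflexive u+a≡a²) a²≤m)
    -- From m < (a + 1)² and a² = u + a. The 3a enters twice when m² is compared with u², which
    -- produces the 6 in the rate.
    m≤u+3a : m ℕ.≤ u ℕ.+ 3 ℕ.* a
    m≤u+3a = ℕ.s≤s⁻¹ (ℕ.≤-trans (proj₂ (proj₂ (√-floor m))) (ℕ.≤-reflexive (trans (square a) (trans (cong (λ z → suc (z ℕ.+ 2 ℕ.* a)) (sym u+a≡a²)) (collect u a)))))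
      where
      square : ∀ a → (1 ℕ.+ a) ℕ.* (1 ℕ.+ a) ≡ 1 ℕ.+ (a ℕ.* a ℕ.+ 2 ℕ.* a)
      square = solve-∀
      collect : ∀ u a → 1 ℕ.+ (u ℕ.+ a ℕ.+ 2 ℕ.* a) ≡ 1 ℕ.+ (u ℕ.+ 3 ℕ.* a)
      collect = solve-∀
    m²≤ : m ℕ.* m ℕ.≤ u ℕ.* u ℕ.+ 6 ℕ.* a ℕ.* m
    m²≤ = begin
      m ℕ.* m                                                ≤⟨ ℕ.*-monoˡ-≤ m m≤u+3a ⟩
      (u ℕ.+ 3 ℕ.* a) ℕ.* m                                  ≡⟨ ℕ.*-distribʳ-+ m u (3 ℕ.* a) ⟩
      u ℕ.* m ℕ.+ 3 ℕ.* a ℕ.* m                              ≤⟨ ℕ.+-monoˡ-≤ (3 ℕ.* a ℕ.* m) (ℕ.*-monoʳ-≤ u m≤u+3a) ⟩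
      u ℕ.* (u ℕ.+ 3 ℕ.* a) ℕ.+ 3 ℕ.* a ℕ.* m                ≡⟨ expand u a m ⟩
      u ℕ.* u ℕ.+ (3 ℕ.* a ℕ.* u ℕ.+ 3 ℕ.* a ℕ.* m)          ≤⟨ ℕ.+-monoʳ-≤ (u ℕ.* u) (ℕ.+-monoˡ-≤ (3 ℕ.* a ℕ.* m) (ℕ.*-monoʳ-≤ (3 ℕ.* a) u≤m)) ⟩
      u ℕ.* u ℕ.+ (3 ℕ.* a ℕ.* m ℕ.+ 3 ℕ.* a ℕ.* m)          ≡⟨ collect u a m ⟩
      u ℕ.* u ℕ.+ 6 ℕ.* a ℕ.* m                              ∎
      where
      expand : ∀ u a m → u ℕ.* (u ℕ.+ 3 ℕ.* a) ℕ.+ 3 ℕ.* a ℕ.* m ≡ u ℕ.* u ℕ.+ (3 ℕ.* a ℕ.* u ℕ.+ 3 ℕ.* a ℕ.* m)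
      expand = solve-∀
      collect : ∀ u a m → u ℕ.* u ℕ.+ (3 ℕ.* a ℕ.* m ℕ.+ 3 ℕ.* a ℕ.* m) ≡ u ℕ.* u ℕ.+ 6 ℕ.* a ℕ.* m
      collect = solve-∀
    close : m ℕ.^ 2 ℕ.* a ℕ.≤ 6 ℕ.* m ℕ.^ 2 ℕ.+ 4 ℕ.* ρ (C 4) m ℕ.* a
    close = begin
      m ℕ.^ 2 ℕ.* a                                          ≡⟨ cong (ℕ._* a) (cong (m ℕ.*_) (ℕ.*-identityʳ m)) ⟩
      m ℕ.* m ℕ.* a                                          ≤⟨ ℕ.*-monoˡ-≤ a m²≤ ⟩
      (u ℕ.* u ℕ.+ 6 ℕ.* a ℕ.* m) ℕ.* a                      ≡⟨ regroup t a m ⟩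
      6 ℕ.* (m ℕ.* (a ℕ.* a)) ℕ.+ 4 ℕ.* (t ℕ.* t) ℕ.* a      ≤⟨ ℕ.+-mono-≤ (ℕ.*-monoʳ-≤ 6 (ℕ.*-monoʳ-≤ m (ℕ.≤-trans a²≤m (ℕ.≤-reflexive (sym (ℕ.*-identityʳ m)))))) (ℕ.*-monoˡ-≤ a (ℕ.*-monoʳ-≤ 4 t²≤ρ)) ⟩
      6 ℕ.* m ℕ.^ 2 ℕ.+ 4 ℕ.* ρ (C 4) m ℕ.* a                ∎
      where
      regroup : ∀ t a m → (2 ℕ.* t ℕ.* (2 ℕ.* t) ℕ.+ 6 ℕ.* a ℕ.* m) ℕ.* a ≡ 6 ℕ.* (m ℕ.* (a ℕ.* a)) ℕ.+ 4 ℕ.* (t ℕ.* t) ℕ.* a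
      regroup = solve-∀
  exact : ∀ m → 0 ℕ.< m → ρ (C 4) m ÷ 1 ≃ (1ℚᵘ + δ m) * ((m ℕ.^ 2) ÷ 4)
  exact m 0<m = ℚᵘ.≃-sym (ℚᵘ.≃-trans (ℚᵘ.*-congʳ {(m ℕ.^ 2) ÷ 4} (1+x-1 ((4 ℕ.* ρ (C 4) m) ÷ (m ℕ.^ 2))))
    (ℚᵘ.≃-trans (÷-* _ _ _ 4 (0<^ m 2 0<m) z<s) (÷-≃ _ _ _ 1 (0<* (0<^ m 2 0<m) z<s) z<s (regroup (ρ (C 4) m) (m ℕ.^ 2)))))
    where
    regroup : ∀ r p → 4 ℕ.* r ℕ.* p ℕ.* 1 ≡ r ℕ.* (p ℕ.* 4)
    regroup = solve-∀

6-cycle-upper : ∀ m → 0 ℕ.< m → ρ (C 6) m ÷ 1 ≤ (3 ÷ 1) * (m ÷ 6) ^ 3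
6-cycle-upper m 0<m = begin
  ρ (C 6) m ÷ 1                          ≤⟨ ÷-≤ _ 1 (3 ℕ.* m ℕ.^ 3) (1 ℕ.* 6 ℕ.^ 3) z<s z<s cross ⟩
  (3 ℕ.* m ℕ.^ 3) ÷ (1 ℕ.* 6 ℕ.^ 3)      ≃⟨ ÷-* 3 1 (m ℕ.^ 3) (6 ℕ.^ 3) z<s z<s ⟨
  (3 ÷ 1) * ((m ℕ.^ 3) ÷ (6 ℕ.^ 3))      ≃⟨ ℚᵘ.*-congˡ {3 ÷ 1} (÷-^ m 6 3 z<s) ⟨
  (3 ÷ 1) * (m ÷ 6) ^ 3                  ∎
  where
  open ℚᵘ.≤-Reasoning
  cross : ρ (C 6) m ℕ.* 216 ℕ.≤ 3 ℕ.* m ℕ.^ 3 ℕ.* 1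
  -- Since 6³ = 2 · 108, the bound on hexagons even gives the factor 2, and it is weakened to 3
  -- here.
  cross = ℕ.≤-trans (ℕ.≤-reflexive (trans (ℕ.*-comm (ρ (C 6) m) 216) (ℕ.*-assoc 2 108 (ρ (C 6) m))))
    (ℕ.≤-trans (ℕ.*-monoʳ-≤ 2 (108ρ≤ m 0<m)) (ℕ.≤-trans (ℕ.*-monoˡ-≤ (m ℕ.^ 3) (ℕ.n≤1+n 2)) (ℕ.≤-reflexive (sym (ℕ.*-identityʳ _)))))

even-upper : ∀ r → 2 ℕ.≤ r → ∀ m → 0 ℕ.< m → let l = 2 ℕ.+ r in
  ρ (C (l ℕ.* 2)) m ÷ 1 ≤ (m ÷ (2 ℕ.* l)) ^ l * (1ℚᵘ + 1 ÷ suc r) ^ suc r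
even-upper r 2≤r m 0<m = begin
  ρ (C (l ℕ.* 2)) m ÷ 1                                                ≤⟨ ÷-≤ _ 1 _ _ z<s (0<* 0<D (0<^ R R z<s)) cross ⟩
  (m ℕ.^ l ℕ.* l ℕ.^ R) ÷ ((2 ℕ.* l) ℕ.^ l ℕ.* R ℕ.^ R)                ≃⟨ ÷-* (m ℕ.^ l) _ (l ℕ.^ R) _ 0<D (0<^ R R z<s) ⟨
  ((m ℕ.^ l) ÷ ((2 ℕ.* l) ℕ.^ l)) * ((l ℕ.^ R) ÷ (R ℕ.^ R))            ≃⟨ ℚᵘ.*-cong (÷-^ m (2 ℕ.* l) l z<s) (ℚᵘ.≃-trans (^-congˡ R (1+1÷ r)) (÷-^ l R R z<s)) ⟨
  (m ÷ (2 ℕ.* l)) ^ l * (1ℚᵘ + 1 ÷ R) ^ R                              ∎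
  where
  open ℚᵘ.≤-Reasoning
  l R : ℕ
  l = 2 ℕ.+ r
  R = suc r
  0<D : 0 ℕ.< (2 ℕ.* l) ℕ.^ l
  0<D = 0<^ (2 ℕ.* l) l z<s
  cross : ρ (C (l ℕ.* 2)) m ℕ.* ((2 ℕ.* l) ℕ.^ l ℕ.* R ℕ.^ R) ℕ.≤ m ℕ.^ l ℕ.* l ℕ.^ R ℕ.* 1
  -- With R = l - 1 the identity behind this is (2l)ˡ Rᴿ = 2l (2R)ᴿ lᴿ.
  cross = ℕ.≤-trans (ℕ.≤-reflexive (trans (cong (λ z → ρ (C (l ℕ.* 2)) m ℕ.* (2 ℕ.* l ℕ.* z ℕ.* R ℕ.^ R)) (^-distrib-* 2 l R))
      (trans (regroup (ρ (C (l ℕ.* 2)) m) (2 ℕ.* l) (2 ℕ.^ R) (l ℕ.^ R) (R ℕ.^ R)) (cong (λ z → 2 ℕ.* l ℕ.* z ℕ.* ρ (C (l ℕ.* 2)) m ℕ.* l ℕ.^ R) (sym (^-distrib-* 2 R R))))))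
    (ℕ.≤-trans (ℕ.*-monoˡ-≤ (l ℕ.^ R) (ρ-even≤ r 2≤r m 0<m)) (ℕ.≤-reflexive (sym (ℕ.*-identityʳ _))))
    where
    regroup : ∀ p d t l r → p ℕ.* (d ℕ.* (t ℕ.* l) ℕ.* r) ≡ d ℕ.* (t ℕ.* r) ℕ.* p ℕ.* l
    regroup = solve-∀

0≤^ : ∀ p q n → 0 ℕ.< q → 0ℚᵘ ≤ (p ÷ q) ^ n
0≤^ p q n 0<q = ℚᵘ.≤-trans (0≤÷ (p ℕ.^ n) (q ℕ.^ n)) (ℚᵘ.≤-reflexive (ℚᵘ.≃-sym (÷-^ p q n 0<q)))

theorem1p6 : (∃[ δ ] (δ →0) × (∀ m → 0 ℕ.< m → ρ (C 4) m ÷ 1 ≃ (1ℚᵘ + δ m) * ((m ℕ.^ 2) ÷ 4)))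
    × ((∃[ δ ] (δ →0) × (∀ m → 0 ℕ.< m → (1ℚᵘ + δ m) * (m ÷ 6) ^ 3 ≤ ρ (C 6) m ÷ 1))
    × (∀ m → 0 ℕ.< m → ρ (C 6) m ÷ 1 ≤ (3 ÷ 1) * (m ÷ 6) ^ 3))
    × (∀ k l → k ≡ 2 ℕ.* l → 8 ℕ.≤ k →
    (∃[ δ ] (δ →0) × (∀ m → 0 ℕ.< m → (1ℚᵘ + δ m) * (m ÷ k) ^ l ≤ ρ (C k) m ÷ 1))
    × (∀ m → 0 ℕ.< m →
    (ρ (C k) m ÷ 1 ≤ (m ÷ (2 ℕ.* l)) ^ l * (1ℚᵘ + 1 ÷ (l ∸ 1)) ^ (l ∸ 1))
    × (fromℚᵘ ((m ÷ (2 ℕ.* l)) ^ l * (1ℚᵘ + 1 ÷ (l ∸ 1)) ^ (l ∸ 1)) ≤ᴿ ((m ÷ k) ^ l) · e)))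
theorem1p6 = 4-cycle-asymptotics , (even-lower 2 (s≤s (s≤s (s≤s z≤n))) , 6-cycle-upper) , long
  where
  long : ∀ k l → k ≡ 2 ℕ.* l → 8 ℕ.≤ k →
    (∃[ δ ] (δ →0) × (∀ m → 0 ℕ.< m → (1ℚᵘ + δ m) * (m ÷ k) ^ l ≤ ρ (C k) m ÷ 1))
    × (∀ m → 0 ℕ.< m →
    (ρ (C k) m ÷ 1 ≤ (m ÷ (2 ℕ.* l)) ^ l * (1ℚᵘ + 1 ÷ (l ∸ 1)) ^ (l ∸ 1))
    × (fromℚᵘ ((m ÷ (2 ℕ.* l)) ^ l * (1ℚᵘ + 1 ÷ (l ∸ 1)) ^ (l ∸ 1)) ≤ᴿ ((m ÷ k) ^ l) · e))
  -- Cancelling 2 leaves l = 4 + s, so the process runs with r = 2 + s, as the condition `2 ≤ r`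
  -- demands.
  long k l refl 8≤2l with ℕ.m≤n⇒∃[o]m+o≡n (ℕ.*-cancelˡ-≤ {4} {l} 2 8≤2l)
  ... | s , refl =
    subst (λ k → ∃[ δ ] (δ →0) × (∀ m → 0 ℕ.< m → (1ℚᵘ + δ m) * (m ÷ k) ^ l ≤ ρ (C k) m ÷ 1)) (ℕ.*-comm l 2)
      (even-lower (3 ℕ.+ s) (s≤s (s≤s (s≤s z≤n)))) ,
    λ m 0<m → subst (λ k → ρ (C k) m ÷ 1 ≤ (m ÷ (2 ℕ.* l)) ^ l * (1ℚᵘ + 1 ÷ (l ∸ 1)) ^ (l ∸ 1)) (ℕ.*-comm l 2)
        (even-upper (2 ℕ.+ s) (s≤s (s≤s z≤n)) m 0<m) ,
      ≤⇒·e ((m ÷ (2 ℕ.* l)) ^ l) (0≤^ m (2 ℕ.* l) l z<s) (2 ℕ.+ s)
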